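{- Let $n>1$ be an odd integer. For integers $k\geq 0$ define $$c_q(k)=(-1)^k\frac{(1+q^{4k+1})(q^{2};q^{4})^3_k}{(1+q)(q^{4};q^{4})^3_k}q^{2k^2+2k}.$$ Then, modulo $\Phi_n(-q)^4\Phi_n(q)^2$, $$\sum_{k=0}^{n-1}\sum_{j=0}^{k}c_q(j)c_q(k-j)\equiv [n]^2_{q^2}\,q^{(n-1)^2}\bigg(\sum_{k=0}^{\frac{n-1}{2}}\frac{(q^{2};q^{4})^3_k}{(q^{4},q^{3},q^{5};q^{4})_k}q^{2k}\bigg)^2.$$
   Context: Here $q$ is an indeterminate. The $q$-shifted factorial is $(a;q)_0=1$, $(a;q)_m=(1-a)(1-aq)\cdots(1-aq^{m-1})$ for $m\geq1$, and $(a_1,\dots,a_s;q)_m=(a_1;q)_m\cdots(a_s;q)_m$. $[m]_{q^2}=1+q^2+\cdots+q^{2(m-1)}$. $\Phi_n(q)$ denotes the $n$-th cyclotomic polynomial in $q$. A congruence between rational functions in $q$ modulo a polynomial $P(q)$ means that the numerator of the difference (in reduced form) is divisible by $P(q)$ while its denominator is coprime to $P(q)$. -}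

module Defs where

open import Data.Nat as ℕ using (ℕ; zero; suc; _∸_)
open import Data.Nat.Divisibility using (_∣?_)
open import Data.Integer as ℤ using (ℤ; +_; -_)
open import Data.List using (List; []; _∷_; map; replicate; _++_; foldr)
open import Data.List.Relation.Unary.All using (All)
open import Data.Product using (_×_; _,_; proj₁; proj₂; Σ; ∃)
open import Data.Bool using (if_then_else_)
open import Relation.Nullary using (does; ¬_)
open import Relation.Binary.PropositionalEquality using (_≡_)

-- Polynomials in q with integer coefficients (little-endian lists).

Poly : Set
Poly = List ℤ

infixl 6 _+P_ _-P_
infixl 7 _*P_

_+P_ : Poly → Poly → Poly
[] +P q = q
(a ∷ p) +P [] = a ∷ p
(a ∷ p) +P (b ∷ q) = (a ℤ.+ b) ∷ (p +P q)

negP : Poly → Poly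
negP = map (-_)

_-P_ : Poly → Poly → Poly
p -P q = p +P negP q

scaleP : ℤ → Poly → Poly
scaleP c = map (c ℤ.*_)

_*P_ : Poly → Poly → Poly
[] *P q = []
(a ∷ p) *P q = scaleP a q +P (+ 0 ∷ (p *P q))

constP : ℤ → Poly
constP c = c ∷ []

oneP : Poly
oneP = constP (+ 1)

qpow : ℕ → Poly
qpow k = replicate k (+ 0) ++ (+ 1 ∷ [])

-- substitution q ↦ -q
altP : Poly → Poly
altP [] = []
altP (a ∷ p) = a ∷ negP (altP p)

-- equality of polynomials (up to trailing zeros)
IsZeroP : Poly → Set
IsZeroP p = All (_≡ + 0) p

infix 4 _≈P_
_≈P_ : Poly → Poly → Set
p ≈P q = IsZeroP (p -P q)

-- Rational functions in q, as (numerator , denominator), not reduced.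

Frac : Set
Frac = Poly × Poly

poly→F : Poly → Frac
poly→F p = p , oneP

zeroF oneF : Frac
zeroF = [] , oneP
oneF = oneP , oneP

infixl 6 _+F_
infixl 7 _*F_ _/F_

_+F_ : Frac → Frac → Frac
(a , b) +F (c , d) = (a *P d +P c *P b) , (b *P d)

_*F_ : Frac → Frac → Frac
(a , b) *F (c , d) = (a *P c) , (b *P d)

_/F_ : Frac → Frac → Frac
(a , b) /F (c , d) = (a *P d) , (b *P c)

powF : Frac → ℕ → Frac
powF x zero = oneF
powF x (suc k) = powF x k *F x

altF : Frac → Frac
altF (a , b) = altP a , altP b

sumF : (ℕ → Frac) → ℕ → Frac
sumF f zero = zeroF
sumF f (suc m) = sumF f m +F f m

prodF : List Frac → Frac
prodF = foldr _*F_ oneF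

-- Cyclotomic polynomials, via  q^n - 1 = ∏_{d ∣ n} Φ_d(q).

private
  divFilter : ℕ → List (ℕ × Frac) → List Frac
  divFilter n [] = []
  divFilter n ((d , f) ∷ xs) =
    if does (d ∣? n) then f ∷ divFilter n xs else divFilter n xs

newΦ : ℕ → List (ℕ × Frac) → Frac
newΦ n prev = poly→F (qpow n -P oneP) /F prodF (divFilter n prev)

cycUpTo : ℕ → List (ℕ × Frac)
cycUpTo zero = []
cycUpTo (suc m) = cycUpTo m ++ ((suc m , newΦ (suc m) (cycUpTo m)) ∷ [])

-- Φ_n(q) as a (non-reduced) quotient of polynomials; Φ_0 := 1 (unused)
Φ : ℕ → Frac
Φ zero = oneF
Φ (suc m) = newΦ (suc m) (cycUpTo m)

-- V is coprime to P = A/B (over ℚ[q]):  s V + t P = c  for a nonzero integer c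
CoprimeTo : Poly → Frac → Set
CoprimeTo V (A , B) =
  Σ Poly λ s → Σ Poly λ t → Σ ℤ λ c → ¬ (c ≡ + 0) ×
    (s *P V *P B +P t *P A ≈P scaleP c B)

-- X ≡ Y (mod P): writing X - Y = N/D, there are U, V with V coprime to P
-- and V·N = P·U·D, i.e. X - Y = P·U/V.
infix 4 _≡F_[mod_]
_≡F_[mod_] : Frac → Frac → Frac → Set
(N₁ , D₁) ≡F (N₂ , D₂) [mod (A , B) ] =
  Σ Poly λ U → Σ Poly λ V → CoprimeTo V (A , B) ×
    (V *P (N₁ *P D₂ -P N₂ *P D₁) *P B ≈P A *P U *P (D₁ *P D₂))

poch4 : ℕ → ℕ → Poly
poch4 m zero = oneP
poch4 m (suc k) = poch4 m k *P (oneP -P qpow (m ℕ.+ 4 ℕ.* k))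

cube : Poly → Poly
cube p = p *P p *P p

sign : ℕ → ℤ
sign zero = + 1
sign (suc k) = - sign k

cq : ℕ → Frac
cq k =
  scaleP (sign k) ((oneP +P qpow (4 ℕ.* k ℕ.+ 1)) *P cube (poch4 2 k)
                   *P qpow (2 ℕ.* k ℕ.* k ℕ.+ 2 ℕ.* k))
  , ((oneP +P qpow 1) *P cube (poch4 4 k))

qint2 : ℕ → Poly
qint2 zero = []
qint2 (suc m) = qint2 m +P qpow (2 ℕ.* m)

lhs : ℕ → Frac
lhs n = sumF (λ k → sumF (λ j → cq j *F cq (k ∸ j)) (suc k)) n

innerSum : ℕ → Frac
innerSum n = sumF (λ k → (cube (poch4 2 k) *P qpow (2 ℕ.* k))
                         , (poch4 4 k *P poch4 3 k *P poch4 5 k))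
                  (suc ((n ∸ 1) ℕ./ 2))

rhs : ℕ → Frac
rhs n = poly→F (qint2 n *P qint2 n *P qpow ((n ∸ 1) ℕ.* (n ∸ 1)))
        *F (innerSum n *F innerSum n)

modulus : ℕ → Frac
modulus n = powF (altF (Φ n)) 4 *F powF (Φ n) 2

-- Put a = q², P = q⁴, n = 2m + 1, and let c_X(k) be c_q(k) with each (1 − aP^i)² in the numerator
-- replaced by (1 − aP^i)² − X aP^i and each (1 − P^(i+1))² in the denominator by
-- (1 − P^(i+1))² − X P^(i+1).  At z = (1 − q^2n)²/q^2n these split, and Watson's transformation (obtained
-- here from a Bailey pair: a terminating ₆φ₅ sum and a q-Vandermonde sum) evaluates Σ_{k ≤ m} c_z(k)
-- as ± the right-hand square root with the same deformation.
--
-- If q^n = −1, then c_X(k) = − c_X(m − k), so Σ_{k ≤ m} c_X(k) is divisible by 1 + q^n for indeterminate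
-- X; comparing X = z with X = 0 gives Σ_{k ≤ m} c_0(k) ≡ ± the right-hand square root modulo
-- (1 + q^n)(1 − q^2n)².  The remaining terms of the double sum contain (1 − q^2n)³ times a sum
-- that vanishes by the same reflection.  So the congruence holds modulo (1 + q^n)⁴ (1 − q^n)², with
-- denominators composed of q, 2, 1 + q and 1 − q^e with n ∤ e.
--
-- Finally Φ_n(−q)⁴ Φ_n(q)² divides this modulus up to a constant, and is coprime over ℚ to those
-- denominators, because (q^n − 1)/(q^g − 1) ≡ n/g modulo q^g − 1 for g = gcd(n, e).

module Submission where

open import Algebra.Bundles using (CommutativeMonoid; CommutativeRing)
open import Data.Bool.Base using (Bool; true; false; if_then_else_) renaming (T to So)
open import Data.Integer.Base as ℤ using (ℤ; -[1+_])
import Data.Integer.Properties as ℤₚ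
import Data.Integer.Solver as ℤSolver
open import Data.List.Base using (List; []; _∷_; _++_)
open import Data.List.Relation.Unary.All using ([]; _∷_)
open import Data.Maybe.Base using (nothing)
open import Data.Nat using (ℕ; _<_; _%_)
open import Data.Nat.Base as ℕ using (zero; suc; _∸_; _/_; _≤_; s≤s; z≤n)
open import Data.Nat.Divisibility using (_∣_; _∤_; _∣?_; _∣0; divides; ∣-antisym; ∣-refl; ∣-trans; ∣⇒≤; ∣m+n∣m⇒∣n; ∣m⇒∣m*n; m∣m*n; >⇒∤)
open import Data.Nat.DivMod using (m*n/n≡m; m≡m%n+[m/n]*n)
open import Data.Nat.GCD using (gcd; gcd-GCD; gcd[m,n]∣m; gcd[m,n]∣n; module Bézout)
import Data.Nat.Properties as ℕₚ
open import Data.Nat.Tactic.RingSolver using (solve-∀)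
open import Data.Product.Base using (Σ; Σ-syntax; _×_; _,_; proj₁; proj₂)
open import Data.Sum.Base using (inj₁; inj₂; [_,_]′)
open import Defs
open import Function.Base using (_∘_; _$_; flip)
open import Level using (0ℓ)
open import Relation.Binary.PropositionalEquality as ≡ using (_≡_; _≢_)
open import Relation.Binary.Structures using (IsEquivalence)
open import Relation.Nullary using (¬_; yes; no; does)
open import Relation.Nullary.Decidable using (dec-true; dec-false)
open import Relation.Nullary.Negation using (contradiction)
open import Tactic.RingSolver.Core.Polynomial.Parameters using (Homomorphism)

-- Two obstacles shape the argument. The element z is itself divisible by (1 + q^n)². Divisibility
-- of both sums, at X = 0 and at X = z, by 1 + q^n and of their difference by z would therefore not
-- give divisibility of the difference by (1 + q^n) z. The reflection is carried out in the ring
-- with X adjoined subject to X² = zX, which still specialises to both values: there the sum is (1 +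
-- q^n)(u₀ + u₁X), and the difference is (1 + q^n) u₁ z. Squaring gains another factor 1 + q^n,
-- since both roots contain one. The inner sum has 1 - q^n among its denominators, through (q³, q⁵;
-- q⁴)_k, so the right-hand side cannot be formed term by term in the local ring L that carries the
-- congruence. It is formed in the larger ring K of all fractions and shown to come from L: the
-- bracket [n] in q² supplies the missing 1 - q^n and a factor 1 + q^n besides. The deformation is
-- chosen because (1 - y)² - Xy = (1 - uy)(1 - y/u) for X = (1 - u)²/u. It moves two of the three
-- parameters a to au and a/u, and u = q^(2n) makes a/u = P^(-m).

CRing : Set₁
CRing = CommutativeRing 0ℓ 0ℓ

-- A ring solver with integer coefficients

module IntegerSolver (R : CRing) where
  open CommutativeRing R
  open import Algebra.Properties.Ring ring
  open import Algebra.Properties.AbelianGroup +-abelianGroup using (⁻¹-∙-comm)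
  open import Algebra.Properties.Semiring.Mult.TCOptimised semiring renaming (_×_ to infixl 8 _⨯_)
  open import Relation.Binary.Reasoning.Setoid setoid
  open import Tactic.RingSolver.Core.AlmostCommutativeRing
    using (fromCommutativeRing; _-Raw-AlmostCommutative⟶_)

  fromℤ : ℤ → Carrier
  fromℤ (ℤ.+ n)  = n ⨯ 1#
  fromℤ -[1+ n ] = - (suc n ⨯ 1#)

  private
    fromℤ-⊖ : ∀ m n → fromℤ (m ℤ.⊖ n) ≈ m ⨯ 1# - n ⨯ 1#
    fromℤ-⊖ m zero = sym (trans (+-congˡ -0#≈0#) (+-identityʳ _))
    fromℤ-⊖ zero (suc n) = sym (+-identityˡ _)
    fromℤ-⊖ (suc m) (suc n) = begin
      fromℤ (suc m ℤ.⊖ suc n)              ≡⟨ ≡.cong fromℤ (ℤₚ.[1+m]⊖[1+n]≡m⊖n m n) ⟩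
      fromℤ (m ℤ.⊖ n)                      ≈⟨ fromℤ-⊖ m n ⟩
      m ⨯ 1# - n ⨯ 1#                      ≈⟨ +-congʳ (+-identityˡ _) ⟨
      (0# + m ⨯ 1#) - n ⨯ 1#               ≈⟨ +-congʳ (+-congʳ (-‿inverseʳ 1#)) ⟨
      ((1# - 1#) + m ⨯ 1#) - n ⨯ 1#        ≈⟨ +-congʳ (+-assoc _ _ _) ⟩
      (1# + (- 1# + m ⨯ 1#)) - n ⨯ 1#      ≈⟨ +-congʳ (+-congˡ (+-comm _ _)) ⟩
      (1# + (m ⨯ 1# - 1#)) - n ⨯ 1#        ≈⟨ +-congʳ (+-assoc _ _ _) ⟨
      ((1# + m ⨯ 1#) - 1#) - n ⨯ 1#        ≈⟨ +-assoc _ _ _ ⟩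
      (1# + m ⨯ 1#) + (- 1# - n ⨯ 1#)      ≈⟨ +-congˡ (⁻¹-∙-comm _ _) ⟩
      (1# + m ⨯ 1#) - (1# + n ⨯ 1#)        ≈⟨ +-cong (1+× m 1#) (-‿cong (1+× n 1#)) ⟨
      suc m ⨯ 1# - suc n ⨯ 1#              ∎

    fromℤ-neg : ∀ i → fromℤ (ℤ.- i) ≈ - fromℤ i
    fromℤ-neg (ℤ.+ zero)    = sym -0#≈0#
    fromℤ-neg (ℤ.+ (suc n)) = refl
    fromℤ-neg -[1+ n ]      = sym (-‿involutive _)

    fromℤ-+ : ∀ i j → fromℤ (i ℤ.+ j) ≈ fromℤ i + fromℤ j
    fromℤ-+ (ℤ.+ m)  (ℤ.+ n)  = ×-homo-+ 1# m n
    fromℤ-+ (ℤ.+ m)  -[1+ n ] = fromℤ-⊖ m (suc n)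
    fromℤ-+ -[1+ m ] (ℤ.+ n)  = trans (fromℤ-⊖ n (suc m)) (+-comm _ _)
    fromℤ-+ -[1+ m ] -[1+ n ] = begin
      - (suc (suc (m ℕ.+ n)) ⨯ 1#)     ≡⟨ ≡.cong (λ k → - (suc k ⨯ 1#)) (ℕₚ.+-suc m n) ⟨
      - ((suc m ℕ.+ suc n) ⨯ 1#)       ≈⟨ -‿cong (×-homo-+ 1# (suc m) (suc n)) ⟩
      - (suc m ⨯ 1# + suc n ⨯ 1#)      ≈⟨ ⁻¹-∙-comm _ _ ⟨
      - (suc m ⨯ 1#) - suc n ⨯ 1#      ∎

    fromℤ-*⁺ : ∀ m j → fromℤ (ℤ.+ m ℤ.* j) ≈ fromℤ (ℤ.+ m) * fromℤ j
    fromℤ-*⁺ m (ℤ.+ n) = trans (reflexive (≡.cong fromℤ (≡.sym (ℤₚ.pos-* m n)))) (×1-homo-* m n)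
    fromℤ-*⁺ m -[1+ n ] = begin
      fromℤ (ℤ.+ m ℤ.* -[1+ n ])          ≡⟨ ≡.cong fromℤ (ℤₚ.neg-distribʳ-* (ℤ.+ m) (ℤ.+ suc n)) ⟨
      fromℤ (ℤ.- (ℤ.+ m ℤ.* ℤ.+ suc n))   ≈⟨ fromℤ-neg (ℤ.+ m ℤ.* ℤ.+ suc n) ⟩
      - fromℤ (ℤ.+ m ℤ.* ℤ.+ suc n)       ≈⟨ -‿cong (fromℤ-*⁺ m (ℤ.+ suc n)) ⟩
      - (fromℤ (ℤ.+ m) * (suc n ⨯ 1#))    ≈⟨ -‿distribʳ-* _ _ ⟩
      fromℤ (ℤ.+ m) * - (suc n ⨯ 1#)      ∎

    fromℤ-* : ∀ i j → fromℤ (i ℤ.* j) ≈ fromℤ i * fromℤ j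
    fromℤ-* (ℤ.+ m) j = fromℤ-*⁺ m j
    fromℤ-* -[1+ m ] j = begin
      fromℤ (-[1+ m ] ℤ.* j)               ≡⟨ ≡.cong fromℤ (ℤₚ.neg-distribˡ-* (ℤ.+ suc m) j) ⟨
      fromℤ (ℤ.- (ℤ.+ suc m ℤ.* j))        ≈⟨ fromℤ-neg (ℤ.+ suc m ℤ.* j) ⟩
      - fromℤ (ℤ.+ suc m ℤ.* j)            ≈⟨ -‿cong (fromℤ-*⁺ (suc m) j) ⟩
      - ((suc m ⨯ 1#) * fromℤ j)           ≈⟨ -‿distribˡ-* _ _ ⟩
      - (suc m ⨯ 1#) * fromℤ j             ∎

    -- Equality in the ring is not decidable, so cancellation has to be detected on the
    -- coefficients; this is why they are integers and not ring elements.
    isZero : ℤ → Bool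
    isZero (ℤ.+ zero) = true
    isZero _          = false

    isZero-sound : ∀ i → So (isZero i) → 0# ≈ fromℤ i
    isZero-sound (ℤ.+ zero) _ = refl

    homo : Homomorphism 0ℓ 0ℓ 0ℓ 0ℓ
    homo = record
      { from = record { rawRing = CommutativeRing.rawRing ℤₚ.+-*-commutativeRing ; isZero = isZero }
      ; to = fromCommutativeRing R (λ _ → nothing)
      ; morphism = record
        { ⟦_⟧    = fromℤ
        ; +-homo = fromℤ-+
        ; *-homo = fromℤ-*
        ; -‿homo = fromℤ-neg
        ; 0-homo = refl
        ; 1-homo = refl
        }
      ; Zero-C⟶Zero-R = isZero-sound
      }

  open import Data.Vec.Base using (Vec)
  open import Tactic.RingSolver.Core.Expression public
    using (Expr; Κ; Ι; _⊕_; _⊗_; ⊝_; module Eval)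
  open Expr
  open Eval rawRing fromℤ
  open import Tactic.RingSolver.Core.Polynomial.Base (Homomorphism.from homo) renaming (Poly to Normal)
  open import Algebra.Properties.Semiring.Exp.TCOptimised semiring using (^-congˡ)

  private
    norm : ∀ {n} → Expr ℤ n → Normal n
    norm (Κ x)   = κ x
    norm (Ι x)   = ι x
    norm (x ⊕ y) = norm x ⊞ norm y
    norm (x ⊗ y) = norm x ⊠ norm y
    norm (⊝ x)   = ⊟ norm x
    norm (x ⊛ i) = norm x ⊡ i

  ⟦_⇓⟧ : ∀ {n} → Expr ℤ n → Vec Carrier n → Carrier
  ⟦ expr ⇓⟧ = ⟦ norm expr ⟧ₚ
    where open import Tactic.RingSolver.Core.Polynomial.Semantics homo renaming (⟦_⟧ to ⟦_⟧ₚ)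

  correct : ∀ {n} (expr : Expr ℤ n) ρ → ⟦ expr ⇓⟧ ρ ≈ ⟦ expr ⟧ ρ
  correct = go
    where
    open import Tactic.RingSolver.Core.Polynomial.Homomorphism homo
    go : ∀ {n} (expr : Expr ℤ n) ρ → ⟦ expr ⇓⟧ ρ ≈ ⟦ expr ⟧ ρ
    go (Κ x)   ρ = κ-hom x ρ
    go (Ι x)   ρ = ι-hom x ρ
    go (x ⊕ y) ρ = trans (⊞-hom (norm x) (norm y) ρ) (+-cong (go x ρ) (go y ρ))
    go (x ⊗ y) ρ = trans (⊠-hom (norm x) (norm y) ρ) (*-cong (go x ρ) (go y ρ))
    go (⊝ x)   ρ = trans (⊟-hom (norm x) ρ) (-‿cong (go x ρ))
    go (x ⊛ i) ρ = trans (⊡-hom (norm x) i ρ) (^-congˡ i (go x ρ))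

  open import Relation.Binary.Reflection setoid Ι ⟦_⟧ ⟦_⇓⟧ correct public using (solve)

  infix 4 _⊜_
  infixl 6 _⊖_
  _⊜_ : ∀ {n} → Expr ℤ n → Expr ℤ n → Expr ℤ n × Expr ℤ n
  _⊜_ = _,_

  _⊖_ : ∀ {n} → Expr ℤ n → Expr ℤ n → Expr ℤ n
  x ⊖ y = x ⊕ ⊝ y

  𝟙 : ∀ {n} → Expr ℤ n
  𝟙 = Κ (ℤ.+ 1)

-- Finite sums and products

∸-suc : ∀ {k n} → k < n → n ∸ k ≡ suc (n ∸ suc k)
∸-suc k<n = ℕₚ.+-∸-assoc 1 k<n

fold : {A : Set} → (A → A → A) → A → (ℕ → A) → ℕ → A
fold _∙_ ε f zero    = ε
fold _∙_ ε f (suc n) = fold _∙_ ε f n ∙ f n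

module BigOp (M : CommutativeMonoid 0ℓ 0ℓ) where
  open CommutativeMonoid M
  open import Relation.Binary.Reasoning.Setoid setoid
  open import Algebra.Properties.CommutativeSemigroup commutativeSemigroup using (interchange)

  ⨁ : (ℕ → Carrier) → ℕ → Carrier
  ⨁ = fold _∙_ ε

  ⨁-cong : ∀ {f g} n → (∀ i → i < n → f i ≈ g i) → ⨁ f n ≈ ⨁ g n
  ⨁-cong zero    h = refl
  ⨁-cong (suc n) h = ∙-cong (⨁-cong n λ i i<n → h i (ℕₚ.m<n⇒m<1+n i<n)) (h n ℕₚ.≤-refl)

  ⨁-∙ : ∀ f g n → ⨁ (λ i → f i ∙ g i) n ≈ ⨁ f n ∙ ⨁ g n
  ⨁-∙ f g zero    = sym (identityˡ ε)
  ⨁-∙ f g (suc n) = trans (∙-congʳ (⨁-∙ f g n)) (interchange _ _ _ _)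

  ⨁-++ : ∀ f m n → ⨁ f (m ℕ.+ n) ≈ ⨁ f m ∙ ⨁ (λ i → f (m ℕ.+ i)) n
  ⨁-++ f m zero rewrite ℕₚ.+-identityʳ m = sym (identityʳ _)
  ⨁-++ f m (suc n) rewrite ℕₚ.+-suc m n = trans (∙-congʳ (⨁-++ f m n)) (assoc _ _ _)

  ⨁-first : ∀ f n → ⨁ f (suc n) ≈ f 0 ∙ ⨁ (f ∘ suc) n
  ⨁-first f n = trans (⨁-++ f 1 n) (∙-congʳ (identityˡ _))

  -- Reversal is phrased with pairs i + j + 1 = n, so that users can induct on such pairs without
  -- truncated subtraction.
  ⨁-reverse : ∀ {f g} n → (∀ i j → suc (i ℕ.+ j) ≡ n → f i ≈ g j) → ⨁ f n ≈ ⨁ g n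
  ⨁-reverse zero    h = refl
  ⨁-reverse {f} {g} (suc n) h = begin
    ⨁ f n ∙ f n            ≈⟨ ∙-cong (⨁-reverse n (λ i j p → h i (suc j) (≡.cong suc (≡.trans (ℕₚ.+-suc i j) p))))
                                     (h n 0 (≡.cong suc (ℕₚ.+-identityʳ n))) ⟩
    ⨁ (g ∘ suc) n ∙ g 0    ≈⟨ comm _ _ ⟩
    g 0 ∙ ⨁ (g ∘ suc) n    ≈⟨ ⨁-first g n ⟨
    ⨁ g (suc n)            ∎

  △ : (ℕ → ℕ → Carrier) → ℕ → Carrier
  △ F n = ⨁ (λ k → ⨁ (λ j → F j (k ∸ j)) (suc k)) n

  △-rows : ∀ F n → △ F n ≈ ⨁ (λ j → ⨁ (F j) (n ∸ j)) n
  △-rows F zero    = refl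
  △-rows F (suc n) = begin
    △ F n ∙ ⨁ (λ j → F j (n ∸ j)) (suc n)                                  ≈⟨ ∙-congʳ (△-rows F n) ⟩
    ⨁ (λ j → ⨁ (F j) (n ∸ j)) n ∙ ⨁ (λ j → F j (n ∸ j)) (suc n)            ≈⟨ ∙-congʳ (identityʳ _) ⟨
    -- The neutral element is read as row j = n, which is empty; both sums then run over j ≤ n and
    -- merge row by row.
    (⨁ (λ j → ⨁ (F j) (n ∸ j)) n ∙ ε) ∙ ⨁ (λ j → F j (n ∸ j)) (suc n)
      ≡⟨ ≡.cong (λ l → (⨁ (λ j → ⨁ (F j) (n ∸ j)) n ∙ ⨁ (F n) l) ∙ ⨁ (λ j → F j (n ∸ j)) (suc n)) (ℕₚ.n∸n≡0 n) ⟨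
    ⨁ (λ j → ⨁ (F j) (n ∸ j)) (suc n) ∙ ⨁ (λ j → F j (n ∸ j)) (suc n)      ≈⟨ ⨁-∙ _ _ (suc n) ⟨
    ⨁ (λ j → ⨁ (F j) (suc (n ∸ j))) (suc n)
      ≈⟨ ⨁-cong (suc n) (λ j j<1+n → reflexive (≡.cong (⨁ (F j)) (≡.sym (ℕₚ.+-∸-assoc 1 (ℕₚ.≤-pred j<1+n))))) ⟩
    ⨁ (λ j → ⨁ (F j) (suc n ∸ j)) (suc n)                                  ∎

  △-flip : ∀ F n → △ F n ≈ △ (flip F) n
  △-flip F n = ⨁-cong n λ k _ → ⨁-reverse (suc k) λ i j p →
    let i+j≡k = ℕₚ.suc-injective p in
    reflexive (≡.cong₂ F (≡.trans (≡.sym (ℕₚ.m+n∸n≡m i j)) (≡.cong (_∸ j) i+j≡k))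
                         (≡.trans (≡.cong (_∸ i) (≡.sym i+j≡k)) (ℕₚ.m+n∸m≡n i j)))

-- Operations without laws or equality. A ring and its quotients have the same `Ops`, so a sum or
-- series written over them is literally the same expression in the ring and modulo an element.
record Ops (A : Set) : Set where
  infixl 6 _+_ _-_
  infixl 7 _*_
  field
    _+_ _*_ : A → A → A
    -_      : A → A
    0# 1#   : A
  _-_ : A → A → A
  x - y = x + (- y)
  sum prod : (ℕ → A) → ℕ → A
  sum  = fold _+_ 0#
  prod = fold _*_ 1#
  infixr 8 _^_
  _^_ : A → ℕ → A
  x ^ n = prod (λ _ → x) n

ops : (R : CRing) → Ops (CommutativeRing.Carrier R)
ops R = record { CommutativeRing R }

module RingKit (R : CRing) where
  open CommutativeRing R
  open Ops (ops R) public using (sum; prod; _^_)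
  open IntegerSolver R public using (Expr; Κ; Ι; _⊕_; _⊗_; ⊝_; solve; _⊜_; _⊖_; 𝟙)
  open import Algebra.Properties.Ring ring public using (-‿distribˡ-*; -‿distribʳ-*; -0#≈0#)
  open import Relation.Binary.Reasoning.Setoid setoid
  open BigOp +-commutativeMonoid public
    using (△)
    renaming ( ⨁-cong to sum-cong; ⨁-∙ to sum-+; ⨁-++ to sum-++; ⨁-first to sum-first
             ; ⨁-reverse to sum-reverse; △-rows to △-rows; △-flip to △-flip)
  open BigOp *-commutativeMonoid public
    using ()
    renaming ( ⨁-cong to prod-cong; ⨁-∙ to prod-*; ⨁-++ to prod-++; ⨁-first to prod-first
             ; ⨁-reverse to prod-reverse)

  *-distribˡ-sum : ∀ x f n → x * sum f n ≈ sum (λ i → x * f i) n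
  *-distribˡ-sum x f zero    = zeroʳ x
  *-distribˡ-sum x f (suc n) = trans (distribˡ x _ _) (+-congʳ (*-distribˡ-sum x f n))

  *-distribʳ-sum : ∀ x f n → sum f n * x ≈ sum (λ i → f i * x) n
  *-distribʳ-sum x f zero    = zeroˡ x
  *-distribʳ-sum x f (suc n) = trans (distribʳ x _ _) (+-congʳ (*-distribʳ-sum x f n))

  -‿sum : ∀ f n → - sum f n ≈ sum (λ i → - f i) n
  -‿sum f zero    = -0#≈0#
  -‿sum f (suc n) = trans (solve 2 (λ x y → ⊝ (x ⊕ y) ⊜ ⊝ x ⊕ ⊝ y) refl (sum f n) (f n)) (+-congʳ (-‿sum f n))

  ^-+ : ∀ x m n → x ^ (m ℕ.+ n) ≈ x ^ m * x ^ n
  ^-+ x m n = prod-++ (λ _ → x) m n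

  *-^ : ∀ x y n → (x * y) ^ n ≈ x ^ n * y ^ n
  *-^ x y n = prod-* (λ _ → x) (λ _ → y) n

  ^-cong : ∀ {x y} n → x ≈ y → x ^ n ≈ y ^ n
  ^-cong n p = prod-cong n (λ _ _ → p)

  1^ : ∀ n → 1# ^ n ≈ 1#
  1^ zero    = refl
  1^ (suc n) = trans (*-identityʳ _) (1^ n)

  ^-* : ∀ x m n → x ^ (m ℕ.* n) ≈ (x ^ n) ^ m
  ^-* x zero    n = refl
  ^-* x (suc m) n = trans (^-+ x n (m ℕ.* n)) (trans (*-congˡ (^-* x m n)) (*-comm _ _))

  cancel-unit : ∀ {u v} x y → u * v ≈ 1# → u * x ≈ u * y → x ≈ y
  cancel-unit {u} {v} x y uv eq = begin
    x             ≈⟨ *-identityˡ x ⟨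
    1# * x        ≈⟨ *-congʳ uv ⟨
    (u * v) * x   ≈⟨ solve 3 (λ u v x → (u ⊗ v) ⊗ x ⊜ v ⊗ (u ⊗ x)) refl u v x ⟩
    v * (u * x)   ≈⟨ *-congˡ eq ⟩
    v * (u * y)   ≈⟨ solve 3 (λ u v x → (u ⊗ v) ⊗ x ⊜ v ⊗ (u ⊗ x)) refl u v y ⟨
    (u * v) * y   ≈⟨ *-congʳ uv ⟩
    1# * y        ≈⟨ *-identityˡ y ⟩
    y             ∎

-- The deformed series and its building blocks

module Sequences {A : Set} (O : Ops A) (q : A) where
  open Ops O

  a P : A
  a = q * q
  P = a * a

  -- In exponents of q, `ε k` is (-1)^k q^(2k²), the sign and power on the right-hand side before
  -- squaring. The other two are (P;P)_k and (a;P)_k.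
  ε pochP pocha : ℕ → A
  ε     = prod (λ i → - (a * P ^ i))
  pochP = prod (λ i → 1# - P ^ suc i)
  pocha = prod (λ i → 1# - a * P ^ i)

  numX denX : A → ℕ → A
  numX X i = (1# - a * P ^ i) * (1# - a * P ^ i) - X * (a * P ^ i)
  denX X i = (1# - P ^ suc i) * (1# - P ^ suc i) - X * P ^ suc i

  -- The arguments r, v i and w i stand for the inverses of 1 + q, 1 - P^(i+1) and `denX X i`. They
  -- are arbitrary here because in the local ring these inverses exist only for some i; each use
  -- supplies the range it needs.
  module Series (r : A) (v w : ℕ → A) (X : A) where
    ratio d c : ℕ → A
    ratio i = - (P ^ suc i * (((1# - a * P ^ i) * numX X i) * (v i * w i)))
    d       = prod ratio
    c k     = ((1# + q * P ^ k) * r) * d k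

  -- Multiplied by `prod (numX 0#) k`, which is (a;P)_k squared, this is the k-th term of the inner
  -- sum. The deformed right-hand side differs only in that last factor.
  τ : (v v₃ v₅ : ℕ → A) → ℕ → A
  τ v v₃ v₅ = prod (λ i → ((a * (1# - a * P ^ i)) * v i) * (v₃ i * v₅ i))

-- Watson's transformation at c_z

module Vandermonde (R : CRing) (P a : CommutativeRing.Carrier R) where
  open CommutativeRing R
  open RingKit R
  open import Relation.Binary.Reasoning.Setoid setoid

  qbin : ℕ → ℕ → Carrier
  qbin n       zero    = 1#
  qbin zero    (suc i) = 0#
  qbin (suc n) (suc i) = qbin n (suc i) + P ^ (n ∸ i) * qbin n i

  qbin-above : ∀ n i → n < i → qbin n i ≈ 0#
  qbin-above zero    (suc i) _         = refl
  qbin-above (suc n) (suc i) (s≤s n<i) = begin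
    qbin n (suc i) + P ^ (n ∸ i) * qbin n i  ≈⟨ +-cong (qbin-above n (suc i) (ℕₚ.m<n⇒m<1+n n<i)) (*-congˡ (qbin-above n i n<i)) ⟩
    0# + P ^ (n ∸ i) * 0#                    ≈⟨ solve 1 (λ x → Κ (ℤ.+ 0) ⊕ x ⊗ Κ (ℤ.+ 0) ⊜ Κ (ℤ.+ 0)) refl (P ^ (n ∸ i)) ⟩
    0#                                       ∎

  pochP : ℕ → Carrier
  pochP = prod (λ i → 1# - P ^ suc i)

  qbin-diag : ∀ n → qbin n n ≈ 1#
  qbin-diag zero    = refl
  qbin-diag (suc n) = begin
    qbin n (suc n) + P ^ (n ∸ n) * qbin n n  ≈⟨ +-cong (qbin-above n (suc n) ℕₚ.≤-refl) (*-cong (reflexive (≡.cong (P ^_) (ℕₚ.n∸n≡0 n))) (qbin-diag n)) ⟩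
    0# + 1# * 1#                             ≈⟨ trans (+-identityˡ _) (*-identityˡ _) ⟩
    1#                                       ∎

  qbin-pochP : ∀ i k → qbin (i ℕ.+ k) i * (pochP i * pochP k) ≈ pochP (i ℕ.+ k)
  qbin-pochP zero    k = trans (*-identityˡ _) (*-identityˡ _)
  qbin-pochP (suc i) zero rewrite ℕₚ.+-identityʳ i = begin
    qbin (suc i) (suc i) * (pochP (suc i) * 1#)  ≈⟨ *-cong (qbin-diag (suc i)) (*-identityʳ _) ⟩
    1# * pochP (suc i)                           ≈⟨ *-identityˡ _ ⟩
    pochP (suc i)                                ∎
  qbin-pochP (suc i) (suc k) = begin
    (qbin n (suc i) + P ^ (n ∸ i) * qbin n i) * (pochP (suc i) * pochP (suc k))
      ≡⟨ ≡.cong (λ l → (qbin n (suc i) + P ^ l * qbin n i) * (pochP (suc i) * pochP (suc k))) (ℕₚ.m+n∸m≡n i (suc k)) ⟩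
    (qbin n (suc i) + P ^ suc k * qbin n i) * ((pochP i * (1# - P ^ suc i)) * (pochP k * (1# - P ^ suc k)))
      ≈⟨ solve 6 (λ b b′ x y fi fk → (b ⊕ y ⊗ b′) ⊗ ((fi ⊗ (𝟙 ⊖ x)) ⊗ (fk ⊗ (𝟙 ⊖ y)))
                 ⊜ (b ⊗ ((fi ⊗ (𝟙 ⊖ x)) ⊗ fk)) ⊗ (𝟙 ⊖ y) ⊕ (b′ ⊗ (fi ⊗ (fk ⊗ (𝟙 ⊖ y)))) ⊗ (y ⊗ (𝟙 ⊖ x)))
               refl (qbin n (suc i)) (qbin n i) (P ^ suc i) (P ^ suc k) (pochP i) (pochP k) ⟩
    (qbin n (suc i) * (pochP (suc i) * pochP k)) * (1# - P ^ suc k) + (qbin n i * (pochP i * pochP (suc k))) * (P ^ suc k * (1# - P ^ suc i))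
      ≈⟨ +-cong (*-congʳ (trans (reflexive (≡.cong (λ l → qbin l (suc i) * (pochP (suc i) * pochP k)) (ℕₚ.+-suc i k)))
                                (trans (qbin-pochP (suc i) k) (reflexive (≡.cong pochP (≡.sym (ℕₚ.+-suc i k)))))))
                (*-congʳ (qbin-pochP i (suc k))) ⟩
    pochP n * (1# - P ^ suc k) + pochP n * (P ^ suc k * (1# - P ^ suc i))
      ≈⟨ solve 3 (λ f x y → f ⊗ (𝟙 ⊖ y) ⊕ f ⊗ (y ⊗ (𝟙 ⊖ x)) ⊜ f ⊗ (𝟙 ⊖ x ⊗ y)) refl (pochP n) (P ^ suc i) (P ^ suc k) ⟩
    pochP n * (1# - P ^ suc i * P ^ suc k)
      ≈⟨ *-congˡ (+-congˡ (-‿cong (^-+ P (suc i) (suc k)))) ⟨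
    pochP n * (1# - P ^ suc n)  ∎
    where n = i ℕ.+ suc k

  sg : ℕ → Carrier
  sg = prod (λ l → - P ^ l)

  -- These are a^i (cu/a;P)_i and u^k (cP^i;P)_k. The second is what remains of (c;P)_n / (c;P)_i
  -- when k = n - i, so no division by a or by c-factors is left in `term`.
  lo : (c u : Carrier) → ℕ → Carrier
  hi : (c u : Carrier) → ℕ → ℕ → Carrier
  lo c u i = prod (λ l → a - (c * u) * P ^ l) i
  hi c u i k = prod (λ l → u * (1# - c * P ^ (i ℕ.+ l))) k

  term : (c u : Carrier) → ℕ → ℕ → Carrier
  term c u n i = qbin n i * (sg i * (lo c u i * hi c u i (n ∸ i)))

  -- The q-Chu–Vandermonde sum with denominators cleared; q-Pascal splits the sum for n + 1
  -- into the sums for n with parameters c and cP.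
  vandermonde : ∀ n c u → sum (term c u n) (suc n) ≈ prod (λ l → u - a * P ^ l) n
  vandermonde zero    c u = solve 0 (Κ (ℤ.+ 0) ⊕ 𝟙 ⊗ (𝟙 ⊗ (𝟙 ⊗ 𝟙)) ⊜ 𝟙) refl
  vandermonde (suc n) c u = begin
    sum (term c u (suc n)) (suc (suc n))                                       ≈⟨ sum-first (term c u (suc n)) (suc n) ⟩
    term c u (suc n) 0 + sum (λ i → term c u (suc n) (suc i)) (suc n)
      ≈⟨ +-congˡ (trans (sum-cong (suc n) λ i _ → distribʳ _ _ _) (sum-+ (first ∘ suc) second (suc n))) ⟩
    first 0 + (sum (first ∘ suc) (suc n) + sum second (suc n))                 ≈⟨ +-assoc _ _ _ ⟨
    (first 0 + sum (first ∘ suc) (suc n)) + sum second (suc n)                 ≈⟨ +-congʳ (sum-first first (suc n)) ⟨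
    (sum first (suc n) + first (suc n)) + sum second (suc n)                   ≈⟨ +-congʳ (+-congˡ (trans (*-congʳ (qbin-above n (suc n) ℕₚ.≤-refl)) (zeroˡ _))) ⟩
    (sum first (suc n) + 0#) + sum second (suc n)                              ≈⟨ +-congʳ (+-identityʳ _) ⟩
    sum first (suc n) + sum second (suc n)
      ≈⟨ +-cong (trans (sum-cong (suc n) (λ i i<1+n → first≈ i (ℕₚ.≤-pred i<1+n))) (sym (*-distribʳ-sum _ _ (suc n))))
                (trans (sum-cong (suc n) (λ i i<1+n → second≈ i (ℕₚ.≤-pred i<1+n))) (sym (*-distribʳ-sum _ _ (suc n)))) ⟩
    sum (term c u n) (suc n) * (u * (1# - c * P ^ n)) + sum (term (c * P) u n) (suc n) * (- (P ^ n * (a - c * u)))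
      ≈⟨ +-cong (*-congʳ (vandermonde n c u)) (*-congʳ (vandermonde n (c * P) u)) ⟩
    V * (u * (1# - c * P ^ n)) + V * (- (P ^ n * (a - c * u)))
      ≈⟨ solve 5 (λ V u c p a → V ⊗ (u ⊗ (𝟙 ⊖ c ⊗ p)) ⊕ V ⊗ (⊝ (p ⊗ (a ⊖ c ⊗ u))) ⊜ V ⊗ (u ⊖ a ⊗ p)) refl V u c (P ^ n) a ⟩
    V * (u - a * P ^ n)  ∎
    where
    V = prod (λ l → u - a * P ^ l) n
    first second : ℕ → Carrier
    first i  = qbin n i * (sg i * (lo c u i * hi c u i (suc n ∸ i)))
    second i = (P ^ (n ∸ i) * qbin n i) * (sg (suc i) * (lo c u (suc i) * hi c u (suc i) (n ∸ i)))
    first≈ : ∀ i → i ≤ n → first i ≈ term c u n i * (u * (1# - c * P ^ n))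
    first≈ i i≤n rewrite ℕₚ.+-∸-assoc 1 i≤n = begin
      qbin n i * (sg i * (lo c u i * (hi c u i (n ∸ i) * (u * (1# - c * P ^ (i ℕ.+ (n ∸ i)))))))
        ≡⟨ ≡.cong (λ l → qbin n i * (sg i * (lo c u i * (hi c u i (n ∸ i) * (u * (1# - c * P ^ l)))))) (ℕₚ.m+[n∸m]≡n i≤n) ⟩
      qbin n i * (sg i * (lo c u i * (hi c u i (n ∸ i) * (u * (1# - c * P ^ n)))))
        ≈⟨ solve 5 (λ x y z s t → x ⊗ (y ⊗ (z ⊗ (s ⊗ t))) ⊜ (x ⊗ (y ⊗ (z ⊗ s))) ⊗ t) refl _ _ _ _ _ ⟩
      term c u n i * (u * (1# - c * P ^ n)) ∎
    lo-suc : ∀ i → lo c u (suc i) ≈ (a - c * u) * lo (c * P) u i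
    lo-suc i = trans (prod-first (λ l → a - (c * u) * P ^ l) i)
      (*-cong (+-congˡ (-‿cong (*-identityʳ _)))
              (prod-cong i λ l _ → solve 5 (λ a c u p P → a ⊖ (c ⊗ u) ⊗ (p ⊗ P) ⊜ a ⊖ ((c ⊗ P) ⊗ u) ⊗ p) refl a c u (P ^ l) P))
    hi-suc : ∀ i k → hi c u (suc i) k ≈ hi (c * P) u i k
    hi-suc i k = prod-cong k λ l _ → solve 4 (λ u c p P → u ⊗ (𝟙 ⊖ c ⊗ (p ⊗ P)) ⊜ u ⊗ (𝟙 ⊖ (c ⊗ P) ⊗ p)) refl u c (P ^ (i ℕ.+ l)) P
    second≈ : ∀ i → i ≤ n → second i ≈ term (c * P) u n i * (- (P ^ n * (a - c * u)))
    second≈ i i≤n = begin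
      (P ^ (n ∸ i) * qbin n i) * ((sg i * - P ^ i) * (lo c u (suc i) * hi c u (suc i) (n ∸ i)))
        ≈⟨ *-congˡ (*-congˡ (*-cong (lo-suc i) (hi-suc i (n ∸ i)))) ⟩
      (P ^ (n ∸ i) * qbin n i) * ((sg i * - P ^ i) * (((a - c * u) * lo (c * P) u i) * hi (c * P) u i (n ∸ i)))
        ≈⟨ solve 7 (λ p b s p′ y l h → (p ⊗ b) ⊗ ((s ⊗ ⊝ p′) ⊗ ((y ⊗ l) ⊗ h)) ⊜ (b ⊗ (s ⊗ (l ⊗ h))) ⊗ (⊝ ((p′ ⊗ p) ⊗ y)))
             refl (P ^ (n ∸ i)) (qbin n i) (sg i) (P ^ i) (a - c * u) (lo (c * P) u i) (hi (c * P) u i (n ∸ i)) ⟩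
      term (c * P) u n i * (- ((P ^ i * P ^ (n ∸ i)) * (a - c * u)))
        ≈⟨ *-congˡ (-‿cong (*-congʳ (trans (sym (^-+ P i (n ∸ i))) (reflexive (≡.cong (P ^_) (ℕₚ.m+[n∸m]≡n i≤n)))))) ⟩
      term (c * P) u n i * (- (P ^ n * (a - c * u))) ∎

-- z = (1 − x)²/x with x = aP^N is the value of X at which numX and denX split into linear factors.
module _ (R : CRing) where
  open CommutativeRing R
  open Ops (ops R) using (_^_)
  module _ (q : Carrier) where
    open Sequences (ops R) q

    module Factorisation (N : ℕ) (z : Carrier)
      (z-eq : (a * P ^ N) * z ≈ (1# - a * P ^ N) * (1# - a * P ^ N)) where
      open RingKit R hiding (_^_)
      open import Relation.Binary.Reasoning.Setoid setoid

      private
        x : Carrier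
        x = a * P ^ N

      N≡ : ∀ {k} → k < N → N ≡ k ℕ.+ suc (N ∸ suc k)
      N≡ {k} k<N = ≡.trans (≡.sym (ℕₚ.m+[n∸m]≡n k<N)) (≡.sym (ℕₚ.+-suc k _))

      x-split : ∀ {k} → k < N → x ≈ a * (P ^ k * P ^ suc (N ∸ suc k))
      x-split {k} k<N = *-congˡ (trans (reflexive (≡.cong (P ^_) (N≡ k<N))) (^-+ P k _))

      x-numX : ∀ k → k < N → x * numX z k ≈ - (a * P ^ k) * ((1# - P ^ suc (N ∸ suc k)) * (1# - P ^ suc (N ℕ.+ k)))
      x-numX k k<N = begin
        x * ((1# - a * R′) * (1# - a * R′) - z * (a * R′))
          ≈⟨ solve 4 (λ x y z a → x ⊗ (y ⊗ y ⊖ z ⊗ a) ⊜ x ⊗ (y ⊗ y) ⊖ (x ⊗ z) ⊗ a) refl _ _ _ _ ⟩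
        x * ((1# - a * R′) * (1# - a * R′)) - (x * z) * (a * R′)   ≈⟨ +-congˡ (-‿cong (*-congʳ z-eq)) ⟩
        x * ((1# - a * R′) * (1# - a * R′)) - ((1# - x) * (1# - x)) * (a * R′)
          ≈⟨ solve 2 (λ x b → x ⊗ ((𝟙 ⊖ b) ⊗ (𝟙 ⊖ b)) ⊖ ((𝟙 ⊖ x) ⊗ (𝟙 ⊖ x)) ⊗ b ⊜ (x ⊖ b) ⊗ (𝟙 ⊖ x ⊗ b)) refl x (a * R′) ⟩
        (x - a * R′) * (1# - x * (a * R′))
          ≈⟨ *-cong (+-congʳ (x-split k<N)) (+-congˡ (-‿cong (trans (solve 3 (λ a n k → (a ⊗ n) ⊗ (a ⊗ k) ⊜ (n ⊗ k) ⊗ (a ⊗ a)) refl a (P ^ N) R′) (*-congʳ (sym (^-+ P N k)))))) ⟩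
        (a * (R′ * P ^ suc e) - a * R′) * (1# - P ^ suc (N ℕ.+ k))
          ≈⟨ solve 4 (λ a r p s → (a ⊗ (r ⊗ p) ⊖ a ⊗ r) ⊗ s ⊜ ⊝ (a ⊗ r) ⊗ ((𝟙 ⊖ p) ⊗ s)) refl _ _ _ _ ⟩
        - (a * R′) * ((1# - P ^ suc e) * (1# - P ^ suc (N ℕ.+ k))) ∎
        where
        e = N ∸ suc k
        R′ = P ^ k

      x-denX : ∀ k → k < N → x * denX z k ≈ - (P ^ suc k) * ((1# - a * P ^ (N ∸ suc k)) * (1# - a * P ^ suc (N ℕ.+ k)))
      x-denX k k<N = begin
        x * ((1# - R′) * (1# - R′) - z * R′)
          ≈⟨ solve 4 (λ x y z a → x ⊗ (y ⊗ y ⊖ z ⊗ a) ⊜ x ⊗ (y ⊗ y) ⊖ (x ⊗ z) ⊗ a) refl _ _ _ _ ⟩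
        x * ((1# - R′) * (1# - R′)) - (x * z) * R′   ≈⟨ +-congˡ (-‿cong (*-congʳ z-eq)) ⟩
        x * ((1# - R′) * (1# - R′)) - ((1# - x) * (1# - x)) * R′
          ≈⟨ solve 2 (λ x b → x ⊗ ((𝟙 ⊖ b) ⊗ (𝟙 ⊖ b)) ⊖ ((𝟙 ⊖ x) ⊗ (𝟙 ⊖ x)) ⊗ b ⊜ (x ⊖ b) ⊗ (𝟙 ⊖ x ⊗ b)) refl x R′ ⟩
        (x - R′) * (1# - x * R′)
          ≈⟨ *-cong (+-congʳ (x-split k<N)) (+-congˡ (-‿cong (trans (solve 4 (λ a n k P → (a ⊗ n) ⊗ (k ⊗ P) ⊜ a ⊗ ((n ⊗ k) ⊗ P)) refl a (P ^ N) (P ^ k) P) (*-congˡ (*-congʳ (sym (^-+ P N k))))))) ⟩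
        (a * (P ^ k * (P ^ e * P)) - R′) * (1# - a * P ^ suc (N ℕ.+ k))
          ≈⟨ solve 5 (λ a k p P s → (a ⊗ (k ⊗ (p ⊗ P)) ⊖ k ⊗ P) ⊗ s ⊜ ⊝ (k ⊗ P) ⊗ ((𝟙 ⊖ a ⊗ p) ⊗ s)) refl _ _ _ _ _ ⟩
        - R′ * ((1# - a * P ^ e) * (1# - a * P ^ suc (N ℕ.+ k))) ∎
        where
        e = N ∸ suc k
        R′ = P ^ suc k

module _ (R : CRing) where
  open CommutativeRing R
  open Ops (ops R) using (_^_)
  module _ (q q⁻¹ : Carrier) where
    open Sequences (ops R) q

    module BaileyPair (v vo v₃ v₅ : ℕ → Carrier) (q-inv : q * q⁻¹ ≈ 1#)
      (v-inv  : ∀ i → (1# - P ^ suc i) * v i ≈ 1#) (vo-inv : ∀ i → (1# - a * P ^ i) * vo i ≈ 1#)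
      (v₃-inv : ∀ i → (1# - (q * a) * P ^ i) * v₃ i ≈ 1#)
      (v₅-inv : ∀ i → (1# - (q * P) * P ^ i) * v₅ i ≈ 1#) where
      open RingKit R hiding (_^_)
      open import Relation.Binary.Reasoning.Setoid setoid

      pochP⁻¹ pocha⁻¹ poch₃₅⁻¹ : ℕ → Carrier
      pochP⁻¹  = prod v
      pocha⁻¹  = prod vo
      poch₃₅⁻¹ = prod (λ i → v₃ i * v₅ i)

      prod-unit : ∀ (f g : ℕ → Carrier) n → (∀ i → f i * g i ≈ 1#) → prod f n * prod g n ≈ 1#
      prod-unit f g n h = trans (sym (prod-* f g n)) (trans (prod-cong n (λ i _ → h i)) (1^ n))

      pochP-inv : ∀ n → pochP n * pochP⁻¹ n ≈ 1#
      pochP-inv n = prod-unit _ v n v-inv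

      pocha-inv : ∀ n → pocha n * pocha⁻¹ n ≈ 1#
      pocha-inv n = prod-unit _ vo n vo-inv

      P^-inv : ∀ n → P ^ n * (((q⁻¹ * q⁻¹) * (q⁻¹ * q⁻¹)) ^ n) ≈ 1#
      P^-inv n = prod-unit _ _ n λ _ → begin
        ((q * q) * (q * q)) * ((q⁻¹ * q⁻¹) * (q⁻¹ * q⁻¹))
          ≈⟨ solve 2 (λ q r → ((q ⊗ q) ⊗ (q ⊗ q)) ⊗ ((r ⊗ r) ⊗ (r ⊗ r)) ⊜ ((q ⊗ r) ⊗ (q ⊗ r)) ⊗ ((q ⊗ r) ⊗ (q ⊗ r))) refl q q⁻¹ ⟩
        ((q * q⁻¹) * (q * q⁻¹)) * ((q * q⁻¹) * (q * q⁻¹))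
          ≈⟨ *-cong (*-cong q-inv q-inv) (*-cong q-inv q-inv) ⟩
        (1# * 1#) * (1# * 1#)  ≈⟨ solve 0 ((𝟙 ⊗ 𝟙) ⊗ (𝟙 ⊗ 𝟙) ⊜ 𝟙) refl ⟩
        1# ∎

      aP^-inv : ∀ n → (a * P ^ n) * ((q⁻¹ * q⁻¹) * ((q⁻¹ * q⁻¹) * (q⁻¹ * q⁻¹)) ^ n) ≈ 1#
      aP^-inv n = begin
        ((q * q) * P ^ n) * ((q⁻¹ * q⁻¹) * ((q⁻¹ * q⁻¹) * (q⁻¹ * q⁻¹)) ^ n)
          ≈⟨ solve 4 (λ q r p s → ((q ⊗ q) ⊗ p) ⊗ ((r ⊗ r) ⊗ s) ⊜ ((q ⊗ r) ⊗ (q ⊗ r)) ⊗ (p ⊗ s)) refl _ _ _ _ ⟩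
        ((q * q⁻¹) * (q * q⁻¹)) * (P ^ n * ((q⁻¹ * q⁻¹) * (q⁻¹ * q⁻¹)) ^ n)
          ≈⟨ *-cong (*-cong q-inv q-inv) (P^-inv n) ⟩
        (1# * 1#) * 1#  ≈⟨ solve 0 ((𝟙 ⊗ 𝟙) ⊗ 𝟙 ⊜ 𝟙) refl ⟩
        1# ∎

      ε⁻¹ : ℕ → Carrier
      ε⁻¹ = prod (λ i → - ((q⁻¹ * q⁻¹) * ((q⁻¹ * q⁻¹) * (q⁻¹ * q⁻¹)) ^ i))

      ε-inv : ∀ n → ε n * ε⁻¹ n ≈ 1#
      ε-inv n = prod-unit _ _ n λ i → trans (solve 2 (λ x y → ⊝ x ⊗ ⊝ y ⊜ x ⊗ y) refl _ _) (aP^-inv i)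

      -- In exponents of q: 2i² + 4k(i+k) = 2k² + 2(i+k)².
      ε-shift : ∀ i k → ε i * (P ^ (i ℕ.+ k)) ^ k ≈ ε k * ε (i ℕ.+ k)
      ε-shift i zero rewrite ℕₚ.+-identityʳ i = *-comm _ _
      ε-shift i (suc k) rewrite ℕₚ.+-suc i k = begin
        ε i * ((P ^ n * P) ^ k * (P ^ n * P))
          ≈⟨ *-congˡ (*-congʳ (*-^ (P ^ n) P k)) ⟩
        ε i * (((P ^ n) ^ k * P ^ k) * (P ^ n * P))
          ≈⟨ solve 5 (λ e x y z P → e ⊗ ((x ⊗ y) ⊗ (z ⊗ P)) ⊜ (e ⊗ x) ⊗ ((y ⊗ z) ⊗ P)) refl (ε i) ((P ^ n) ^ k) (P ^ k) (P ^ n) P ⟩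
        (ε i * (P ^ n) ^ k) * ((P ^ k * P ^ n) * P)
          ≈⟨ *-congʳ (ε-shift i k) ⟩
        (ε k * ε n) * ((P ^ k * P ^ n) * P)
          ≈⟨ solve 5 (λ e f y z a → (e ⊗ f) ⊗ ((y ⊗ z) ⊗ (a ⊗ a)) ⊜ (e ⊗ ⊝ (a ⊗ y)) ⊗ (f ⊗ ⊝ (a ⊗ z))) refl (ε k) (ε n) (P ^ k) (P ^ n) a ⟩
        ε (suc k) * ε (suc n) ∎
        where n = i ℕ.+ k

      open Vandermonde R P a using (qbin; qbin-pochP; sg; lo; hi; vandermonde)

      private
        sg-a^ : ∀ i → sg i * a ^ i ≈ ε i
        sg-a^ i = trans (sym (prod-* _ _ i)) (prod-cong i λ l _ → solve 2 (λ a p → ⊝ p ⊗ a ⊜ ⊝ (a ⊗ p)) refl a (P ^ l))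

        pochP-split : ∀ m i → prod (λ l → 1# - P ^ suc (m ℕ.+ l)) i ≈ pochP (m ℕ.+ i) * pochP⁻¹ m
        pochP-split m i = begin
          prod (λ l → 1# - P ^ suc (m ℕ.+ l)) i                             ≈⟨ *-identityˡ _ ⟨
          1# * prod (λ l → 1# - P ^ suc (m ℕ.+ l)) i                        ≈⟨ *-congʳ (pochP-inv m) ⟨
          (pochP m * pochP⁻¹ m) * prod (λ l → 1# - P ^ suc (m ℕ.+ l)) i     ≈⟨ solve 3 (λ x y z → (x ⊗ y) ⊗ z ⊜ (x ⊗ z) ⊗ y) refl _ _ _ ⟩
          (pochP m * prod (λ l → 1# - P ^ suc (m ℕ.+ l)) i) * pochP⁻¹ m     ≈⟨ *-congʳ (prod-++ (λ i → 1# - P ^ suc i) m i) ⟨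
          pochP (m ℕ.+ i) * pochP⁻¹ m                                       ∎

        pocha-split : ∀ m i → prod (λ l → 1# - a * P ^ (m ℕ.+ l)) i ≈ pocha (m ℕ.+ i) * pocha⁻¹ m
        pocha-split m i = begin
          prod (λ l → 1# - a * P ^ (m ℕ.+ l)) i                             ≈⟨ *-identityˡ _ ⟨
          1# * prod (λ l → 1# - a * P ^ (m ℕ.+ l)) i                        ≈⟨ *-congʳ (pocha-inv m) ⟨
          (pocha m * pocha⁻¹ m) * prod (λ l → 1# - a * P ^ (m ℕ.+ l)) i     ≈⟨ solve 3 (λ x y z → (x ⊗ y) ⊗ z ⊜ (x ⊗ z) ⊗ y) refl _ _ _ ⟩
          (pocha m * prod (λ l → 1# - a * P ^ (m ℕ.+ l)) i) * pocha⁻¹ m     ≈⟨ *-congʳ (prod-++ (λ i → 1# - a * P ^ i) m i) ⟨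
          pocha (m ℕ.+ i) * pocha⁻¹ m                                       ∎

        lo≈ : ∀ n s i → lo (a * P ^ suc s) (P ^ n) i ≈ a ^ i * (pochP (n ℕ.+ s ℕ.+ i) * pochP⁻¹ (n ℕ.+ s))
        lo≈ n s i = begin
          prod (λ l → a - ((a * P ^ suc s) * P ^ n) * P ^ l) i
            ≈⟨ (prod-cong i λ l _ → begin
                 a - ((a * (P ^ s * P)) * P ^ n) * P ^ l
                   ≈⟨ solve 5 (λ a s P n l → a ⊖ ((a ⊗ (s ⊗ P)) ⊗ n) ⊗ l ⊜ a ⊗ (𝟙 ⊖ ((n ⊗ s) ⊗ l) ⊗ P)) refl a (P ^ s) P (P ^ n) (P ^ l) ⟩
                 a * (1# - ((P ^ n * P ^ s) * P ^ l) * P)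
                   ≈⟨ *-congˡ (+-congˡ (-‿cong (*-congʳ (trans (^-+ P (n ℕ.+ s) l) (*-congʳ (^-+ P n s)))))) ⟨
                 a * (1# - P ^ suc (n ℕ.+ s ℕ.+ l)) ∎) ⟩
          prod (λ l → a * (1# - P ^ suc (n ℕ.+ s ℕ.+ l))) i             ≈⟨ prod-* _ _ i ⟩
          a ^ i * prod (λ l → 1# - P ^ suc (n ℕ.+ s ℕ.+ l)) i           ≈⟨ *-congˡ (pochP-split (n ℕ.+ s) i) ⟩
          a ^ i * (pochP (n ℕ.+ s ℕ.+ i) * pochP⁻¹ (n ℕ.+ s))           ∎

        hi≈ : ∀ n s i k → hi (a * P ^ suc s) (P ^ n) i k ≈ (P ^ n) ^ k * (pocha (suc s ℕ.+ i ℕ.+ k) * pocha⁻¹ (suc s ℕ.+ i))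
        hi≈ n s i k = begin
          prod (λ l → P ^ n * (1# - (a * P ^ suc s) * P ^ (i ℕ.+ l))) k
            ≈⟨ (prod-cong k λ l _ → *-congˡ (+-congˡ (-‿cong (trans (*-assoc a _ _) (*-congˡ (trans (sym (^-+ P (suc s) (i ℕ.+ l))) (reflexive (≡.cong (P ^_) (≡.sym (ℕₚ.+-assoc (suc s) i l)))))))))) ⟩
          prod (λ l → P ^ n * (1# - a * P ^ (suc s ℕ.+ i ℕ.+ l))) k           ≈⟨ prod-* _ _ k ⟩
          (P ^ n) ^ k * prod (λ l → 1# - a * P ^ (suc s ℕ.+ i ℕ.+ l)) k       ≈⟨ *-congˡ (pocha-split (suc s ℕ.+ i) k) ⟩
          (P ^ n) ^ k * (pocha (suc s ℕ.+ i ℕ.+ k) * pocha⁻¹ (suc s ℕ.+ i))   ∎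

        vandermonde-rhs : ∀ n → prod (λ l → P ^ n - a * P ^ l) n ≈ ε n * pocha n
        vandermonde-rhs n = begin
          prod (λ l → P ^ n - a * P ^ l) n                        ≈⟨ prod-cong n factor ⟩
          prod (λ l → - (a * P ^ l) * (1# - a * P ^ (n ∸ suc l))) n   ≈⟨ prod-* _ _ n ⟩
          ε n * prod (λ l → 1# - a * P ^ (n ∸ suc l)) n
            ≈⟨ *-congˡ (prod-reverse n λ i j p → reflexive (≡.cong (λ m → 1# - a * P ^ m) (≡.trans (≡.cong (_∸ suc i) (≡.sym p)) (ℕₚ.m+n∸m≡n (suc i) j)))) ⟩
          ε n * pocha n ∎
          where
          factor : ∀ l → l < n → P ^ n - a * P ^ l ≈ - (a * P ^ l) * (1# - a * P ^ (n ∸ suc l))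
          factor l l<n = begin
            P ^ n - a * P ^ l                            ≡⟨ ≡.cong (λ m → P ^ m - a * P ^ l) (ℕₚ.m+[n∸m]≡n l<n) ⟨
            P ^ (suc l ℕ.+ (n ∸ suc l)) - a * P ^ l      ≈⟨ +-congʳ (^-+ P (suc l) (n ∸ suc l)) ⟩
            (P ^ l * P) * P ^ (n ∸ suc l) - a * P ^ l
              ≈⟨ solve 3 (λ x y a → (x ⊗ (a ⊗ a)) ⊗ y ⊖ a ⊗ x ⊜ ⊝ (a ⊗ x) ⊗ (𝟙 ⊖ a ⊗ y)) refl (P ^ l) (P ^ (n ∸ suc l)) a ⟩
            - (a * P ^ l) * (1# - a * P ^ (n ∸ suc l))   ∎

      conjugate-term : ℕ → ℕ → ℕ → Carrier
      conjugate-term n s i = ε (n ∸ i) * (pochP (n ℕ.+ s ℕ.+ i) * pochP⁻¹ (n ∸ i)) * (pochP⁻¹ i * pocha⁻¹ (suc s ℕ.+ i))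

      -- The conjugate half of Bailey's lemma; `watson` takes n = N - r and s = 2r. Multiplication
      -- by the unit U turns the terms into those of `vandermonde` with c = aP^(s+1) and u = P^n.
      conjugate : ∀ n s → sum (conjugate-term n s) (suc n)
        ≈ (pochP (n ℕ.+ s) * pochP⁻¹ n) * (pocha n * pocha⁻¹ (suc s ℕ.+ n))
      conjugate n s = cancel-unit _ _ unit (begin
        U * sum (conjugate-term n s) (suc n)    ≈⟨ *-distribˡ-sum U _ (suc n) ⟩
        sum (λ i → U * conjugate-term n s i) (suc n)   ≈⟨ sum-cong (suc n) (λ i i<1+n → step i (ℕₚ.≤-pred i<1+n)) ⟩
        sum (λ i → qbin n i * (sg i * (lo (a * P ^ suc s) (P ^ n) i * hi (a * P ^ suc s) (P ^ n) i (n ∸ i)))) (suc n) ≈⟨ vandermonde n (a * P ^ suc s) (P ^ n) ⟩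
        prod (λ l → P ^ n - a * P ^ l) n   ≈⟨ vandermonde-rhs n ⟩
        ε n * pocha n  ≈⟨ solve 2 (λ e o → (e ⊗ o) ⊗ (𝟙 ⊗ (𝟙 ⊗ 𝟙)) ⊜ e ⊗ o) refl _ _ ⟨
        (ε n * pocha n) * (1# * (1# * 1#))
          ≈⟨ *-congˡ (*-cong (pochP-inv (n ℕ.+ s)) (*-cong (pochP-inv n) (pocha-inv (suc s ℕ.+ n)))) ⟨
        (ε n * pocha n) * ((pochP (n ℕ.+ s) * pochP⁻¹ (n ℕ.+ s)) * ((pochP n * pochP⁻¹ n) * (pocha (suc s ℕ.+ n) * pocha⁻¹ (suc s ℕ.+ n))))
          ≈⟨ solve 8 (λ e o f g h k l m → (e ⊗ o) ⊗ ((f ⊗ g) ⊗ ((h ⊗ k) ⊗ (l ⊗ m))) ⊜ (e ⊗ (h ⊗ (g ⊗ l))) ⊗ ((f ⊗ k) ⊗ (o ⊗ m))) refl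
               (ε n) (pocha n) (pochP (n ℕ.+ s)) (pochP⁻¹ (n ℕ.+ s)) (pochP n) (pochP⁻¹ n) (pocha (suc s ℕ.+ n)) (pocha⁻¹ (suc s ℕ.+ n)) ⟩
        U * ((pochP (n ℕ.+ s) * pochP⁻¹ n) * (pocha n * pocha⁻¹ (suc s ℕ.+ n))) ∎)
        where
        U = ε n * (pochP n * (pochP⁻¹ (n ℕ.+ s) * pocha (suc s ℕ.+ n)))
        unit : U * (ε⁻¹ n * (pochP⁻¹ n * (pochP (n ℕ.+ s) * pocha⁻¹ (suc s ℕ.+ n)))) ≈ 1#
        unit = begin
          U * (ε⁻¹ n * (pochP⁻¹ n * (pochP (n ℕ.+ s) * pocha⁻¹ (suc s ℕ.+ n))))
            ≈⟨ solve 8 (λ a a′ b b′ c c′ d d′ → (a ⊗ (b ⊗ (c′ ⊗ d))) ⊗ (a′ ⊗ (b′ ⊗ (c ⊗ d′))) ⊜ (a ⊗ a′) ⊗ ((b ⊗ b′) ⊗ ((c ⊗ c′) ⊗ (d ⊗ d′)))) refl _ _ _ _ _ _ _ _ ⟩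
          (ε n * ε⁻¹ n) * ((pochP n * pochP⁻¹ n) * ((pochP (n ℕ.+ s) * pochP⁻¹ (n ℕ.+ s)) * (pocha (suc s ℕ.+ n) * pocha⁻¹ (suc s ℕ.+ n))))
            ≈⟨ *-cong (ε-inv n) (*-cong (pochP-inv n) (*-cong (pochP-inv (n ℕ.+ s)) (pocha-inv (suc s ℕ.+ n)))) ⟩
          1# * (1# * (1# * 1#)) ≈⟨ solve 0 (𝟙 ⊗ (𝟙 ⊗ (𝟙 ⊗ 𝟙)) ⊜ 𝟙) refl ⟩
          1# ∎
        step : ∀ i → i ≤ n → U * conjugate-term n s i ≈ qbin n i * (sg i * (lo (a * P ^ suc s) (P ^ n) i * hi (a * P ^ suc s) (P ^ n) i (n ∸ i)))
        step i i≤n = sym (begin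
          qbin n i * (sg i * (lo (a * P ^ suc s) (P ^ n) i * hi (a * P ^ suc s) (P ^ n) i k))
            ≈⟨ *-cong qbin≈ (*-congˡ (*-cong (lo≈ n s i) (hi≈ n s i k))) ⟩
          (pochP n * (pochP⁻¹ i * pochP⁻¹ k)) * (sg i * ((a ^ i * (F * F⁻¹)) * ((P ^ n) ^ k * (pocha (suc s ℕ.+ i ℕ.+ k) * O⁻¹))))
            ≡⟨ ≡.cong (λ l → (pochP n * (pochP⁻¹ i * pochP⁻¹ k)) * (sg i * ((a ^ i * (F * F⁻¹)) * ((P ^ n) ^ k * (pocha l * O⁻¹)))))
                 (≡.trans (ℕₚ.+-assoc (suc s) i k) (≡.cong (suc s ℕ.+_) i+k≡n)) ⟩
          (pochP n * (pochP⁻¹ i * pochP⁻¹ k)) * (sg i * ((a ^ i * (F * F⁻¹)) * ((P ^ n) ^ k * (O * O⁻¹))))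
            ≈⟨ solve 10 (λ f fi fk s ai F F⁻¹ Pn O O⁻¹ →
                 (f ⊗ (fi ⊗ fk)) ⊗ (s ⊗ ((ai ⊗ (F ⊗ F⁻¹)) ⊗ (Pn ⊗ (O ⊗ O⁻¹))))
                 ⊜ ((s ⊗ ai) ⊗ Pn) ⊗ ((f ⊗ (fi ⊗ fk)) ⊗ ((F ⊗ F⁻¹) ⊗ (O ⊗ O⁻¹)))) refl
                 (pochP n) (pochP⁻¹ i) (pochP⁻¹ k) (sg i) (a ^ i) F F⁻¹ ((P ^ n) ^ k) O O⁻¹ ⟩
          ((sg i * a ^ i) * (P ^ n) ^ k) * rest
            ≈⟨ *-congʳ (begin
                 (sg i * a ^ i) * (P ^ n) ^ k      ≈⟨ *-congʳ (sg-a^ i) ⟩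
                 ε i * (P ^ n) ^ k                 ≡⟨ ≡.cong (λ l → ε i * (P ^ l) ^ k) i+k≡n ⟨
                 ε i * (P ^ (i ℕ.+ k)) ^ k         ≈⟨ ε-shift i k ⟩
                 ε k * ε (i ℕ.+ k)                 ≡⟨ ≡.cong (λ l → ε k * ε l) i+k≡n ⟩
                 ε k * ε n                         ∎) ⟩
          (ε k * ε n) * rest
            ≈⟨ solve 9 (λ ek en f fi fk F F⁻¹ O O⁻¹ →
                 (ek ⊗ en) ⊗ ((f ⊗ (fi ⊗ fk)) ⊗ ((F ⊗ F⁻¹) ⊗ (O ⊗ O⁻¹)))
                 ⊜ (en ⊗ (f ⊗ (F⁻¹ ⊗ O))) ⊗ (ek ⊗ (F ⊗ fk) ⊗ (fi ⊗ O⁻¹))) refl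
                 (ε k) (ε n) (pochP n) (pochP⁻¹ i) (pochP⁻¹ k) F F⁻¹ O O⁻¹ ⟩
          U * conjugate-term n s i ∎)
          where
          k = n ∸ i
          i+k≡n = ℕₚ.m+[n∸m]≡n i≤n
          F = pochP (n ℕ.+ s ℕ.+ i)
          F⁻¹ = pochP⁻¹ (n ℕ.+ s)
          O = pocha (suc s ℕ.+ n)
          O⁻¹ = pocha⁻¹ (suc s ℕ.+ i)
          rest = (pochP n * (pochP⁻¹ i * pochP⁻¹ k)) * ((F * F⁻¹) * (O * O⁻¹))
          qbin≈ : qbin n i ≈ pochP n * (pochP⁻¹ i * pochP⁻¹ k)
          qbin≈ = begin
            qbin n i                    ≈⟨ solve 1 (λ b → b ⊗ (𝟙 ⊗ 𝟙) ⊜ b) refl _ ⟨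
            qbin n i * (1# * 1#)        ≈⟨ *-congˡ (*-cong (pochP-inv i) (pochP-inv k)) ⟨
            qbin n i * ((pochP i * pochP⁻¹ i) * (pochP k * pochP⁻¹ k))
              ≈⟨ solve 5 (λ b x x′ y y′ → b ⊗ ((x ⊗ x′) ⊗ (y ⊗ y′)) ⊜ (b ⊗ (x ⊗ y)) ⊗ (x′ ⊗ y′)) refl _ _ _ _ _ ⟩
            (qbin n i * (pochP i * pochP k)) * (pochP⁻¹ i * pochP⁻¹ k)
              ≈⟨ *-congʳ (trans (reflexive (≡.cong (λ l → qbin l i * (pochP i * pochP k)) (≡.sym i+k≡n))) (trans (qbin-pochP i k) (reflexive (≡.cong pochP i+k≡n)))) ⟩
            pochP n * (pochP⁻¹ i * pochP⁻¹ k) ∎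

      -- The classical two-parameter Bailey pair relative to a in base P, with parameters q and q³,
      -- except that the factor (1 - q)/(1 - a) is left out of `α`. Here aP over the parameters
      -- gives the q⁵ and q³ under `β`, and aP/(q·q³) = a gives its numerator. In `α` the parameter
      -- q³ contributes (q³)_r/(q³)_r = 1, while (q)_r/(q⁵)_r cancels 1 - qP^r from 1 - aP^(2r) and
      -- leaves 1 + qP^r.
      α β : ℕ → Carrier
      α r = (ε r * (1# + q * P ^ r)) * (pocha r * pochP⁻¹ r)
      β j = pocha j * (pochP⁻¹ j * poch₃₅⁻¹ j)

      -- The index j + s + 1 in (a;P) absorbs the 1/(1 - a) missing from `α`, since (a;P)_(k+1) = (1
      -- - a)(aP;P)_k.
      bailey-term : ℕ → ℕ → Carrier
      bailey-term j s = α s * (pochP⁻¹ (j ∸ s) * pocha⁻¹ (suc (j ℕ.+ s)))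

      private
        -- At J = P^j the quotient `Y J` over `X J` is the ratio of `β (suc j)` to `β j`. Hence
        -- `bailey` reduces to showing that the sum of the `bailey-term`s satisfies the same
        -- first-order recurrence.
        X Y : Carrier → Carrier
        X J = (1# - J * P) * ((1# - (q * a) * J) * (1# - (q * P) * J))
        Y J = 1# - a * J

        X-cong : ∀ {J K} → J ≈ K → X J ≈ X K
        X-cong p = *-cong (+-congˡ (-‿cong (*-congʳ p))) (*-cong (+-congˡ (-‿cong (*-congˡ p))) (+-congˡ (-‿cong (*-congˡ p))))

        Y-cong : ∀ {J K} → J ≈ K → Y J ≈ Y K
        Y-cong p = +-congˡ (-‿cong (*-congˡ p))

        lower : ∀ (f g : ℕ → Carrier) → (∀ i → f i * g i ≈ 1#) → ∀ n → prod g n ≈ prod g (suc n) * f n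
        lower f g h n = begin
          prod g n                    ≈⟨ *-identityʳ _ ⟨
          prod g n * 1#               ≈⟨ *-congˡ (h n) ⟨
          prod g n * (f n * g n)      ≈⟨ solve 3 (λ x y z → x ⊗ (y ⊗ z) ⊜ (x ⊗ z) ⊗ y) refl _ _ _ ⟩
          prod g (suc n) * f n        ∎

        lowerP : ∀ n → pochP⁻¹ n ≈ pochP⁻¹ (suc n) * (1# - P ^ suc n)
        lowerP = lower _ v v-inv

        lowera : ∀ n → pocha⁻¹ n ≈ pocha⁻¹ (suc n) * (1# - a * P ^ n)
        lowera = lower _ vo vo-inv

        -- The Wilf–Zeilberger certificate of the terminating ₆φ₅ sum below.
        G : ℕ → ℕ → ℕ → Carrier
        G j r d = (((P ^ j * a) * ε r) * (pocha (suc r) * pochP⁻¹ r)) * ((1# - (q * a) * P ^ r) * (pochP⁻¹ d * pocha⁻¹ (suc (suc (j ℕ.+ r)))))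

        δ : ℕ → ℕ → Carrier
        δ j s = X (P ^ j) * bailey-term (suc j) s - Y (P ^ j) * bailey-term j s

        -- The summands telescope to the certificate. Carrying d = j - r as an argument makes every
        -- exponent a sum; once all inverses are lowered to a common index, the induction step is a
        -- polynomial identity in q, S = P^r and T = P^(d+1).
        δ-partial : ∀ r d j → r ℕ.+ d ≡ j → sum (δ j) (suc r) ≈ G j r d
        δ-partial zero d .d ≡.refl = begin
          0# + (X J * (((1# * (1# + q * 1#)) * (1# * 1#)) * (fd * pocha⁻¹ (suc (suc (d ℕ.+ 0)))))
                - Y J * (((1# * (1# + q * 1#)) * (1# * 1#)) * (pochP⁻¹ d * pocha⁻¹ (suc (d ℕ.+ 0)))))
            ≈⟨ +-congˡ (+-congˡ (-‿cong (*-congˡ (*-congˡ (*-cong (lowerP d) (lowera _)))))) ⟩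
          0# + (X J * (((1# * (1# + q * 1#)) * (1# * 1#)) * (fd * oi))
                - Y J * (((1# * (1# + q * 1#)) * (1# * 1#)) * ((fd * (1# - J * P)) * (oi * (1# - a * (P ^ (d ℕ.+ 0) * P))))))
            ≡⟨ ≡.cong (λ l → 0# + (X J * (((1# * (1# + q * 1#)) * (1# * 1#)) * (fd * oi))
                - Y J * (((1# * (1# + q * 1#)) * (1# * 1#)) * ((fd * (1# - J * P)) * (oi * (1# - a * (P ^ l * P))))))) (ℕₚ.+-identityʳ d) ⟩
          0# + (X J * (((1# * (1# + q * 1#)) * (1# * 1#)) * (fd * oi))
                - Y J * (((1# * (1# + q * 1#)) * (1# * 1#)) * ((fd * (1# - J * P)) * (oi * (1# - a * (J * P))))))
            ≈⟨ solve 4 (λ q J fd oi → let a = q ⊗ q ; P = a ⊗ a ; A = ((𝟙 ⊗ (𝟙 ⊕ q ⊗ 𝟙)) ⊗ (𝟙 ⊗ 𝟙)) in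
                 Κ (ℤ.+ 0) ⊕ (((𝟙 ⊖ J ⊗ P) ⊗ ((𝟙 ⊖ (q ⊗ a) ⊗ J) ⊗ (𝟙 ⊖ (q ⊗ P) ⊗ J))) ⊗ (A ⊗ (fd ⊗ oi))
                   ⊖ (𝟙 ⊖ a ⊗ J) ⊗ (A ⊗ ((fd ⊗ (𝟙 ⊖ J ⊗ P)) ⊗ (oi ⊗ (𝟙 ⊖ a ⊗ (J ⊗ P))))))
                 ⊜ (((J ⊗ a) ⊗ 𝟙) ⊗ ((𝟙 ⊗ (𝟙 ⊖ a ⊗ 𝟙)) ⊗ 𝟙)) ⊗ ((𝟙 ⊖ (q ⊗ a) ⊗ 𝟙) ⊗ ((fd ⊗ (𝟙 ⊖ J ⊗ P)) ⊗ oi))) refl q J fd oi ⟩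
          (((J * a) * 1#) * ((1# * (1# - a * 1#)) * 1#)) * ((1# - (q * a) * 1#) * ((fd * (1# - J * P)) * oi))
            ≈⟨ *-congˡ (*-congˡ (*-congʳ (lowerP d))) ⟨
          G d 0 d ∎
          where
          J = P ^ d
          fd = pochP⁻¹ (suc d)
          oi = pocha⁻¹ (suc (suc (d ℕ.+ 0)))
        δ-partial (suc r) d .(suc r ℕ.+ d) ≡.refl = begin
          sum (δ j) (suc r) + δ j (suc r)
            ≈⟨ +-congʳ (δ-partial r (suc d) j (ℕₚ.+-suc r d)) ⟩
          (((J * a) * e) * (oo * pochP⁻¹ r)) * ((1# - (q * a) * S) * (fd * pocha⁻¹ (suc (suc (j ℕ.+ r)))))
            + (X J * bailey-term (suc j) (suc r) - Y J * bailey-term j (suc r))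
            ≡⟨ ≡.cong₂ (λ l l′ → (((J * a) * e) * (oo * pochP⁻¹ r)) * ((1# - (q * a) * S) * (fd * pocha⁻¹ (suc l)))
                  + (X J * (α (suc r) * (l′ * oi)) - Y J * (α (suc r) * (pochP⁻¹ (r ℕ.+ d ∸ r) * pocha⁻¹ (suc M)))))
                (≡.sym (ℕₚ.+-suc j r)) (≡.cong pochP⁻¹ (≡.trans (≡.cong (_∸ r) (≡.sym (ℕₚ.+-suc r d))) (ℕₚ.m+n∸m≡n r (suc d)))) ⟩
          (((J * a) * e) * (oo * pochP⁻¹ r)) * ((1# - (q * a) * S) * (fd * pocha⁻¹ (suc M)))
            + (X J * (α (suc r) * (fd * oi)) - Y J * (α (suc r) * (pochP⁻¹ (r ℕ.+ d ∸ r) * pocha⁻¹ (suc M))))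
            ≡⟨ ≡.cong (λ l → (((J * a) * e) * (oo * pochP⁻¹ r)) * ((1# - (q * a) * S) * (fd * pocha⁻¹ (suc M)))
                  + (X J * (α (suc r) * (fd * oi)) - Y J * (α (suc r) * (pochP⁻¹ l * pocha⁻¹ (suc M))))) (ℕₚ.m+n∸m≡n r d) ⟩
          (((J * a) * e) * (oo * pochP⁻¹ r)) * ((1# - (q * a) * S) * (fd * pocha⁻¹ (suc M)))
            + (X J * (α (suc r) * (fd * oi)) - Y J * (α (suc r) * (pochP⁻¹ d * pocha⁻¹ (suc M))))
            ≈⟨ +-cong (*-cong (*-congˡ (*-congˡ (lowerP r))) (*-congˡ (*-congˡ oM)))
                      (+-congˡ (-‿cong (*-congˡ (*-congˡ (*-cong (lowerP d) oM))))) ⟩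
          (((J * a) * e) * (oo * (fi * (1# - S * P)))) * ((1# - (q * a) * S) * (fd * (oi * (1# - a * ((J * (S * P)) * P)))))
            + (X J * (α (suc r) * (fd * oi)) - Y J * (α (suc r) * ((fd * (1# - T)) * (oi * (1# - a * ((J * (S * P)) * P))))))
            ≈⟨ +-cong (*-cong (*-congʳ (*-congʳ (*-congʳ J≈ST))) (*-congˡ (*-congˡ J-factor)))
                      (+-cong (*-congʳ (X-cong J≈ST)) (-‿cong (*-cong (Y-cong J≈ST) (*-congˡ (*-congˡ J-factor))))) ⟩
          ((((S * T) * a) * e) * (oo * (fi * (1# - S * P)))) * ((1# - (q * a) * S) * (fd * (oi * (1# - a * (((S * T) * (S * P)) * P)))))
            + (X (S * T) * (α (suc r) * (fd * oi)) - Y (S * T) * (α (suc r) * ((fd * (1# - T)) * (oi * (1# - a * (((S * T) * (S * P)) * P))))))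
            ≈⟨ solve 8 (λ q S T e oo fi fd oi → let a = q ⊗ q ; P = a ⊗ a ; J = S ⊗ T
                                                    A = ((e ⊗ ⊝ (a ⊗ S)) ⊗ (𝟙 ⊕ q ⊗ (S ⊗ P))) ⊗ (oo ⊗ fi)
                                                    O = oi ⊗ (𝟙 ⊖ a ⊗ ((J ⊗ (S ⊗ P)) ⊗ P)) in
                 (((J ⊗ a) ⊗ e) ⊗ (oo ⊗ (fi ⊗ (𝟙 ⊖ S ⊗ P)))) ⊗ ((𝟙 ⊖ (q ⊗ a) ⊗ S) ⊗ (fd ⊗ O))
                 ⊕ (((𝟙 ⊖ J ⊗ P) ⊗ ((𝟙 ⊖ (q ⊗ a) ⊗ J) ⊗ (𝟙 ⊖ (q ⊗ P) ⊗ J))) ⊗ (A ⊗ (fd ⊗ oi))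
                   ⊖ (𝟙 ⊖ a ⊗ J) ⊗ (A ⊗ ((fd ⊗ (𝟙 ⊖ T)) ⊗ O)))
                 ⊜ (((J ⊗ a) ⊗ (e ⊗ ⊝ (a ⊗ S))) ⊗ ((oo ⊗ (𝟙 ⊖ a ⊗ (S ⊗ P))) ⊗ fi)) ⊗ ((𝟙 ⊖ (q ⊗ a) ⊗ (S ⊗ P)) ⊗ ((fd ⊗ (𝟙 ⊖ T)) ⊗ oi)))
                 refl q S T e oo fi fd oi ⟩
          ((((S * T) * a) * ε (suc r)) * (pocha (suc (suc r)) * fi)) * ((1# - (q * a) * (S * P)) * ((fd * (1# - T)) * oi))
            ≈⟨ *-cong (*-congʳ (*-congʳ (*-congʳ J≈ST))) (*-congˡ (*-congʳ (lowerP d))) ⟨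
          G j (suc r) d ∎
          where
          j = suc r ℕ.+ d
          M = j ℕ.+ suc r
          J = P ^ j
          S = P ^ r
          T = P ^ suc d
          e = ε r
          oo = pocha (suc r)
          fi = pochP⁻¹ (suc r)
          fd = pochP⁻¹ (suc d)
          oi = pocha⁻¹ (suc (suc M))
          J≈ST : J ≈ S * T
          J≈ST = trans (reflexive (≡.cong (P ^_) (≡.sym (ℕₚ.+-suc r d)))) (^-+ P r (suc d))
          oM : pocha⁻¹ (suc M) ≈ oi * (1# - a * ((J * (S * P)) * P))
          oM = trans (lowera (suc M)) (*-congˡ (+-congˡ (-‿cong (*-congˡ (*-congʳ (^-+ P j (suc r)))))))
          J-factor : oi * (1# - a * ((J * (S * P)) * P)) ≈ oi * (1# - a * (((S * T) * (S * P)) * P))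
          J-factor = *-congˡ (+-congˡ (-‿cong (*-congˡ (*-congʳ (*-congʳ J≈ST)))))

        -- The sum for j + 1 has one term more than the sum for j, at s = j + 1. It cancels the
        -- value of the certificate at r = j.
        δ-closes : ∀ j → sum (δ j) (suc j) + X (P ^ j) * bailey-term (suc j) (suc j) ≈ 0#
        δ-closes j = begin
          sum (δ j) (suc j) + X J * bailey-term (suc j) (suc j)
            ≈⟨ +-congʳ (δ-partial j 0 j (ℕₚ.+-identityʳ j)) ⟩
          (((J * a) * e) * (oo * pochP⁻¹ j)) * ((1# - (q * a) * J) * (1# * pocha⁻¹ (suc (suc (j ℕ.+ j)))))
            + X J * (α (suc j) * (pochP⁻¹ (j ∸ j) * oi))
            ≡⟨ ≡.cong₂ (λ l l′ → (((J * a) * e) * (oo * pochP⁻¹ j)) * ((1# - (q * a) * J) * (1# * pocha⁻¹ (suc l)))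
                                  + X J * (α (suc j) * (pochP⁻¹ l′ * oi))) (≡.sym (ℕₚ.+-suc j j)) (ℕₚ.n∸n≡0 j) ⟩
          (((J * a) * e) * (oo * pochP⁻¹ j)) * ((1# - (q * a) * J) * (1# * pocha⁻¹ (suc M)))
            + X J * (α (suc j) * (1# * oi))
            ≈⟨ +-congʳ (*-cong (*-congˡ (*-congˡ (lowerP j))) (*-congˡ (*-congˡ (trans (lowera (suc M)) (*-congˡ (+-congˡ (-‿cong (*-congˡ (*-congʳ (^-+ P j (suc j)))))))))))  ⟩
          (((J * a) * e) * (oo * (fi * (1# - J * P)))) * ((1# - (q * a) * J) * (1# * (oi * (1# - a * ((J * (J * P)) * P)))))
            + X J * (α (suc j) * (1# * oi))
            ≈⟨ solve 6 (λ q J e oo fi oi → let a = q ⊗ q ; P = a ⊗ a in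
                 (((J ⊗ a) ⊗ e) ⊗ (oo ⊗ (fi ⊗ (𝟙 ⊖ J ⊗ P)))) ⊗ ((𝟙 ⊖ (q ⊗ a) ⊗ J) ⊗ (𝟙 ⊗ (oi ⊗ (𝟙 ⊖ a ⊗ ((J ⊗ (J ⊗ P)) ⊗ P)))))
                 ⊕ ((𝟙 ⊖ J ⊗ P) ⊗ ((𝟙 ⊖ (q ⊗ a) ⊗ J) ⊗ (𝟙 ⊖ (q ⊗ P) ⊗ J))) ⊗ ((((e ⊗ ⊝ (a ⊗ J)) ⊗ (𝟙 ⊕ q ⊗ (J ⊗ P))) ⊗ (oo ⊗ fi)) ⊗ (𝟙 ⊗ oi))
                 ⊜ Κ (ℤ.+ 0)) refl q J e oo fi oi ⟩
          0# ∎
          where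
          M = j ℕ.+ suc j
          J = P ^ j
          e = ε j
          oo = pocha (suc j)
          fi = pochP⁻¹ (suc j)
          oi = pocha⁻¹ (suc (suc M))

        X-step : ∀ j → X (P ^ j) * sum (bailey-term (suc j)) (suc (suc j)) ≈ Y (P ^ j) * sum (bailey-term j) (suc j)
        X-step j = begin
          x * (S′ + t)                              ≈⟨ solve 4 (λ x s t u → x ⊗ (s ⊕ t) ⊜ ((x ⊗ s ⊖ u) ⊕ x ⊗ t) ⊕ u) refl x S′ t (y * S) ⟩
          ((x * S′ - y * S) + x * t) + y * S        ≈⟨ +-congʳ (+-congʳ (+-cong (*-distribˡ-sum x _ (suc j)) (trans (-‿cong (*-distribˡ-sum y _ (suc j))) (-‿sum _ (suc j))))) ⟩
          ((sum (λ s → x * bailey-term (suc j) s) (suc j) + sum (λ s → - (y * bailey-term j s)) (suc j)) + x * t) + y * S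
                                                    ≈⟨ +-congʳ (+-congʳ (sum-+ _ _ (suc j))) ⟨
          (sum (δ j) (suc j) + x * t) + y * S       ≈⟨ +-congʳ (δ-closes j) ⟩
          0# + y * S                                ≈⟨ +-identityˡ _ ⟩
          y * S                                     ∎
          where
          x = X (P ^ j)
          y = Y (P ^ j)
          S′ = sum (bailey-term (suc j)) (suc j)
          t = bailey-term (suc j) (suc j)
          S = sum (bailey-term j) (suc j)

      bailey : ∀ j → (1# - q) * sum (bailey-term j) (suc j) ≈ β j
      bailey zero = begin
        (1# - q) * (0# + ((1# * (1# + q * 1#)) * (1# * 1#)) * (1# * (1# * vo 0)))
          ≈⟨ solve 2 (λ q o → (𝟙 ⊖ q) ⊗ (Κ (ℤ.+ 0) ⊕ ((𝟙 ⊗ (𝟙 ⊕ q ⊗ 𝟙)) ⊗ (𝟙 ⊗ 𝟙)) ⊗ (𝟙 ⊗ (𝟙 ⊗ o))) ⊜ (𝟙 ⊖ (q ⊗ q) ⊗ 𝟙) ⊗ o) refl q (vo 0) ⟩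
        (1# - a * 1#) * vo 0   ≈⟨ vo-inv 0 ⟩
        1#                     ≈⟨ solve 0 (𝟙 ⊜ 𝟙 ⊗ (𝟙 ⊗ 𝟙)) refl ⟩
        1# * (1# * 1#)         ∎
      bailey (suc j) = cancel-unit _ _ x-unit (begin
        x * ((1# - q) * S′)         ≈⟨ solve 3 (λ x q s → x ⊗ (q ⊗ s) ⊜ q ⊗ (x ⊗ s)) refl _ _ _ ⟩
        (1# - q) * (x * S′)         ≈⟨ *-congˡ (X-step j) ⟩
        (1# - q) * (Y (P ^ j) * S)  ≈⟨ solve 3 (λ q y s → q ⊗ (y ⊗ s) ⊜ (q ⊗ s) ⊗ y) refl _ _ _ ⟩
        ((1# - q) * S) * Y (P ^ j)  ≈⟨ *-congʳ (bailey j) ⟩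
        β j * Y (P ^ j)             ≈⟨ *-identityˡ _ ⟨
        1# * (β j * Y (P ^ j))      ≈⟨ *-congʳ x-unit ⟨
        (x * (v j * (v₃ j * v₅ j))) * ((pocha j * (pochP⁻¹ j * poch₃₅⁻¹ j)) * Y (P ^ j))
          ≈⟨ solve 8 (λ x v v3 v5 o f h y → (x ⊗ (v ⊗ (v3 ⊗ v5))) ⊗ ((o ⊗ (f ⊗ h)) ⊗ y) ⊜ x ⊗ ((o ⊗ y) ⊗ ((f ⊗ v) ⊗ (h ⊗ (v3 ⊗ v5))))) refl _ _ _ _ _ _ _ _ ⟩
        x * β (suc j)               ∎)
        where
        x = X (P ^ j)
        S′ = sum (bailey-term (suc j)) (suc (suc j))
        S = sum (bailey-term j) (suc j)
        x-unit : x * (v j * (v₃ j * v₅ j)) ≈ 1#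
        x-unit = trans (solve 6 (λ x v y s z t → (x ⊗ (y ⊗ z)) ⊗ (v ⊗ (s ⊗ t)) ⊜ (x ⊗ v) ⊗ ((y ⊗ s) ⊗ (z ⊗ t))) refl _ _ _ _ _ _)
                 (trans (*-cong (v-inv j) (*-cong (v₃-inv j) (v₅-inv j))) (solve 0 (𝟙 ⊗ (𝟙 ⊗ 𝟙) ⊜ 𝟙) refl))

      -- Bailey's lemma: one triangular double sum is evaluated in two orders. For fixed outer index
      -- k the columns sum by `bailey`, and for fixed r the rows sum by `conjugate`.
      watson : ∀ N →
        (1# - q) * sum (λ r → α r * ((pochP (N ℕ.+ r) * pochP⁻¹ (N ∸ r)) * (pocha (N ∸ r) * pocha⁻¹ (suc (N ℕ.+ r))))) (suc N)
        ≈ sum (λ k → (ε (N ∸ k) * (pochP (N ℕ.+ k) * pochP⁻¹ (N ∸ k))) * β k) (suc N)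
      watson N = begin
        (1# - q) * sum (λ r → α r * ((pochP (N ℕ.+ r) * pochP⁻¹ (N ∸ r)) * (pocha (N ∸ r) * pocha⁻¹ (suc (N ℕ.+ r))))) (suc N)
          ≈⟨ *-congˡ (sum-cong (suc N) (λ r r<1+N → row r (ℕₚ.≤-pred r<1+N))) ⟨
        (1# - q) * sum (λ r → sum (F r) (suc N ∸ r)) (suc N)   ≈⟨ *-congˡ (△-rows F (suc N)) ⟨
        (1# - q) * △ F (suc N)                                 ≈⟨ *-distribˡ-sum _ _ (suc N) ⟩
        sum (λ k → (1# - q) * sum (λ j → F j (k ∸ j)) (suc k)) (suc N)
          ≈⟨ sum-cong (suc N) (λ k _ → column k) ⟩
        sum (λ k → w k * β k) (suc N)                          ∎
        where
        w : ℕ → Carrier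
        w k = ε (N ∸ k) * (pochP (N ℕ.+ k) * pochP⁻¹ (N ∸ k))
        F : ℕ → ℕ → Carrier
        F r i = α r * (w (r ℕ.+ i) * (pochP⁻¹ i * pocha⁻¹ (suc (r ℕ.+ r ℕ.+ i))))
        column : ∀ k → (1# - q) * sum (λ j → F j (k ∸ j)) (suc k) ≈ w k * β k
        column k = begin
          (1# - q) * sum (λ j → F j (k ∸ j)) (suc k)
            ≈⟨ *-congˡ (trans (sum-cong (suc k) (λ j j<1+k → entry j (ℕₚ.≤-pred j<1+k))) (sym (*-distribˡ-sum (w k) _ (suc k)))) ⟩
          (1# - q) * (w k * sum (bailey-term k) (suc k))   ≈⟨ solve 3 (λ x y z → x ⊗ (y ⊗ z) ⊜ y ⊗ (x ⊗ z)) refl _ _ _ ⟩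
          w k * ((1# - q) * sum (bailey-term k) (suc k))   ≈⟨ *-congˡ (bailey k) ⟩
          w k * β k                                        ∎
          where
          entry : ∀ j → j ≤ k → F j (k ∸ j) ≈ w k * bailey-term k j
          entry j j≤k = begin
            α j * (w (j ℕ.+ (k ∸ j)) * (pochP⁻¹ (k ∸ j) * pocha⁻¹ (suc (j ℕ.+ j ℕ.+ (k ∸ j)))))
              ≡⟨ ≡.cong₂ (λ l l′ → α j * (w l * (pochP⁻¹ (k ∸ j) * pocha⁻¹ (suc l′)))) (ℕₚ.m+[n∸m]≡n j≤k)
                   (≡.trans (ℕₚ.+-assoc j j (k ∸ j)) (≡.trans (≡.cong (j ℕ.+_) (ℕₚ.m+[n∸m]≡n j≤k)) (ℕₚ.+-comm j k))) ⟩
            α j * (w k * (pochP⁻¹ (k ∸ j) * pocha⁻¹ (suc (k ℕ.+ j))))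
              ≈⟨ solve 3 (λ x y z → x ⊗ (y ⊗ z) ⊜ y ⊗ (x ⊗ z)) refl _ _ _ ⟩
            w k * bailey-term k j ∎
        row : ∀ r → r ≤ N → sum (F r) (suc N ∸ r) ≈ α r * ((pochP (N ℕ.+ r) * pochP⁻¹ (N ∸ r)) * (pocha (N ∸ r) * pocha⁻¹ (suc (N ℕ.+ r))))
        row r r≤N = begin
          sum (F r) (suc N ∸ r)       ≡⟨ ≡.cong (sum (F r)) (ℕₚ.+-∸-assoc 1 r≤N) ⟩
          sum (F r) (suc n)           ≈⟨ sum-cong (suc n) (λ i _ → reflexive (≡.cong₂ (λ l l′ → α r * ((ε l′ * (pochP l * pochP⁻¹ l′)) * (pochP⁻¹ i * pocha⁻¹ (suc (r ℕ.+ r ℕ.+ i))))) (idx i) (≡.sym (ℕₚ.∸-+-assoc N r i)))) ⟩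
          sum (λ i → α r * conjugate-term n (r ℕ.+ r) i) (suc n)    ≈⟨ *-distribˡ-sum (α r) _ (suc n) ⟨
          α r * sum (conjugate-term n (r ℕ.+ r)) (suc n)            ≈⟨ *-congˡ (conjugate n (r ℕ.+ r)) ⟩
          α r * ((pochP (n ℕ.+ (r ℕ.+ r)) * pochP⁻¹ n) * (pocha n * pocha⁻¹ (suc (r ℕ.+ r) ℕ.+ n)))
            ≡⟨ ≡.cong₂ (λ l l′ → α r * ((pochP l * pochP⁻¹ n) * (pocha n * pocha⁻¹ (suc l′)))) n+2r (≡.trans (ℕₚ.+-comm (r ℕ.+ r) n) n+2r) ⟩
          α r * ((pochP (N ℕ.+ r) * pochP⁻¹ n) * (pocha n * pocha⁻¹ (suc (N ℕ.+ r)))) ∎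
          where
          n = N ∸ r
          n+2r : n ℕ.+ (r ℕ.+ r) ≡ N ℕ.+ r
          n+2r = ≡.trans (≡.sym (ℕₚ.+-assoc n r r)) (≡.cong (ℕ._+ r) (ℕₚ.m∸n+n≡m r≤N))
          idx : ∀ i → N ℕ.+ (r ℕ.+ i) ≡ n ℕ.+ (r ℕ.+ r) ℕ.+ i
          idx i = ≡.trans (≡.sym (ℕₚ.+-assoc N r i)) (≡.cong (ℕ._+ i) (≡.sym n+2r))

      module Terminating
        (N : ℕ) (r z : Carrier) (v′ w : ℕ → Carrier)
        (r-inv : (1# + q) * r ≈ 1#)
        (z-eq : (a * P ^ N) * z ≈ (1# - a * P ^ N) * (1# - a * P ^ N))
        (v′-inv : ∀ i → i < N → (1# - P ^ suc i) * v′ i ≈ 1#)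
        (w-inv : ∀ i → i < N → denX z i * w i ≈ 1#)
        where
        open Series r v′ w z
        open Factorisation R q N z z-eq

        private
          x : Carrier
          x = a * P ^ N

          x-unit : ∀ {y y′} → x * y ≈ x * y′ → y ≈ y′
          x-unit = cancel-unit _ _ (aP^-inv N)

          quotient : ∀ k → k < N → P ^ suc k * (numX z k * w k)
            ≈ (a * P ^ k) * (((1# - P ^ suc (N ∸ suc k)) * (1# - P ^ suc (N ℕ.+ k))) * (vo (N ∸ suc k) * vo (suc (N ℕ.+ k))))
          quotient k k<N = cancel-unit _ _ (w-inv k k<N) (x-unit (begin
            x * (D * (R′ * (M * w k)))
              ≈⟨ solve 5 (λ x D R M w → x ⊗ (D ⊗ (R ⊗ (M ⊗ w))) ⊜ (D ⊗ w) ⊗ ((x ⊗ M) ⊗ R)) refl _ _ _ _ _ ⟩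
            (D * w k) * ((x * M) * R′)                                ≈⟨ *-cong (w-inv k k<N) (*-congʳ (x-numX k k<N)) ⟩
            1# * ((- A * (B * C)) * R′)                               ≈⟨ solve 4 (λ A B C R → 𝟙 ⊗ ((⊝ A ⊗ (B ⊗ C)) ⊗ R) ⊜ (⊝ R ⊗ (A ⊗ (B ⊗ C))) ⊗ (𝟙 ⊗ 𝟙)) refl _ _ _ _ ⟩
            (- R′ * (A * (B * C))) * (1# * 1#)                        ≈⟨ *-congˡ (*-cong (vo-inv e) (vo-inv f)) ⟨
            (- R′ * (A * (B * C))) * (((1# - a * P ^ e) * vo e) * ((1# - a * P ^ f) * vo f))
              ≈⟨ solve 7 (λ R A BC s s′ t t′ → (⊝ R ⊗ (A ⊗ BC)) ⊗ ((s ⊗ s′) ⊗ (t ⊗ t′)) ⊜ (⊝ R ⊗ (s ⊗ t)) ⊗ (A ⊗ (BC ⊗ (s′ ⊗ t′)))) refl _ _ _ _ _ _ _ ⟩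
            (- R′ * ((1# - a * P ^ e) * (1# - a * P ^ f))) * (A * ((B * C) * (vo e * vo f)))  ≈⟨ *-congʳ (x-denX k k<N) ⟨
            (x * D) * (A * ((B * C) * (vo e * vo f)))                 ≈⟨ *-assoc _ _ _ ⟩
            x * (D * (A * ((B * C) * (vo e * vo f))))                 ∎))
            where
            e = N ∸ suc k
            f = suc (N ℕ.+ k)
            D = denX z k
            M = numX z k
            R′ = P ^ suc k
            A = a * P ^ k
            B = 1# - P ^ suc e
            C = 1# - P ^ suc (N ℕ.+ k)

          v′≈v : ∀ k → k < N → v′ k ≈ v k
          v′≈v k k<N = cancel-unit _ _ (v-inv k) (trans (v′-inv k k<N) (sym (v-inv k)))

          upperP : ∀ n → pochP⁻¹ (suc n) * (1# - P ^ suc n) ≈ pochP⁻¹ n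
          upperP n = sym (lowerP n)

          uppera : ∀ n → pocha (suc n) * vo n ≈ pocha n
          uppera n = trans (*-assoc _ _ _) (trans (*-congˡ (vo-inv n)) (*-identityʳ _))

        -- The factor 1 - x normalises k = 0, where the right-hand product contains (a;P)_N /
        -- (a;P)_(N+1) = 1/(1 - x). Each step multiplies by the split form `quotient` of the
        -- deformed factors.
        d≈ : ∀ k → k ≤ N → d k ≈ ((ε k * (pocha k * pochP⁻¹ k)) * ((pochP (N ℕ.+ k) * pochP⁻¹ (N ∸ k)) * (pocha (N ∸ k) * pocha⁻¹ (suc (N ℕ.+ k))))) * (1# - x)
        d≈ zero _ = sym (begin
          ((1# * (1# * 1#)) * ((pochP (N ℕ.+ 0) * pochP⁻¹ N) * (pocha N * pocha⁻¹ (suc (N ℕ.+ 0))))) * (1# - x)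
            ≡⟨ ≡.cong (λ l → ((1# * (1# * 1#)) * ((pochP l * pochP⁻¹ N) * (pocha N * pocha⁻¹ (suc l)))) * (1# - x)) (ℕₚ.+-identityʳ N) ⟩
          ((1# * (1# * 1#)) * ((pochP N * pochP⁻¹ N) * (pocha N * pocha⁻¹ (suc N)))) * (1# - x)
            ≈⟨ solve 4 (λ p o o′ y → ((𝟙 ⊗ (𝟙 ⊗ 𝟙)) ⊗ (p ⊗ (o ⊗ o′))) ⊗ y ⊜ p ⊗ ((o ⊗ y) ⊗ o′)) refl _ _ _ _ ⟩
          (pochP N * pochP⁻¹ N) * (pocha (suc N) * pocha⁻¹ (suc N))   ≈⟨ *-cong (pochP-inv N) (pocha-inv (suc N)) ⟩
          1# * 1#                                                     ≈⟨ *-identityˡ _ ⟩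
          1# ∎)
        d≈ (suc k) k<N = begin
          d k * - (P ^ suc k * (((1# - a * P ^ k) * numX z k) * (v′ k * w k)))
            ≈⟨ *-cong (d≈ k (ℕₚ.<⇒≤ k<N)) (-‿cong (*-congˡ (*-congˡ (*-congʳ (v′≈v k k<N))))) ⟩
          (((ε k * (pocha k * pochP⁻¹ k)) * ((pochP (N ℕ.+ k) * pochP⁻¹ (N ∸ k)) * (pocha (N ∸ k) * pocha⁻¹ (suc (N ℕ.+ k))))) * (1# - x))
            * - (P ^ suc k * (((1# - a * P ^ k) * numX z k) * (v k * w k)))
            ≡⟨ ≡.cong (λ l → (((ε k * (pocha k * pochP⁻¹ k)) * ((pochP (N ℕ.+ k) * pochP⁻¹ l) * (pocha l * pocha⁻¹ (suc (N ℕ.+ k))))) * (1# - x))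
                * - (P ^ suc k * (((1# - a * P ^ k) * numX z k) * (v k * w k)))) (∸-suc k<N) ⟩
          (((ε k * (pocha k * pochP⁻¹ k)) * ((pochP (N ℕ.+ k) * pochP⁻¹ (suc e)) * (pocha (suc e) * pocha⁻¹ (suc (N ℕ.+ k))))) * (1# - x))
            * - (P ^ suc k * (((1# - a * P ^ k) * numX z k) * (v k * w k)))
            ≈⟨ solve 10 (λ R y M v w G o f p1 p2 → (((G ⊗ (o ⊗ f)) ⊗ p1) ⊗ p2) ⊗ ⊝ (R ⊗ ((y ⊗ M) ⊗ (v ⊗ w)))
                   ⊜ (((G ⊗ ((o ⊗ y) ⊗ (f ⊗ v))) ⊗ p1) ⊗ p2) ⊗ ⊝ (R ⊗ (M ⊗ w))) refl
                 (P ^ suc k) (1# - a * P ^ k) (numX z k) (v k) (w k) (ε k) (pocha k) (pochP⁻¹ k) _ (1# - x) ⟩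
          (((ε k * (pocha (suc k) * pochP⁻¹ (suc k))) * ((pochP (N ℕ.+ k) * pochP⁻¹ (suc e)) * (pocha (suc e) * pocha⁻¹ (suc (N ℕ.+ k))))) * (1# - x)) * - (P ^ suc k * (numX z k * w k))
            ≈⟨ *-congˡ (-‿cong (quotient k k<N)) ⟩
          (((ε k * (pocha (suc k) * pochP⁻¹ (suc k))) * ((pochP (N ℕ.+ k) * pochP⁻¹ (suc e)) * (pocha (suc e) * pocha⁻¹ (suc (N ℕ.+ k))))) * (1# - x))
            * - ((a * P ^ k) * (((1# - P ^ suc e) * (1# - P ^ suc (N ℕ.+ k))) * (vo e * vo (suc (N ℕ.+ k)))))
            ≈⟨ solve 12 (λ G H p fe oe o′ y A s t u u′ →
                   (((G ⊗ H) ⊗ ((p ⊗ fe) ⊗ (oe ⊗ o′))) ⊗ y) ⊗ ⊝ (A ⊗ ((s ⊗ t) ⊗ (u ⊗ u′)))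
                   ⊜ (((G ⊗ ⊝ A) ⊗ H) ⊗ (((p ⊗ t) ⊗ (fe ⊗ s)) ⊗ ((oe ⊗ u) ⊗ (o′ ⊗ u′)))) ⊗ y) refl
                 (ε k) (pocha (suc k) * pochP⁻¹ (suc k)) (pochP (N ℕ.+ k)) (pochP⁻¹ (suc e)) (pocha (suc e)) (pocha⁻¹ (suc (N ℕ.+ k))) (1# - x) (a * P ^ k)
                 (1# - P ^ suc e) (1# - P ^ suc (N ℕ.+ k)) (vo e) (vo (suc (N ℕ.+ k))) ⟩
          ((ε (suc k) * (pocha (suc k) * pochP⁻¹ (suc k))) * ((pochP (suc (N ℕ.+ k)) * (pochP⁻¹ (suc e) * (1# - P ^ suc e))) * ((pocha (suc e) * vo e) * pocha⁻¹ (suc (suc (N ℕ.+ k)))))) * (1# - x)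
            ≈⟨ *-congʳ (*-congˡ (*-cong (*-congˡ (upperP e)) (*-congʳ (uppera e)))) ⟩
          ((ε (suc k) * (pocha (suc k) * pochP⁻¹ (suc k))) * ((pochP (suc (N ℕ.+ k)) * pochP⁻¹ e) * (pocha e * pocha⁻¹ (suc (suc (N ℕ.+ k)))))) * (1# - x)
            ≡⟨ ≡.cong (λ l → ((ε (suc k) * (pocha (suc k) * pochP⁻¹ (suc k))) * ((pochP l * pochP⁻¹ e) * (pocha e * pocha⁻¹ (suc l)))) * (1# - x)) (ℕₚ.+-suc N k) ⟨
          ((ε (suc k) * (pocha (suc k) * pochP⁻¹ (suc k))) * ((pochP (N ℕ.+ suc k) * pochP⁻¹ e) * (pocha e * pocha⁻¹ (suc (N ℕ.+ suc k))))) * (1# - x) ∎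
          where e = N ∸ suc k

        t≈ : ∀ k → k ≤ N → ε N * (τ v v₃ v₅ k * prod (numX z) k) ≈ (ε (N ∸ k) * (pochP (N ℕ.+ k) * pochP⁻¹ (N ∸ k))) * β k
        t≈ zero _ = begin
          ε N * (1# * 1#)     ≈⟨ solve 1 (λ e → e ⊗ (𝟙 ⊗ 𝟙) ⊜ (e ⊗ 𝟙) ⊗ (𝟙 ⊗ (𝟙 ⊗ 𝟙))) refl _ ⟩
          (ε N * 1#) * (1# * (1# * 1#))                   ≈⟨ *-congʳ (*-congˡ (pochP-inv N)) ⟨
          (ε N * (pochP N * pochP⁻¹ N)) * (1# * (1# * 1#))  ≡⟨ ≡.cong (λ l → (ε N * (pochP l * pochP⁻¹ N)) * (1# * (1# * 1#))) (ℕₚ.+-identityʳ N) ⟨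
          (ε N * (pochP (N ℕ.+ 0) * pochP⁻¹ N)) * (1# * (1# * 1#)) ∎
        t≈ (suc k) k<N = x-unit (begin
          x * (ε N * ((τ v v₃ v₅ k * (((a * y) * v k) * (v₃ k * v₅ k))) * (prod (numX z) k * M)))
            ≈⟨ solve 9 (λ x E T a y v h p M → x ⊗ (E ⊗ ((T ⊗ (((a ⊗ y) ⊗ v) ⊗ h)) ⊗ (p ⊗ M))) ⊜ ((E ⊗ (T ⊗ p)) ⊗ ((y ⊗ v) ⊗ h)) ⊗ (a ⊗ (x ⊗ M))) refl _ _ _ _ _ _ _ _ _ ⟩
          ((ε N * (τ v v₃ v₅ k * prod (numX z) k)) * ((y * v k) * (v₃ k * v₅ k))) * (a * (x * M))
            ≈⟨ *-cong (*-congʳ (t≈ k (ℕₚ.<⇒≤ k<N))) (*-congˡ (x-numX k k<N)) ⟩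
          (((ε (N ∸ k) * (pochP (N ℕ.+ k) * pochP⁻¹ (N ∸ k))) * β k) * ((y * v k) * (v₃ k * v₅ k))) * (a * (- (a * P ^ k) * (B * C)))
            ≡⟨ ≡.cong (λ l → (((ε l * (pochP (N ℕ.+ k) * pochP⁻¹ l)) * β k) * ((y * v k) * (v₃ k * v₅ k))) * (a * (- (a * P ^ k) * (B * C)))) (∸-suc k<N) ⟩
          ((((ε e * - (a * P ^ e)) * (pochP (N ℕ.+ k) * pochP⁻¹ (suc e))) * (pocha k * (pochP⁻¹ k * poch₃₅⁻¹ k))) * ((y * v k) * (v₃ k * v₅ k))) * (a * (- (a * P ^ k) * (B * C)))
            ≈⟨ solve 14 (λ E pe pk p fe o f h y v h′ a B C →
                  ((((E ⊗ ⊝ (a ⊗ pe)) ⊗ (p ⊗ fe)) ⊗ (o ⊗ (f ⊗ h))) ⊗ ((y ⊗ v) ⊗ h′)) ⊗ (a ⊗ (⊝ (a ⊗ pk) ⊗ (B ⊗ C)))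
                  ⊜ (a ⊗ (pk ⊗ (pe ⊗ (a ⊗ a)))) ⊗ ((E ⊗ ((p ⊗ C) ⊗ (fe ⊗ B))) ⊗ ((o ⊗ y) ⊗ ((f ⊗ v) ⊗ (h ⊗ h′))))) refl
                  (ε e) (P ^ e) (P ^ k) (pochP (N ℕ.+ k)) (pochP⁻¹ (suc e)) (pocha k) (pochP⁻¹ k) (poch₃₅⁻¹ k) y (v k) (v₃ k * v₅ k) a B C ⟩
          (a * (P ^ k * P ^ suc e)) * ((ε e * (pochP (suc (N ℕ.+ k)) * (pochP⁻¹ (suc e) * B))) * β (suc k))
            ≈⟨ *-cong (sym (x-split k<N)) (*-congʳ (*-congˡ (*-congˡ (upperP e)))) ⟩
          x * ((ε e * (pochP (suc (N ℕ.+ k)) * pochP⁻¹ e)) * β (suc k))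
            ≡⟨ ≡.cong (λ l → x * ((ε e * (pochP l * pochP⁻¹ e)) * β (suc k))) (ℕₚ.+-suc N k) ⟨
          x * ((ε e * (pochP (N ℕ.+ suc k) * pochP⁻¹ e)) * β (suc k)) ∎)
          where
          e = N ∸ suc k
          y = 1# - a * P ^ k
          M = numX z k
          B = 1# - P ^ suc e
          C = 1# - P ^ suc (N ℕ.+ k)

        exact : (1# - a) * sum c (suc N) ≈ (1# - x) * (ε N * sum (λ k → τ v v₃ v₅ k * prod (numX z) k) (suc N))
        exact = begin
          (1# - a) * sum c (suc N)
            ≈⟨ *-congˡ (trans (sum-cong (suc N) (λ k k<1+N → c≈ k (ℕₚ.≤-pred k<1+N))) (sym (*-distribˡ-sum _ _ (suc N)))) ⟩
          (1# - a) * ((r * (1# - x)) * S)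
            -- As a = q², 1 - a = (1 - q)(1 + q): the second factor cancels r, the first is the one
            -- `watson` carries.
            ≈⟨ solve 4 (λ q r y S → (𝟙 ⊖ q ⊗ q) ⊗ ((r ⊗ y) ⊗ S) ⊜ ((𝟙 ⊕ q) ⊗ r) ⊗ (y ⊗ ((𝟙 ⊖ q) ⊗ S))) refl q r (1# - x) S ⟩
          ((1# + q) * r) * ((1# - x) * ((1# - q) * S))     ≈⟨ *-cong r-inv (*-congˡ (watson N)) ⟩
          1# * ((1# - x) * sum (λ k → (ε (N ∸ k) * (pochP (N ℕ.+ k) * pochP⁻¹ (N ∸ k))) * β k) (suc N))
            ≈⟨ *-identityˡ _ ⟩
          (1# - x) * sum (λ k → (ε (N ∸ k) * (pochP (N ℕ.+ k) * pochP⁻¹ (N ∸ k))) * β k) (suc N)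
            ≈⟨ *-congˡ (trans (*-distribˡ-sum _ _ (suc N)) (sum-cong (suc N) (λ k k<1+N → t≈ k (ℕₚ.≤-pred k<1+N)))) ⟨
          (1# - x) * (ε N * sum (λ k → τ v v₃ v₅ k * prod (numX z) k) (suc N)) ∎
          where
          S = sum (λ k → α k * ((pochP (N ℕ.+ k) * pochP⁻¹ (N ∸ k)) * (pocha (N ∸ k) * pocha⁻¹ (suc (N ℕ.+ k))))) (suc N)
          c≈ : ∀ k → k ≤ N → c k ≈ (r * (1# - x)) * (α k * ((pochP (N ℕ.+ k) * pochP⁻¹ (N ∸ k)) * (pocha (N ∸ k) * pocha⁻¹ (suc (N ℕ.+ k)))))
          c≈ k k≤N = trans (*-congˡ (d≈ k k≤N))
            (solve 6 (λ s r e o p y → (s ⊗ r) ⊗ (((e ⊗ o) ⊗ p) ⊗ y) ⊜ (r ⊗ y) ⊗ (((e ⊗ s) ⊗ o) ⊗ p)) refl _ _ _ _ _ _)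

-- The reflection k ↦ m − k when q^n = −1

module _ (R : CRing) where
  open CommutativeRing R
  open Ops (ops R) using (_^_)
  module _ (q : Carrier) where
    open Sequences (ops R) q

    -- Used for the block of indices 0, ..., m (o = 0, M = m) and for the block m + 1, ..., 2m (o =
    -- m + 1, M = m - 1). The product of ratios restarts at o because the ratio at index m contains
    -- a power of 1 - q^(2n), which vanishes when q^n = -1 and must be split off first.
    module Reflection (r X : Carrier) (v w : ℕ → Carrier) (o M : ℕ)
      (aP≈1 : a * P ^ (M ℕ.+ (o ℕ.+ o)) ≈ 1#) (qP≈ : q * P ^ (o ℕ.+ M) ≈ - (a ^ M))
      (v-inv : ∀ i → i < M → (1# - P ^ suc (o ℕ.+ i)) * v (o ℕ.+ i) ≈ 1#)
      (w-inv : ∀ i → i < M → denX X (o ℕ.+ i) * w (o ℕ.+ i) ≈ 1#) where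
      open RingKit R hiding (_^_)
      open Series r v w X using (ratio)
      open import Relation.Binary.Reasoning.Setoid setoid

      private
        g num den ρ t D : ℕ → Carrier
        g i   = P ^ suc (o ℕ.+ i)
        num i = (1# - a * P ^ (o ℕ.+ i)) * numX X (o ℕ.+ i)
        den i = (1# - P ^ suc (o ℕ.+ i)) * denX X (o ℕ.+ i)
        ρ i   = ratio (o ℕ.+ i)
        t i   = q * P ^ (o ℕ.+ i)
        D     = prod ρ

        pair : ∀ i j → i ℕ.+ j ≡ M → a * (P ^ (o ℕ.+ i) * P ^ (o ℕ.+ j)) ≈ 1#
        pair i j eq = begin
          a * (P ^ (o ℕ.+ i) * P ^ (o ℕ.+ j))   ≈⟨ *-congˡ (^-+ P (o ℕ.+ i) (o ℕ.+ j)) ⟨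
          a * P ^ (o ℕ.+ i ℕ.+ (o ℕ.+ j))       ≡⟨ ≡.cong (λ l → a * P ^ l) (≡.trans (shuffle o i j) (≡.cong (ℕ._+ (o ℕ.+ o)) eq)) ⟩
          a * P ^ (M ℕ.+ (o ℕ.+ o))             ≈⟨ aP≈1 ⟩
          1#                                    ∎
          where
          shuffle : ∀ o i j → o ℕ.+ i ℕ.+ (o ℕ.+ j) ≡ i ℕ.+ j ℕ.+ (o ℕ.+ o)
          shuffle = solve-∀

        pair′ : ∀ i j → suc (i ℕ.+ j) ≡ M → (a * P ^ (o ℕ.+ i)) * P ^ suc (o ℕ.+ j) ≈ 1#
        pair′ i j eq = trans (*-assoc _ _ _) (trans (*-congˡ (*-congˡ (reflexive (≡.cong (P ^_) (≡.sym (ℕₚ.+-suc o j))))))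
                         (pair i (suc j) (≡.trans (ℕₚ.+-suc i j) eq)))

        t-pair : ∀ i j → i ℕ.+ j ≡ M → t i * t j ≈ 1#
        t-pair i j eq = trans (solve 3 (λ q x y → (q ⊗ x) ⊗ (q ⊗ y) ⊜ (q ⊗ q) ⊗ (x ⊗ y)) refl _ _ _) (pair i j eq)

        g-pair : ∀ i j → suc (i ℕ.+ j) ≡ M → g i * g j ≈ a
        g-pair i j eq = begin
          (P ^ (o ℕ.+ i) * P) * g j              ≈⟨ solve 3 (λ x y a → (x ⊗ (a ⊗ a)) ⊗ y ⊜ ((a ⊗ x) ⊗ y) ⊗ a) refl _ _ _ ⟩
          ((a * P ^ (o ℕ.+ i)) * g j) * a        ≈⟨ *-congʳ (pair′ i j eq) ⟩
          1# * a                                 ≈⟨ *-identityˡ _ ⟩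
          a                                      ∎

        -- With u = P^(o+j+1) and y = aP^(o+i) one has uy = 1, and (1 - y)²/y - X is invariant under
        -- y ↦ 1/y. This is why the reflection survives the deformation for every X.
        den-reflect : ∀ i j → suc (i ℕ.+ j) ≡ M → den j ≈ ((g j * g j) * g j) * - num i
        den-reflect i j eq = sym (begin
          ((u * u) * u) * - ((1# - y) * ((1# - y) * (1# - y) - X * y))
            ≈⟨ solve 3 (λ u y X → ((u ⊗ u) ⊗ u) ⊗ ⊝ ((𝟙 ⊖ y) ⊗ ((𝟙 ⊖ y) ⊗ (𝟙 ⊖ y) ⊖ X ⊗ y))
                 ⊜ (y ⊗ u ⊖ u) ⊗ ((y ⊗ u ⊖ u) ⊗ (y ⊗ u ⊖ u) ⊖ X ⊗ ((y ⊗ u) ⊗ u))) refl u y X ⟩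
          (y * u - u) * ((y * u - u) * (y * u - u) - X * ((y * u) * u))
            ≈⟨ *-cong 1-u (+-cong (*-cong 1-u 1-u) (-‿cong (*-congˡ (trans (*-congʳ yu) (*-identityˡ u))))) ⟩
          (1# - u) * ((1# - u) * (1# - u) - X * u) ∎)
          where
          u = g j
          y = a * P ^ (o ℕ.+ i)
          yu = pair′ i j eq
          1-u = +-congʳ yu

        ρ-den : ∀ i → i < M → ρ i * den i ≈ g i * - num i
        ρ-den i i<M = begin
          - (g i * (num i * (v (o ℕ.+ i) * w (o ℕ.+ i)))) * ((1# - P ^ suc (o ℕ.+ i)) * denX X (o ℕ.+ i))
            ≈⟨ solve 6 (λ g n v w x y → ⊝ (g ⊗ (n ⊗ (v ⊗ w))) ⊗ (x ⊗ y) ⊜ (g ⊗ ⊝ n) ⊗ ((x ⊗ v) ⊗ (y ⊗ w))) refl _ _ _ _ _ _ ⟩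
          (g i * - num i) * (((1# - P ^ suc (o ℕ.+ i)) * v (o ℕ.+ i)) * (denX X (o ℕ.+ i) * w (o ℕ.+ i)))
            ≈⟨ *-congˡ (*-cong (v-inv i i<M) (w-inv i i<M)) ⟩
          (g i * - num i) * (1# * 1#)   ≈⟨ solve 1 (λ x → x ⊗ (𝟙 ⊗ 𝟙) ⊜ x) refl _ ⟩
          g i * - num i                 ∎

        den-inv : ∀ i → i < M → den i * (v (o ℕ.+ i) * w (o ℕ.+ i)) ≈ 1#
        den-inv i i<M = trans (solve 4 (λ x y v w → (x ⊗ y) ⊗ (v ⊗ w) ⊜ (x ⊗ v) ⊗ (y ⊗ w)) refl _ _ _ _)
                          (trans (*-cong (v-inv i i<M) (w-inv i i<M)) (*-identityˡ _))

        <-left : ∀ {i j} → suc (i ℕ.+ j) ≡ M → i < M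
        <-left {i} {j} eq = ≡.subst (suc i ≤_) eq (s≤s (ℕₚ.m≤m+n i j))

        <-right : ∀ {i j} → suc (i ℕ.+ j) ≡ M → j < M
        <-right {i} {j} eq = ≡.subst (suc j ≤_) eq (s≤s (ℕₚ.m≤n+m j i))

        ρ-pair : ∀ i j → suc (i ℕ.+ j) ≡ M → (ρ i * ρ j) * P ≈ 1#
        ρ-pair i j eq = cancel-unit _ _ unit (begin
          (den i * den j) * ((ρ i * ρ j) * P)   ≈⟨ solve 5 (λ x y s t P → (x ⊗ y) ⊗ ((s ⊗ t) ⊗ P) ⊜ ((s ⊗ x) ⊗ (t ⊗ y)) ⊗ P) refl _ _ _ _ _ ⟩
          ((ρ i * den i) * (ρ j * den j)) * P   ≈⟨ *-congʳ (*-cong (ρ-den i (<-left eq)) (ρ-den j (<-right eq))) ⟩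
          ((g i * - num i) * (g j * - num j)) * (a * a)
            ≈⟨ *-congˡ (*-cong (g-pair i j eq) (g-pair i j eq)) ⟨
          ((g i * - num i) * (g j * - num j)) * ((g i * g j) * (g i * g j))
            ≈⟨ solve 4 (λ x y s t → ((x ⊗ s) ⊗ (y ⊗ t)) ⊗ ((x ⊗ y) ⊗ (x ⊗ y)) ⊜ ((((x ⊗ x) ⊗ x) ⊗ t) ⊗ (((y ⊗ y) ⊗ y) ⊗ s)) ⊗ 𝟙) refl _ _ _ _ ⟩
          ((((g i * g i) * g i) * - num j) * (((g j * g j) * g j) * - num i)) * 1#
            ≈⟨ *-congʳ (*-cong (den-reflect j i (≡.trans (≡.cong suc (ℕₚ.+-comm j i)) eq)) (den-reflect i j eq)) ⟨
          (den i * den j) * 1# ∎)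
          where
          unit : (den i * den j) * ((v (o ℕ.+ i) * w (o ℕ.+ i)) * (v (o ℕ.+ j) * w (o ℕ.+ j))) ≈ 1#
          unit = trans (solve 4 (λ x y v w → (x ⊗ y) ⊗ (v ⊗ w) ⊜ (x ⊗ v) ⊗ (y ⊗ w)) refl _ _ _ _)
                       (trans (*-cong (den-inv i (<-left eq)) (den-inv j (<-right eq))) (*-identityˡ _))

        mirror : ∀ i → i < M → suc (i ℕ.+ (M ∸ suc i)) ≡ M
        mirror i = ℕₚ.m+[n∸m]≡n

        mirror-unique : ∀ i j → suc (i ℕ.+ j) ≡ M → M ∸ suc j ≡ i
        mirror-unique i j eq = ≡.trans (≡.cong (_∸ suc j) (≡.trans (≡.sym eq) (≡.sym (ℕₚ.+-suc i j)))) (ℕₚ.m+n∸n≡m i (suc j))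

        Γ² : prod g M * prod g M ≈ a ^ M
        Γ² = begin
          prod g M * prod g M
            ≈⟨ *-congˡ (prod-reverse M (λ i j eq → reflexive (≡.cong g (≡.sym (mirror-unique i j eq))))) ⟩
          prod g M * prod (λ i → g (M ∸ suc i)) M    ≈⟨ prod-* _ _ M ⟨
          prod (λ i → g i * g (M ∸ suc i)) M         ≈⟨ prod-cong M (λ i i<M → g-pair i _ (mirror i i<M)) ⟩
          a ^ M                                      ∎

        prod-den : prod den M ≈ ((prod g M * prod g M) * prod g M) * prod (λ i → - num i) M
        prod-den = begin
          prod den M
            ≈⟨ prod-cong M (λ j j<M → den-reflect _ j (≡.trans (≡.cong suc (ℕₚ.+-comm (M ∸ suc j) j)) (mirror j j<M))) ⟩
          prod (λ j → ((g j * g j) * g j) * - num (M ∸ suc j)) M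
            ≈⟨ trans (prod-* _ _ M) (*-cong (trans (prod-* _ _ M) (*-congʳ (prod-* _ _ M)))
                 (prod-reverse M λ i j eq → reflexive (≡.cong (-_ ∘ num) (mirror-unique j i (≡.trans (≡.cong suc (ℕₚ.+-comm j i)) eq))))) ⟩
          ((prod g M * prod g M) * prod g M) * prod (λ i → - num i) M ∎

        -- Reversing the index in `den-reflect` compares all denominators with all numerators. With
        -- Γ = `prod g M` the product of the ratios is Γ/Γ³, and Γ² = a^M by pairing i with M - 1 -
        -- i.
        D-top : D M * (a ^ M) ≈ 1#
        D-top = cancel-unit _ _ unit (begin
          prod den M * (D M * a ^ M)             ≈⟨ solve 3 (λ x y z → x ⊗ (y ⊗ z) ⊜ (y ⊗ x) ⊗ z) refl _ _ _ ⟩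
          (D M * prod den M) * a ^ M             ≈⟨ *-cong (trans (sym (prod-* _ _ M)) (trans (prod-cong M ρ-den) (prod-* _ _ M))) (sym Γ²) ⟩
          (prod g M * prod (λ i → - num i) M) * (prod g M * prod g M)
            ≈⟨ solve 2 (λ g n → (g ⊗ n) ⊗ (g ⊗ g) ⊜ (((g ⊗ g) ⊗ g) ⊗ n) ⊗ 𝟙) refl _ _ ⟩
          (((prod g M * prod g M) * prod g M) * prod (λ i → - num i) M) * 1#  ≈⟨ *-congʳ prod-den ⟨
          prod den M * 1#                        ∎)
          where
          unit : prod den M * prod (λ i → v (o ℕ.+ i) * w (o ℕ.+ i)) M ≈ 1#
          unit = trans (sym (prod-* _ _ M)) (trans (prod-cong M den-inv) (1^ M))

        -- Induction on i moves one ratio across by `ρ-pair`. The minus sign enters only in the base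
        -- case, through `qP≈`, and is the trace of q^n = -1.
        D-reflect : ∀ i j → i ℕ.+ j ≡ M → D j * t j ≈ - D i
        D-reflect zero .M ≡.refl = begin
          D M * (q * P ^ (o ℕ.+ M))   ≈⟨ *-congˡ qP≈ ⟩
          D M * - (a ^ M)             ≈⟨ -‿distribʳ-* _ _ ⟨
          - (D M * a ^ M)             ≈⟨ -‿cong D-top ⟩
          - 1#                        ∎
        D-reflect (suc i) j eq = begin
          D j * t j                           ≈⟨ *-identityʳ _ ⟨
          (D j * t j) * 1#                    ≈⟨ *-congˡ (ρ-pair i j eq) ⟨
          (D j * (q * P ^ (o ℕ.+ j))) * ((ρ i * ρ j) * P)
            ≈⟨ solve 6 (λ d q p x y P → (d ⊗ (q ⊗ p)) ⊗ ((x ⊗ y) ⊗ P) ⊜ ((d ⊗ y) ⊗ (q ⊗ (p ⊗ P))) ⊗ x) refl _ _ _ _ _ _ ⟩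
          (D (suc j) * (q * P ^ suc (o ℕ.+ j))) * ρ i
            ≈⟨ *-congʳ (*-congˡ (*-congˡ (reflexive (≡.cong (P ^_) (≡.sym (ℕₚ.+-suc o j)))))) ⟩
          (D (suc j) * t (suc j)) * ρ i       ≈⟨ *-congʳ (D-reflect i (suc j) (≡.trans (ℕₚ.+-suc i j) eq)) ⟩
          - D i * ρ i                         ≈⟨ -‿distribˡ-* _ _ ⟨
          - D (suc i)                         ∎

      reflect : ∀ i j → i ℕ.+ j ≡ M →
        (1# + q * P ^ (o ℕ.+ i)) * prod (λ l → ratio (o ℕ.+ l)) i ≈ - ((1# + q * P ^ (o ℕ.+ j)) * prod (λ l → ratio (o ℕ.+ l)) j)
      reflect i j eq = sym (begin
        - ((1# + t j) * D j)                   ≈⟨ solve 2 (λ t d → ⊝ ((𝟙 ⊕ t) ⊗ d) ⊜ ⊝ (𝟙 ⊗ d) ⊖ d ⊗ t) refl _ _ ⟩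
        - (1# * D j) - D j * t j               ≈⟨ +-congʳ (-‿cong (*-congʳ (t-pair i j eq))) ⟨
        - ((t i * t j) * D j) - D j * t j      ≈⟨ solve 3 (λ s t d → ⊝ ((s ⊗ t) ⊗ d) ⊖ d ⊗ t ⊜ ⊝ (s ⊗ (d ⊗ t)) ⊖ d ⊗ t) refl _ _ _ ⟩
        - (t i * (D j * t j)) - D j * t j      ≈⟨ +-cong (-‿cong (*-congˡ (D-reflect i j eq))) (-‿cong (D-reflect i j eq)) ⟩
        - (t i * - D i) - - D i                ≈⟨ solve 2 (λ t d → ⊝ (t ⊗ ⊝ d) ⊖ ⊝ d ⊜ (𝟙 ⊕ t) ⊗ d) refl _ _ ⟩
        (1# + t i) * D i                       ∎)

-- Quotients, extensions and localizations of commutative rings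

module _ {A : Set} (O : Ops A) (_≈_ : A → A → Set) where
  open Ops O

  record RingLaws : Set where
    field
      isEquivalence : IsEquivalence _≈_
      +-cong      : ∀ {x y u v} → x ≈ y → u ≈ v → (x + u) ≈ (y + v)
      *-cong      : ∀ {x y u v} → x ≈ y → u ≈ v → (x * u) ≈ (y * v)
      -‿cong      : ∀ {x y} → x ≈ y → (- x) ≈ (- y)
      +-assoc     : ∀ x y z → ((x + y) + z) ≈ (x + (y + z))
      +-comm      : ∀ x y → (x + y) ≈ (y + x)
      +-identityˡ : ∀ x → (0# + x) ≈ x
      +-inverseˡ  : ∀ x → ((- x) + x) ≈ 0#
      *-assoc     : ∀ x y z → ((x * y) * z) ≈ (x * (y * z))
      *-comm      : ∀ x y → (x * y) ≈ (y * x)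
      *-identityˡ : ∀ x → (1# * x) ≈ x
      distribˡ    : ∀ x y z → (x * (y + z)) ≈ ((x * y) + (x * z))

  commutativeRing : RingLaws → CRing
  commutativeRing laws = record
    { Carrier = A ; _≈_ = _≈_ ; _+_ = _+_ ; _*_ = _*_ ; -_ = -_ ; 0# = 0# ; 1# = 1#
    ; isCommutativeRing = record
      { isRing = record
        { +-isAbelianGroup = record
          { isGroup = record
            { isMonoid = record
              { isSemigroup = record { isMagma = record { isEquivalence = isEquivalence ; ∙-cong = +-cong } ; assoc = +-assoc }
              ; identity = +-identityˡ , λ x → trans (+-comm x 0#) (+-identityˡ x) }
            ; inverse = +-inverseˡ , λ x → trans (+-comm x (- x)) (+-inverseˡ x)
            ; ⁻¹-cong = -‿cong }
          ; comm = +-comm }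
        ; *-cong = *-cong
        ; *-assoc = *-assoc
        ; *-identity = *-identityˡ , λ x → trans (*-comm x 1#) (*-identityˡ x)
        ; distrib = distribˡ , λ x y z → trans (*-comm (y + z) x) (trans (distribˡ x y z) (+-cong (*-comm x y) (*-comm x z))) }
      ; *-comm = *-comm } }
    where
    open RingLaws laws
    open IsEquivalence isEquivalence using (trans)

record Hom (R S : CRing) : Set where
  private
    module R = CommutativeRing R
    module S = CommutativeRing S
  field
    ⟦_⟧    : R.Carrier → S.Carrier
    ⟦⟧-cong : ∀ {x y} → x R.≈ y → ⟦ x ⟧ S.≈ ⟦ y ⟧
    +-homo : ∀ x y → ⟦ x R.+ y ⟧ S.≈ ⟦ x ⟧ S.+ ⟦ y ⟧
    *-homo : ∀ x y → ⟦ x R.* y ⟧ S.≈ ⟦ x ⟧ S.* ⟦ y ⟧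
    -‿homo : ∀ x → ⟦ R.- x ⟧ S.≈ S.- ⟦ x ⟧
    0-homo : ⟦ R.0# ⟧ S.≈ S.0#
    1-homo : ⟦ R.1# ⟧ S.≈ S.1#

  open Ops (ops R) using () renaming (sum to sumR; prod to prodR; _^_ to _^R_)
  open Ops (ops S) using () renaming (sum to sumS; prod to prodS; _^_ to _^S_)

  sum-homo : ∀ f n → ⟦ sumR f n ⟧ S.≈ sumS (λ i → ⟦ f i ⟧) n
  sum-homo f zero    = 0-homo
  sum-homo f (suc n) = S.trans (+-homo _ _) (S.+-congʳ (sum-homo f n))

  prod-homo : ∀ f n → ⟦ prodR f n ⟧ S.≈ prodS (λ i → ⟦ f i ⟧) n
  prod-homo f zero    = 1-homo
  prod-homo f (suc n) = S.trans (*-homo _ _) (S.*-congʳ (prod-homo f n))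

  ^-homo : ∀ x n → ⟦ x ^R n ⟧ S.≈ ⟦ x ⟧ ^S n
  ^-homo x n = prod-homo (λ _ → x) n

  unit-homo : ∀ {x y} → x R.* y R.≈ R.1# → ⟦ x ⟧ S.* ⟦ y ⟧ S.≈ S.1#
  unit-homo p = S.trans (S.sym (*-homo _ _)) (S.trans (⟦⟧-cong p) 1-homo)

  2-unit-homo : ∀ {y} → (R.1# R.+ R.1#) R.* y R.≈ R.1# → (S.1# S.+ S.1#) S.* ⟦ y ⟧ S.≈ S.1#
  2-unit-homo p = S.trans (S.*-congʳ (S.sym (S.trans (+-homo _ _) (S.+-cong 1-homo 1-homo)))) (unit-homo p)

  1-‿homo : ∀ x → ⟦ R.1# R.- x ⟧ S.≈ S.1# S.- ⟦ x ⟧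
  1-‿homo x = S.trans (+-homo _ _) (S.+-cong 1-homo (-‿homo x))

  1-^-unit : ∀ x k {y} → ⟦ R.1# R.- x ^R k ⟧ S.* y S.≈ S.1# → (S.1# S.- ⟦ x ⟧ ^S k) S.* y S.≈ S.1#
  1-^-unit x k p = S.trans (S.*-congʳ (S.sym (S.trans (1-‿homo _) (S.+-congˡ (S.-‿cong (^-homo x k)))))) p

module SeriesHom {R S : CRing} (φ : Hom R S) where
  open Hom φ
  private
    module R = CommutativeRing R
    module S = CommutativeRing S
  open RingKit S using (prod-cong; ^-cong)

  module _ (q : R.Carrier) (q′ : S.Carrier) (q-homo : ⟦ q ⟧ S.≈ q′) where
    private
      module Q  = Sequences (ops R) q
      module Q′ = Sequences (ops S) q′
    open Ops (ops R) using () renaming (_^_ to _^R_)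
    open Ops (ops S) using () renaming (_^_ to _^S_)

    a-homo : ⟦ Q.a ⟧ S.≈ Q′.a
    a-homo = S.trans (*-homo _ _) (S.*-cong q-homo q-homo)

    P-homo : ⟦ Q.P ⟧ S.≈ Q′.P
    P-homo = S.trans (*-homo _ _) (S.*-cong a-homo a-homo)

    P^-homo : ∀ k → ⟦ Q.P ^R k ⟧ S.≈ Q′.P ^S k
    P^-homo k = S.trans (^-homo _ k) (^-cong k P-homo)

    aP^-homo : ∀ k → ⟦ Q.a R.* Q.P ^R k ⟧ S.≈ Q′.a S.* Q′.P ^S k
    aP^-homo k = S.trans (*-homo _ _) (S.*-cong a-homo (P^-homo k))

    1-P^-homo : ∀ k → ⟦ R.1# R.- Q.P ^R k ⟧ S.≈ S.1# S.- Q′.P ^S k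
    1-P^-homo k = S.trans (1-‿homo _) (S.+-congˡ (S.-‿cong (P^-homo k)))

    1-aP^-homo : ∀ k → ⟦ R.1# R.- Q.a R.* Q.P ^R k ⟧ S.≈ S.1# S.- Q′.a S.* Q′.P ^S k
    1-aP^-homo k = S.trans (1-‿homo _) (S.+-congˡ (S.-‿cong (aP^-homo k)))

    1-P^-unit-homo : ∀ k {y} → (R.1# R.- Q.P ^R k) R.* y R.≈ R.1# → (S.1# S.- Q′.P ^S k) S.* ⟦ y ⟧ S.≈ S.1#
    1-P^-unit-homo k p = S.trans (S.*-congʳ (S.sym (1-P^-homo k))) (unit-homo p)

    1+qa^-homo : ∀ k → ⟦ R.1# R.+ q R.* Q.a ^R k ⟧ S.≈ S.1# S.+ q′ S.* Q′.a ^S k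
    1+qa^-homo k = S.trans (+-homo _ _) (S.+-cong 1-homo (S.trans (*-homo _ _) (S.*-cong q-homo (S.trans (^-homo _ k) (^-cong k a-homo)))))

    ε-homo : ∀ k → ⟦ Q.ε k ⟧ S.≈ Q′.ε k
    ε-homo k = S.trans (prod-homo _ k) (prod-cong k λ i _ → S.trans (-‿homo _) (S.-‿cong (aP^-homo i)))

    module _ {X : R.Carrier} {X′ : S.Carrier} (X-homo : ⟦ X ⟧ S.≈ X′) where

      numX-homo : ∀ k → ⟦ Q.numX X k ⟧ S.≈ Q′.numX X′ k
      numX-homo k = S.trans (+-homo _ _) (S.+-cong
        (S.trans (*-homo _ _) (S.*-cong (1-aP^-homo k) (1-aP^-homo k)))
        (S.trans (-‿homo _) (S.-‿cong (S.trans (*-homo _ _) (S.*-cong X-homo (aP^-homo k))))))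

      denX-homo : ∀ k → ⟦ Q.denX X k ⟧ S.≈ Q′.denX X′ k
      denX-homo k = S.trans (+-homo _ _) (S.+-cong
        (S.trans (*-homo _ _) (S.*-cong (1-P^-homo (suc k)) (1-P^-homo (suc k))))
        (S.trans (-‿homo _) (S.-‿cong (S.trans (*-homo _ _) (S.*-cong X-homo (P^-homo (suc k)))))))

      module _ (r : R.Carrier) (v w : ℕ → R.Carrier) (r′ : S.Carrier) (v′ w′ : ℕ → S.Carrier)
               (r-homo : ⟦ r ⟧ S.≈ r′) (v-homo : ∀ i → ⟦ v i ⟧ S.≈ v′ i) (w-homo : ∀ i → ⟦ w i ⟧ S.≈ w′ i) where
        private
          module C  = Q.Series r v w X
          module C′ = Q′.Series r′ v′ w′ X′

        ratio-homo : ∀ i → ⟦ C.ratio i ⟧ S.≈ C′.ratio i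
        ratio-homo i = S.trans (-‿homo _) (S.-‿cong (S.trans (*-homo _ _) (S.*-cong (P^-homo (suc i))
          (S.trans (*-homo _ _) (S.*-cong (S.trans (*-homo _ _) (S.*-cong (1-aP^-homo i) (numX-homo i)))
            (S.trans (*-homo _ _) (S.*-cong (v-homo i) (w-homo i))))))))

        c-homo : ∀ k → ⟦ C.c k ⟧ S.≈ C′.c k
        c-homo k = S.trans (*-homo _ _) (S.*-cong
          (S.trans (*-homo _ _) (S.*-cong (S.trans (+-homo _ _) (S.+-cong 1-homo (S.trans (*-homo _ _) (S.*-cong q-homo (P^-homo k))))) r-homo))
          (S.trans (prod-homo _ k) (prod-cong k λ i _ → ratio-homo i)))

        sum-c-homo : ∀ n → ⟦ Ops.sum (ops R) C.c n ⟧ S.≈ Ops.sum (ops S) C′.c n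
        sum-c-homo n = S.trans (sum-homo _ n) (RingKit.sum-cong S n λ k _ → c-homo k)

module Quotient (R : CRing) (w : CommutativeRing.Carrier R) where
  open CommutativeRing R
  open RingKit R using (solve; _⊜_; _⊕_; _⊗_; _⊖_; ⊝_; 𝟙; Κ)
  open import Relation.Binary.Reasoning.Setoid setoid

  infix 4 _∼_
  _∼_ : Carrier → Carrier → Set
  x ∼ y = Σ[ u ∈ Carrier ] x - y ≈ w * u

  ≈⇒∼ : ∀ {x y} → x ≈ y → x ∼ y
  ≈⇒∼ {x} {y} p = 0# , trans (+-congʳ p) (solve 2 (λ y w → y ⊖ y ⊜ w ⊗ Κ (ℤ.+ 0)) refl y w)

  ∼0⇒ : ∀ {x} → x ∼ 0# → Σ[ u ∈ Carrier ] x ≈ w * u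
  ∼0⇒ {x} (u , p) = u , trans (solve 1 (λ x → x ⊜ x ⊖ Κ (ℤ.+ 0)) refl x) p

  Quot : CRing
  Quot = commutativeRing (ops R) _∼_ record
    { isEquivalence = record
      { refl  = ≈⇒∼ refl
      ; sym   = λ { {x} {y} (u , p) → - u , (begin
          y - x       ≈⟨ solve 2 (λ x y → y ⊖ x ⊜ ⊝ (x ⊖ y)) refl x y ⟩
          - (x - y)   ≈⟨ -‿cong p ⟩
          - (w * u)   ≈⟨ solve 2 (λ w u → ⊝ (w ⊗ u) ⊜ w ⊗ ⊝ u) refl w u ⟩
          w * - u     ∎) }
      ; trans = λ { {x} {y} {z} (u , p) (v , r) → u + v , (begin
          x - z               ≈⟨ solve 3 (λ x y z → x ⊖ z ⊜ (x ⊖ y) ⊕ (y ⊖ z)) refl x y z ⟩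
          (x - y) + (y - z)   ≈⟨ +-cong p r ⟩
          w * u + w * v       ≈⟨ distribˡ w u v ⟨
          w * (u + v)         ∎) } }
    ; +-cong = λ { {x} {y} {s} {t} (u , p) (v , r) → u + v , (begin
          (x + s) - (y + t)   ≈⟨ solve 4 (λ x y s t → (x ⊕ s) ⊖ (y ⊕ t) ⊜ (x ⊖ y) ⊕ (s ⊖ t)) refl x y s t ⟩
          (x - y) + (s - t)   ≈⟨ +-cong p r ⟩
          w * u + w * v       ≈⟨ distribˡ w u v ⟨
          w * (u + v)         ∎) }
    ; *-cong = λ { {x} {y} {s} {t} (u , p) (v , r) → u * s + y * v , (begin
          x * s - y * t               ≈⟨ solve 4 (λ x y s t → x ⊗ s ⊖ y ⊗ t ⊜ (x ⊖ y) ⊗ s ⊕ y ⊗ (s ⊖ t)) refl x y s t ⟩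
          (x - y) * s + y * (s - t)   ≈⟨ +-cong (*-congʳ p) (*-congˡ r) ⟩
          (w * u) * s + y * (w * v)   ≈⟨ solve 5 (λ w u s y v → (w ⊗ u) ⊗ s ⊕ y ⊗ (w ⊗ v) ⊜ w ⊗ (u ⊗ s ⊕ y ⊗ v)) refl w u s y v ⟩
          w * (u * s + y * v)         ∎) }
    ; -‿cong = λ { {x} {y} (u , p) → - u , (begin
          (- x) - (- y)   ≈⟨ solve 2 (λ x y → ⊝ x ⊖ ⊝ y ⊜ ⊝ (x ⊖ y)) refl x y ⟩
          - (x - y)       ≈⟨ -‿cong p ⟩
          - (w * u)       ≈⟨ solve 2 (λ w u → ⊝ (w ⊗ u) ⊜ w ⊗ ⊝ u) refl w u ⟩
          w * - u         ∎) }
    ; +-assoc     = λ x y z → ≈⇒∼ (+-assoc x y z)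
    ; +-comm      = λ x y → ≈⇒∼ (+-comm x y)
    ; +-identityˡ = λ x → ≈⇒∼ (+-identityˡ x)
    ; +-inverseˡ  = λ x → ≈⇒∼ (-‿inverseˡ x)
    ; *-assoc     = λ x y z → ≈⇒∼ (*-assoc x y z)
    ; *-comm      = λ x y → ≈⇒∼ (*-comm x y)
    ; *-identityˡ = λ x → ≈⇒∼ (*-identityˡ x)
    ; distribˡ    = λ x y z → ≈⇒∼ (distribˡ x y z)
    }

-- The pair (x , x′) stands for x + x′X in R[X]/(X² − zX).
module Extension (R : CRing) (z : CommutativeRing.Carrier R) where
  open CommutativeRing R
  open RingKit R using (solve; _⊜_; _⊕_; _⊗_; _⊖_; ⊝_; 𝟙; Κ)

  private
    E = Carrier × Carrier

    _≋_ : E → E → Set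
    (x , x′) ≋ (y , y′) = x ≈ y × x′ ≈ y′

    O : Ops E
    O = record
      { _+_ = λ { (x , x′) (y , y′) → x + y , x′ + y′ }
      ; _*_ = λ { (x , x′) (y , y′) → x * y , (x * y′ + x′ * y) + (x′ * y′) * z }
      ; -_  = λ { (x , x′) → - x , - x′ }
      ; 0#  = 0# , 0#
      ; 1#  = 1# , 0# }

  Ext : CRing
  Ext = commutativeRing O _≋_ record
    { isEquivalence = record
      { refl  = refl , refl
      ; sym   = λ { (p , p′) → sym p , sym p′ }
      ; trans = λ { (p , p′) (r , r′) → trans p r , trans p′ r′ } }
    ; +-cong = λ { (p , p′) (r , r′) → +-cong p r , +-cong p′ r′ }
    ; *-cong = λ { (p , p′) (r , r′) → *-cong p r , +-cong (+-cong (*-cong p r′) (*-cong p′ r)) (*-congʳ (*-cong p′ r′)) }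
    ; -‿cong = λ { (p , p′) → -‿cong p , -‿cong p′ }
    ; +-assoc     = λ { (x , x′) (y , y′) (u , u′) → +-assoc x y u , +-assoc x′ y′ u′ }
    ; +-comm      = λ { (x , x′) (y , y′) → +-comm x y , +-comm x′ y′ }
    ; +-identityˡ = λ { (x , x′) → +-identityˡ x , +-identityˡ x′ }
    ; +-inverseˡ  = λ { (x , x′) → -‿inverseˡ x , -‿inverseˡ x′ }
    ; *-assoc     = λ { (x , x′) (y , y′) (u , u′) → *-assoc x y u ,
        solve 7 (λ x x′ y y′ u u′ z →
          ((x ⊗ y) ⊗ u′ ⊕ ((x ⊗ y′ ⊕ x′ ⊗ y) ⊕ (x′ ⊗ y′) ⊗ z) ⊗ u) ⊕ (((x ⊗ y′ ⊕ x′ ⊗ y) ⊕ (x′ ⊗ y′) ⊗ z) ⊗ u′) ⊗ z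
          ⊜ (x ⊗ ((y ⊗ u′ ⊕ y′ ⊗ u) ⊕ (y′ ⊗ u′) ⊗ z) ⊕ x′ ⊗ (y ⊗ u)) ⊕ (x′ ⊗ ((y ⊗ u′ ⊕ y′ ⊗ u) ⊕ (y′ ⊗ u′) ⊗ z)) ⊗ z)
          refl x x′ y y′ u u′ z }
    ; *-comm      = λ { (x , x′) (y , y′) → *-comm x y ,
        solve 5 (λ x x′ y y′ z → (x ⊗ y′ ⊕ x′ ⊗ y) ⊕ (x′ ⊗ y′) ⊗ z ⊜ (y ⊗ x′ ⊕ y′ ⊗ x) ⊕ (y′ ⊗ x′) ⊗ z) refl x x′ y y′ z }
    ; *-identityˡ = λ { (x , x′) → *-identityˡ x ,
        solve 3 (λ x x′ z → (𝟙 ⊗ x′ ⊕ Κ (ℤ.+ 0) ⊗ x) ⊕ (Κ (ℤ.+ 0) ⊗ x′) ⊗ z ⊜ x′) refl x x′ z }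
    ; distribˡ    = λ { (x , x′) (y , y′) (u , u′) → distribˡ x y u ,
        solve 7 (λ x x′ y y′ u u′ z →
          (x ⊗ (y′ ⊕ u′) ⊕ x′ ⊗ (y ⊕ u)) ⊕ (x′ ⊗ (y′ ⊕ u′)) ⊗ z
          ⊜ ((x ⊗ y′ ⊕ x′ ⊗ y) ⊕ (x′ ⊗ y′) ⊗ z) ⊕ ((x ⊗ u′ ⊕ x′ ⊗ u) ⊕ (x′ ⊗ u′) ⊗ z))
          refl x x′ y y′ u u′ z }
    }

  constant : Carrier → E
  constant x = x , 0#

  constant-hom : Hom R Ext
  constant-hom = record
    { ⟦_⟧ = constant
    ; ⟦⟧-cong = λ p → p , refl
    ; +-homo = λ x y → refl , sym (+-identityˡ 0#)
    ; *-homo = λ x y → refl , solve 3 (λ x y z → Κ (ℤ.+ 0) ⊜ (x ⊗ Κ (ℤ.+ 0) ⊕ Κ (ℤ.+ 0) ⊗ y) ⊕ (Κ (ℤ.+ 0) ⊗ Κ (ℤ.+ 0)) ⊗ z) refl x y z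
    ; -‿homo = λ x → refl , solve 0 (Κ (ℤ.+ 0) ⊜ ⊝ Κ (ℤ.+ 0)) refl
    ; 0-homo = refl , refl
    ; 1-homo = refl , refl }

  at-0 : Hom Ext R
  at-0 = record
    { ⟦_⟧ = proj₁ ; ⟦⟧-cong = proj₁
    ; +-homo = λ _ _ → refl ; *-homo = λ _ _ → refl ; -‿homo = λ _ → refl ; 0-homo = refl ; 1-homo = refl }

  at-z : Hom Ext R
  at-z = record
    { ⟦_⟧ = λ { (x , x′) → x + x′ * z }
    ; ⟦⟧-cong = λ { (p , p′) → +-cong p (*-congʳ p′) }
    ; +-homo = λ { (x , x′) (y , y′) → solve 5 (λ x x′ y y′ z → (x ⊕ y) ⊕ (x′ ⊕ y′) ⊗ z ⊜ (x ⊕ x′ ⊗ z) ⊕ (y ⊕ y′ ⊗ z)) refl x x′ y y′ z }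
    ; *-homo = λ { (x , x′) (y , y′) → solve 5 (λ x x′ y y′ z → (x ⊗ y) ⊕ ((x ⊗ y′ ⊕ x′ ⊗ y) ⊕ (x′ ⊗ y′) ⊗ z) ⊗ z ⊜ (x ⊕ x′ ⊗ z) ⊗ (y ⊕ y′ ⊗ z)) refl x x′ y y′ z }
    ; -‿homo = λ { (x , x′) → solve 3 (λ x x′ z → ⊝ x ⊕ ⊝ x′ ⊗ z ⊜ ⊝ (x ⊕ x′ ⊗ z)) refl x x′ z }
    ; 0-homo = solve 1 (λ z → Κ (ℤ.+ 0) ⊕ Κ (ℤ.+ 0) ⊗ z ⊜ Κ (ℤ.+ 0)) refl z
    ; 1-homo = solve 1 (λ z → 𝟙 ⊕ Κ (ℤ.+ 0) ⊗ z ⊜ 𝟙) refl z }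

  indeterminate : E
  indeterminate = 0# , 1#

module _ (R : CRing) where
  open CommutativeRing R

  module Localization (S : Carrier → Set) (S-1 : S 1#) (S-* : ∀ {x y} → S x → S y → S (x * y))
    (S-regular : ∀ {s} → S s → ∀ x y → s * x ≈ s * y → x ≈ y) where
    open RingKit R using (solve; _⊜_; _⊕_; _⊗_; _⊖_; ⊝_; 𝟙; Κ)
    open import Relation.Binary.Reasoning.Setoid setoid

    record Fraction : Set where
      constructor _over_by_
      field
        num : Carrier
        den : Carrier
        den∈S : S den
    open Fraction public

    infix 4 _≃_
    -- Plain cross-multiplication. It is transitive because the elements of S are regular, so the
    -- middle denominator can be cancelled.
    _≃_ : Fraction → Fraction → Set
    x ≃ y = num x * den y ≈ num y * den x

    private
      O : Ops Fraction
      O = record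
        { _+_ = λ x y → (num x * den y + num y * den x) over (den x * den y) by S-* (den∈S x) (den∈S y)
        ; _*_ = λ x y → (num x * num y) over (den x * den y) by S-* (den∈S x) (den∈S y)
        ; -_  = λ x → (- num x) over den x by den∈S x
        ; 0#  = 0# over 1# by S-1
        ; 1#  = 1# over 1# by S-1 }

      ≃-trans : ∀ x y z → x ≃ y → y ≃ z → x ≃ z
      ≃-trans (a over b by _) (c over d by d∈S) (e over f by _) p r = S-regular d∈S (a * f) (e * b) (begin
        d * (a * f)   ≈⟨ solve 3 (λ d a f → d ⊗ (a ⊗ f) ⊜ (a ⊗ d) ⊗ f) refl d a f ⟩
        (a * d) * f   ≈⟨ *-congʳ p ⟩
        (c * b) * f   ≈⟨ solve 3 (λ c b f → (c ⊗ b) ⊗ f ⊜ (c ⊗ f) ⊗ b) refl c b f ⟩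
        (c * f) * b   ≈⟨ *-congʳ r ⟩
        (e * d) * b   ≈⟨ solve 3 (λ e d b → (e ⊗ d) ⊗ b ⊜ d ⊗ (e ⊗ b)) refl e d b ⟩
        d * (e * b)   ∎)

      +-cong′ : ∀ {x y u v} → x ≃ y → u ≃ v → Ops._+_ O x u ≃ Ops._+_ O y v
      +-cong′ {a over b by _} {c over d by _} {e over f by _} {g over h by _} p r = begin
        (a * f + e * b) * (d * h)               ≈⟨ solve 6 (λ a b d e f h → (a ⊗ f ⊕ e ⊗ b) ⊗ (d ⊗ h) ⊜ (a ⊗ d) ⊗ (f ⊗ h) ⊕ (e ⊗ h) ⊗ (b ⊗ d)) refl a b d e f h ⟩
        (a * d) * (f * h) + (e * h) * (b * d)   ≈⟨ +-cong (*-congʳ p) (*-congʳ r) ⟩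
        (c * b) * (f * h) + (g * f) * (b * d)   ≈⟨ solve 6 (λ b c d f g h → (c ⊗ b) ⊗ (f ⊗ h) ⊕ (g ⊗ f) ⊗ (b ⊗ d) ⊜ (c ⊗ h ⊕ g ⊗ d) ⊗ (b ⊗ f)) refl b c d f g h ⟩
        (c * h + g * d) * (b * f)               ∎

      *-cong′ : ∀ {x y u v} → x ≃ y → u ≃ v → Ops._*_ O x u ≃ Ops._*_ O y v
      *-cong′ {a over b by _} {c over d by _} {e over f by _} {g over h by _} p r = begin
        (a * e) * (d * h)   ≈⟨ solve 4 (λ a d e h → (a ⊗ e) ⊗ (d ⊗ h) ⊜ (a ⊗ d) ⊗ (e ⊗ h)) refl a d e h ⟩
        (a * d) * (e * h)   ≈⟨ *-cong p r ⟩
        (c * b) * (g * f)   ≈⟨ solve 4 (λ b c f g → (c ⊗ b) ⊗ (g ⊗ f) ⊜ (c ⊗ g) ⊗ (b ⊗ f)) refl b c f g ⟩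
        (c * g) * (b * f)   ∎

    Loc : CRing
    Loc = commutativeRing O _≃_ record
      { isEquivalence = record { refl = refl ; sym = sym ; trans = λ {x} {y} {z} → ≃-trans x y z }
      ; +-cong = λ {x} {y} {u} {v} → +-cong′ {x} {y} {u} {v}
      ; *-cong = λ {x} {y} {u} {v} → *-cong′ {x} {y} {u} {v}
      ; -‿cong = λ { {a over b by _} {c over d by _} p → trans (solve 2 (λ a d → ⊝ a ⊗ d ⊜ ⊝ (a ⊗ d)) refl a d)
                     (trans (-‿cong p) (solve 2 (λ c b → ⊝ (c ⊗ b) ⊜ ⊝ c ⊗ b) refl c b)) }
      ; +-assoc = λ { (a over b by _) (c over d by _) (e over f by _) →
          solve 6 (λ a b c d e f → ((a ⊗ d ⊕ c ⊗ b) ⊗ f ⊕ e ⊗ (b ⊗ d)) ⊗ (b ⊗ (d ⊗ f)) ⊜ (a ⊗ (d ⊗ f) ⊕ (c ⊗ f ⊕ e ⊗ d) ⊗ b) ⊗ ((b ⊗ d) ⊗ f)) refl a b c d e f }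
      ; +-comm = λ { (a over b by _) (c over d by _) → solve 4 (λ a b c d → (a ⊗ d ⊕ c ⊗ b) ⊗ (d ⊗ b) ⊜ (c ⊗ b ⊕ a ⊗ d) ⊗ (b ⊗ d)) refl a b c d }
      ; +-identityˡ = λ { (a over b by _) → solve 2 (λ a b → (Κ (ℤ.+ 0) ⊗ b ⊕ a ⊗ 𝟙) ⊗ b ⊜ a ⊗ (𝟙 ⊗ b)) refl a b }
      ; +-inverseˡ = λ { (a over b by _) → solve 2 (λ a b → (⊝ a ⊗ b ⊕ a ⊗ b) ⊗ 𝟙 ⊜ Κ (ℤ.+ 0) ⊗ (b ⊗ b)) refl a b }
      ; *-assoc = λ { (a over b by _) (c over d by _) (e over f by _) →
          solve 6 (λ a b c d e f → ((a ⊗ c) ⊗ e) ⊗ (b ⊗ (d ⊗ f)) ⊜ (a ⊗ (c ⊗ e)) ⊗ ((b ⊗ d) ⊗ f)) refl a b c d e f }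
      ; *-comm = λ { (a over b by _) (c over d by _) → solve 4 (λ a b c d → (a ⊗ c) ⊗ (d ⊗ b) ⊜ (c ⊗ a) ⊗ (b ⊗ d)) refl a b c d }
      ; *-identityˡ = λ { (a over b by _) → solve 2 (λ a b → (𝟙 ⊗ a) ⊗ b ⊜ a ⊗ (𝟙 ⊗ b)) refl a b }
      ; distribˡ = λ { (a over b by _) (c over d by _) (e over f by _) →
          solve 6 (λ a b c d e f → (a ⊗ (c ⊗ f ⊕ e ⊗ d)) ⊗ ((b ⊗ d) ⊗ (b ⊗ f)) ⊜ ((a ⊗ c) ⊗ (b ⊗ f) ⊕ (a ⊗ e) ⊗ (b ⊗ d)) ⊗ (b ⊗ (d ⊗ f))) refl a b c d e f }
      }

    embed : Hom R Loc
    embed = record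
      { ⟦_⟧ = λ x → x over 1# by S-1
      ; ⟦⟧-cong = λ p → *-congʳ p
      ; +-homo = λ x y → solve 2 (λ x y → (x ⊕ y) ⊗ (𝟙 ⊗ 𝟙) ⊜ (x ⊗ 𝟙 ⊕ y ⊗ 𝟙) ⊗ 𝟙) refl x y
      ; *-homo = λ x y → solve 2 (λ x y → (x ⊗ y) ⊗ (𝟙 ⊗ 𝟙) ⊜ (x ⊗ y) ⊗ 𝟙) refl x y
      ; -‿homo = λ _ → refl
      ; 0-homo = refl
      ; 1-homo = refl }

    embed-inv : ∀ s (s∈S : S s) → num (CommutativeRing._*_ Loc (s over 1# by S-1) (1# over s by s∈S)) * 1# ≈ 1# * (1# * s)
    embed-inv s _ = solve 1 (λ s → (s ⊗ 𝟙) ⊗ 𝟙 ⊜ 𝟙 ⊗ (𝟙 ⊗ s)) refl s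

-- Antisymmetric sums and the triangular double sum

module _ (R : CRing) where
  open CommutativeRing R

  module Antisymmetric (half : Carrier) (half-inv : (1# + 1#) * half ≈ 1#) where
    open RingKit R
    open import Relation.Binary.Reasoning.Setoid setoid

    self-negative : ∀ {x} → x ≈ - x → x ≈ 0#
    self-negative {x} p = cancel-unit _ _ half-inv (begin
      (1# + 1#) * x     ≈⟨ solve 1 (λ x → (𝟙 ⊕ 𝟙) ⊗ x ⊜ x ⊕ x) refl x ⟩
      x + x             ≈⟨ +-congˡ p ⟩
      x - x             ≈⟨ solve 1 (λ x → x ⊖ x ⊜ (𝟙 ⊕ 𝟙) ⊗ Κ (ℤ.+ 0)) refl x ⟩
      (1# + 1#) * 0#    ∎)

    sum-antisymmetric : ∀ f n → (∀ i j → suc (i ℕ.+ j) ≡ n → f i ≈ - f j) → sum f n ≈ 0#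
    sum-antisymmetric f n h = self-negative (trans (sum-reverse n h) (sym (-‿sum f n)))

    module _ (c : ℕ → Carrier) (m : ℕ) (c-anti : ∀ i j → i ℕ.+ j ≡ m → c i ≈ - c j) where

      sum-vanishes : sum c (suc m) ≈ 0#
      sum-vanishes = sum-antisymmetric c (suc m) λ i j eq → c-anti i j (ℕₚ.suc-injective eq)

      -- The entries after i are the negatives of the first j + 1 entries in reverse order, and the
      -- total is zero.
      partial-sum-symmetric : ∀ i j → suc (i ℕ.+ j) ≡ m → sum c (suc i) ≈ sum c (suc j)
      partial-sum-symmetric i j eq = begin
        sum c (suc i)                          ≈⟨ solve 2 (λ x y → x ⊜ (x ⊖ y) ⊕ y) refl _ _ ⟩
        (sum c (suc i) - sum c (suc j)) + sum c (suc j)   ≈⟨ +-congʳ diff ⟩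
        0# + sum c (suc j)                     ≈⟨ +-identityˡ _ ⟩
        sum c (suc j)                          ∎
        where
        diff : sum c (suc i) - sum c (suc j) ≈ 0#
        diff = begin
          sum c (suc i) - sum c (suc j)                                ≈⟨ +-congˡ (-‿sum c (suc j)) ⟩
          sum c (suc i) + sum (λ l → - c l) (suc j)
            ≈⟨ +-congˡ (sum-reverse (suc j) λ l l′ e → c-anti (suc i ℕ.+ l) l′
                 (≡.trans (≡.cong suc (ℕₚ.+-assoc i l l′)) (≡.trans (≡.cong (λ k → suc (i ℕ.+ k)) (ℕₚ.suc-injective e)) eq))) ⟨
          sum c (suc i) + sum (λ l → c (suc i ℕ.+ l)) (suc j)          ≈⟨ sum-++ c (suc i) (suc j) ⟨
          sum c (suc i ℕ.+ suc j)                                      ≡⟨ ≡.cong (sum c) (≡.cong suc (≡.trans (ℕₚ.+-suc i j) eq)) ⟩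
          sum c (suc m)                                                ≈⟨ sum-vanishes ⟩
          0#                                                           ∎

      -- The reflection of 0, ..., m - 1 negates b and fixes the partial sums of c, so the products
      -- are again antisymmetric.
      tail-vanishes : (b : ℕ → Carrier) → (∀ i j → suc (i ℕ.+ j) ≡ m → b i ≈ - b j) → sum (λ i → b i * sum c (m ∸ i)) m ≈ 0#
      tail-vanishes b b-anti = sum-antisymmetric _ m λ i j eq → begin
        b i * sum c (m ∸ i)        ≡⟨ ≡.cong (λ l → b i * sum c l) (∸-≡ i j eq) ⟩
        b i * sum c (suc j)        ≈⟨ *-cong (b-anti i j eq) (partial-sum-symmetric j i (≡.trans (≡.cong suc (ℕₚ.+-comm j i)) eq)) ⟩
        - b j * sum c (suc i)      ≈⟨ -‿distribˡ-* _ _ ⟨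
        - (b j * sum c (suc i))    ≡⟨ ≡.cong (λ l → - (b j * sum c l)) (∸-≡ j i (≡.trans (≡.cong suc (ℕₚ.+-comm j i)) eq)) ⟨
        - (b j * sum c (m ∸ j))    ∎
        where
        ∸-≡ : ∀ i j → suc (i ℕ.+ j) ≡ m → m ∸ i ≡ suc j
        ∸-≡ i j eq = ≡.trans (≡.cong (_∸ i) (≡.trans (≡.sym eq) (≡.sym (ℕₚ.+-suc i j)))) (ℕₚ.m+n∸m≡n i (suc j))

module ConvolutionSquare (R : CRing) where
  open CommutativeRing R
  open RingKit R
  open import Relation.Binary.Reasoning.Setoid setoid

  -- The triangle j + k ≤ 2m is the square j, k ≤ m together with two mirror-image triangles, in
  -- each of which one index exceeds m.
  △-square : ∀ (c : ℕ → Carrier) m → △ (λ j k → c j * c k) (suc m ℕ.+ m)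
    ≈ sum c (suc m) * sum c (suc m) + (1# + 1#) * sum (λ i → c (suc m ℕ.+ i) * sum c (m ∸ i)) m
  △-square c m = begin
    △ (λ j k → c j * c k) n                           ≈⟨ △-rows _ n ⟩
    sum (λ j → sum (λ k → c j * c k) (n ∸ j)) n       ≈⟨ sum-cong n (λ j _ → sym (*-distribˡ-sum (c j) c (n ∸ j))) ⟩
    sum (λ j → c j * sum c (n ∸ j)) n                 ≈⟨ sum-++ _ (suc m) m ⟩
    sum (λ j → c j * sum c (n ∸ j)) (suc m) + sum (λ i → c (suc m ℕ.+ i) * sum c (n ∸ (suc m ℕ.+ i))) m
      ≈⟨ +-cong head (sum-cong m λ i _ → reflexive (≡.cong (λ l → c (suc m ℕ.+ i) * sum c l) (ℕₚ.[m+n]∸[m+o]≡n∸o (suc m) m i))) ⟩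
    (S * S + T) + T                                   ≈⟨ solve 2 (λ s t → (s ⊕ t) ⊕ t ⊜ s ⊕ (𝟙 ⊕ 𝟙) ⊗ t) refl (S * S) T ⟩
    S * S + (1# + 1#) * T                             ∎
    where
    n = suc m ℕ.+ m
    b : ℕ → Carrier
    b l = c (suc m ℕ.+ l)
    S = sum c (suc m)
    T = sum (λ i → b i * sum c (m ∸ i)) m
    split : ∀ j → j ≤ m → sum c (n ∸ j) ≈ S + sum b (m ∸ j)
    split j j≤m = trans (reflexive (≡.cong (sum c) (ℕₚ.+-∸-assoc (suc m) j≤m))) (sum-++ c (suc m) (m ∸ j))
    head : sum (λ j → c j * sum c (n ∸ j)) (suc m) ≈ S * S + T
    head = begin
      sum (λ j → c j * sum c (n ∸ j)) (suc m)
        ≈⟨ sum-cong (suc m) (λ j j<1+m → trans (*-congˡ (split j (ℕₚ.≤-pred j<1+m))) (distribˡ _ _ _)) ⟩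
      sum (λ j → c j * S + c j * sum b (m ∸ j)) (suc m)        ≈⟨ sum-+ _ _ (suc m) ⟩
      sum (λ j → c j * S) (suc m) + sum (λ j → c j * sum b (m ∸ j)) (suc m)
        ≈⟨ +-cong (sym (*-distribʳ-sum S c (suc m)))
             (trans (+-congˡ (trans (reflexive (≡.cong (λ l → c m * sum b l) (ℕₚ.n∸n≡0 m))) (zeroʳ _))) (+-identityʳ _)) ⟩
      S * S + sum (λ j → c j * sum b (m ∸ j)) m                ≈⟨ +-congˡ (sum-cong m λ j _ → *-distribˡ-sum (c j) b (m ∸ j)) ⟩
      S * S + sum (λ j → sum (λ l → c j * b l) (m ∸ j)) m      ≈⟨ +-congˡ (△-rows (λ j l → c j * b l) m) ⟨
      S * S + △ (λ j l → c j * b l) m                          ≈⟨ +-congˡ (△-flip (λ j l → c j * b l) m) ⟩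
      S * S + △ (λ l j → c j * b l) m                          ≈⟨ +-congˡ (△-rows (λ l j → c j * b l) m) ⟩
      S * S + sum (λ l → sum (λ j → c j * b l) (m ∸ l)) m
        ≈⟨ +-congˡ (sum-cong m λ l _ → trans (sym (*-distribʳ-sum (b l) c (m ∸ l))) (*-comm _ _)) ⟩
      S * S + T ∎

-- The hypothesis says q^n = −1 for n = 2m + 1.
module _ (R : CRing) where
  open CommutativeRing R
  open Ops (ops R) using (_^_)
  module _ (q : Carrier) where
    open Sequences (ops R) q

    module NegativeUnity (m : ℕ) (q^n≈-1 : q * a ^ m ≈ - 1#) where
      open RingKit R hiding (_^_)
      open import Relation.Binary.Reasoning.Setoid setoid

      P^≈ : ∀ k → P ^ k ≈ a ^ k * a ^ k
      P^≈ k = *-^ a a k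

      aP^m≈1 : a * P ^ m ≈ 1#
      aP^m≈1 = begin
        (q * q) * P ^ m                ≈⟨ *-congˡ (P^≈ m) ⟩
        (q * q) * (a ^ m * a ^ m)      ≈⟨ solve 2 (λ q x → (q ⊗ q) ⊗ (x ⊗ x) ⊜ (q ⊗ x) ⊗ (q ⊗ x)) refl _ _ ⟩
        (q * a ^ m) * (q * a ^ m)      ≈⟨ *-cong q^n≈-1 q^n≈-1 ⟩
        - 1# * - 1#                    ≈⟨ solve 0 (⊝ 𝟙 ⊗ ⊝ 𝟙 ⊜ 𝟙) refl ⟩
        1#                             ∎

      qP^m≈ : q * P ^ m ≈ - (a ^ m)
      qP^m≈ = begin
        q * P ^ m              ≈⟨ *-congˡ (P^≈ m) ⟩
        q * (a ^ m * a ^ m)    ≈⟨ solve 2 (λ q x → q ⊗ (x ⊗ x) ⊜ (q ⊗ x) ⊗ x) refl _ _ ⟩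
        (q * a ^ m) * a ^ m    ≈⟨ *-congʳ q^n≈-1 ⟩
        - 1# * a ^ m           ≈⟨ solve 1 (λ x → ⊝ 𝟙 ⊗ x ⊜ ⊝ x) refl _ ⟩
        - (a ^ m)              ∎

      module _ (m′ : ℕ) (m≡ : m ≡ suc m′) where

        -- The exponent is 3m + 1 and P = a², so the value is (aP^m)³.
        tail-aP≈1 : a * P ^ (m′ ℕ.+ (suc m ℕ.+ suc m)) ≈ 1#
        tail-aP≈1 = begin
          a * P ^ (m′ ℕ.+ (suc m ℕ.+ suc m))   ≡⟨ ≡.cong (λ l → a * P ^ l) (≡.trans (shuffle m′ m) (≡.cong (λ l → suc (l ℕ.+ m ℕ.+ m)) (≡.sym m≡))) ⟩
          a * (P ^ (m ℕ.+ m ℕ.+ m) * P)        ≈⟨ *-congˡ (*-congʳ (trans (^-+ P (m ℕ.+ m) m) (*-congʳ (^-+ P m m)))) ⟩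
          a * (((P ^ m * P ^ m) * P ^ m) * (a * a))
            ≈⟨ solve 2 (λ a p → a ⊗ (((p ⊗ p) ⊗ p) ⊗ (a ⊗ a)) ⊜ (a ⊗ p) ⊗ ((a ⊗ p) ⊗ (a ⊗ p))) refl a (P ^ m) ⟩
          (a * P ^ m) * ((a * P ^ m) * (a * P ^ m))   ≈⟨ *-cong aP^m≈1 (*-cong aP^m≈1 aP^m≈1) ⟩
          1# * (1# * 1#)                       ≈⟨ solve 0 (𝟙 ⊗ (𝟙 ⊗ 𝟙) ⊜ 𝟙) refl ⟩
          1#                                   ∎
          where
          shuffle : ∀ m′ m → m′ ℕ.+ (suc m ℕ.+ suc m) ≡ suc (suc m′ ℕ.+ m ℕ.+ m)
          shuffle = solve-∀

        tail-qP≈ : q * P ^ (suc m ℕ.+ m′) ≈ - (a ^ m′)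
        tail-qP≈ = begin
          q * P ^ (suc m ℕ.+ m′)         ≡⟨ ≡.cong (λ l → q * P ^ l) (≡.trans (≡.sym (ℕₚ.+-suc m m′)) (≡.cong (m ℕ.+_) (≡.sym m≡))) ⟩
          q * P ^ (m ℕ.+ m)              ≈⟨ *-congˡ (^-+ P m m) ⟩
          q * (P ^ m * P ^ m)            ≈⟨ *-assoc _ _ _ ⟨
          (q * P ^ m) * P ^ m            ≈⟨ *-congʳ qP^m≈ ⟩
          - (a ^ m) * P ^ m              ≡⟨ ≡.cong (λ l → - (a ^ l) * P ^ m) m≡ ⟩
          - (a ^ m′ * a) * P ^ m         ≈⟨ solve 3 (λ x a p → ⊝ (x ⊗ a) ⊗ p ⊜ ⊝ x ⊗ (a ⊗ p)) refl _ _ _ ⟩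
          - (a ^ m′) * (a * P ^ m)       ≈⟨ *-congˡ aP^m≈1 ⟩
          - (a ^ m′) * 1#                ≈⟨ *-identityʳ _ ⟩
          - (a ^ m′)                     ∎

-- Divisibility of exponents by n, and the local congruence

odd∣2*⇒∣ : ∀ m k → suc (m ℕ.+ m) ∣ k ℕ.* 2 → suc (m ℕ.+ m) ∣ k
-- For n = 2m + 1 one has 2(m + 1) = n + 1, so multiplication by m + 1 inverts 2 modulo n.
odd∣2*⇒∣ m k n∣2k = ∣m+n∣m⇒∣n (≡.subst (suc (m ℕ.+ m) ∣_) (eq m k) (∣m⇒∣m*n (suc m) n∣2k)) (m∣m*n k)
  where
  eq : ∀ m k → k ℕ.* 2 ℕ.* suc m ≡ suc (m ℕ.+ m) ℕ.* k ℕ.+ k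
  eq = solve-∀

between-∤ : ∀ {n k} → n < k → k < n ℕ.+ n → n ∤ k
between-∤ {n} {k} n<k k<2n n∣k = >⇒∤ {{ℕ.>-nonZero (ℕₚ.m<n⇒0<n∸m n<k)}} k∸n<n
  (∣m+n∣m⇒∣n (≡.subst (n ∣_) (≡.sym (ℕₚ.m+[n∸m]≡n (ℕₚ.<⇒≤ n<k))) n∣k) ∣-refl)
  where
  k∸n<n : k ∸ n < n
  k∸n<n = ℕₚ.+-cancelˡ-< n _ _ (≡.subst (_< n ℕ.+ n) (≡.sym (ℕₚ.m+[n∸m]≡n (ℕₚ.<⇒≤ n<k))) k<2n)

module _ (R : CRing) where
  open CommutativeRing R
  open Ops (ops R) using (_^_)
  module Exponents (q : Carrier) where
    open Sequences (ops R) q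
    open RingKit R hiding (_^_)

    a≈ : a ≈ q ^ 2
    a≈ = *-congʳ (sym (*-identityˡ q))

    P^≈q^ : ∀ k → P ^ k ≈ q ^ (k ℕ.* 2 ℕ.* 2)
    P^≈q^ k = trans (^-cong k (solve 1 (λ q → (q ⊗ q) ⊗ (q ⊗ q) ⊜ (𝟙 ⊗ ((𝟙 ⊗ q) ⊗ q)) ⊗ ((𝟙 ⊗ q) ⊗ q)) refl q))
      (trans (sym (^-* (q ^ 2) k 2)) (trans (sym (^-* q (k ℕ.* 2) 2)) refl))

    aP^≈q^ : ∀ k → a * P ^ k ≈ q ^ (suc (k ℕ.* 2) ℕ.* 2)
    aP^≈q^ k = trans (*-cong a≈ (P^≈q^ k)) (sym (^-+ q 2 (k ℕ.* 2 ℕ.* 2)))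

module _ (T : CRing) where
  open CommutativeRing T
  open Ops (ops T) using (_^_)
  module _ (q r half X : Carrier) (v w : ℕ → Carrier) where
    open Sequences (ops T) q

    module VanishingModulo (m : ℕ) (half-inv : (1# + 1#) * half ≈ 1#)
      (v-inv : ∀ i → i < m → (1# - P ^ suc i) * v i ≈ 1#)
      (w-inv : ∀ i → i < m → denX X i * w i ≈ 1#) where
      open RingKit T hiding (_^_)
      open Series r v w X using (c)

      W₁ : Carrier
      W₁ = 1# + q * a ^ m

      open Quotient T W₁ public
      module Q = CommutativeRing Quot

      negative-unity : q * a ^ m Q.≈ - 1#
      negative-unity = 1# , solve 1 (λ y → y ⊖ ⊝ 𝟙 ⊜ (𝟙 ⊕ y) ⊗ 𝟙) refl _

      module N = NegativeUnity Quot q m negative-unity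

      private
        module M = Reflection Quot q r X v w 0 m
          (Q.trans (Q.reflexive (≡.cong (λ l → a * P ^ l) (ℕₚ.+-identityʳ m))) N.aP^m≈1) N.qP^m≈
          (λ i i<m → ≈⇒∼ (v-inv i i<m)) (λ i i<m → ≈⇒∼ (w-inv i i<m))

      c-antisymmetric : ∀ i j → i ℕ.+ j ≡ m → c i Q.≈ - c j
      c-antisymmetric i j eq = Q.trans (≈⇒∼ (solve 3 (λ s r d → (s ⊗ r) ⊗ d ⊜ r ⊗ (s ⊗ d)) refl _ _ _))
        (Q.trans (Q.*-congˡ {r} (M.reflect i j eq))
                 (≈⇒∼ (solve 3 (λ s r d → r ⊗ ⊝ (s ⊗ d) ⊜ ⊝ ((s ⊗ r) ⊗ d)) refl _ _ _)))

      opaque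
        sum-vanishes : Σ[ u ∈ Carrier ] sum c (suc m) ≈ W₁ * u
        sum-vanishes = ∼0⇒ (Antisymmetric.sum-vanishes Quot half (≈⇒∼ half-inv) c m c-antisymmetric)

      module _ {S : CRing} (φ : Hom T S) where
        private module S = CommutativeRing S
        open Hom φ
        module _ (q′ r′ X′ : S.Carrier) (v′ w′ : ℕ → S.Carrier) where
          private module S′ = Sequences (ops S) q′

          module _ (q-homo : ⟦ q ⟧ S.≈ q′) (r-homo : ⟦ r ⟧ S.≈ r′) (X-homo : ⟦ X ⟧ S.≈ X′)
            (v-homo : ∀ i → ⟦ v i ⟧ S.≈ v′ i) (w-homo : ∀ i → ⟦ w i ⟧ S.≈ w′ i) where

            -- The cofactor is the image of one fixed element, so two specialisations of X have
            -- related cofactors. Proving divisibility separately at each value would lose this.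
            image-vanishes : Ops.sum (ops S) (S′.Series.c r′ v′ w′ X′) (suc m)
              S.≈ (S.1# S.+ q′ S.* (Ops._^_ (ops S) S′.a m)) S.* ⟦ proj₁ sum-vanishes ⟧
            image-vanishes = S.trans (S.sym (SeriesHom.sum-c-homo φ q q′ q-homo X-homo r v w r′ v′ w′ r-homo v-homo w-homo (suc m)))
              (S.trans (⟦⟧-cong (proj₂ sum-vanishes)) (S.trans (*-homo _ _) (S.*-congʳ (SeriesHom.1+qa^-homo φ q q′ q-homo m))))

module _ (L : CRing) where
  open CommutativeRing L
  open Ops (ops L) using (_^_)
  module _ (m m′ : ℕ) (m≡ : m ≡ suc m′) where
    private
      n : ℕ
      n = suc (m ℕ.+ m)
    module _ (q q⁻¹ half r : Carrier) where
      open Sequences (ops L) q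

      module LocalCongruence (q-inv : q * q⁻¹ ≈ 1#) (half-inv : (1# + 1#) * half ≈ 1#)
        (r-inv : (1# + q) * r ≈ 1#) (unit : ∀ e → n ∤ e → Σ[ y ∈ Carrier ] (1# - q ^ e) * y ≈ 1#) where
        open RingKit L hiding (_^_)
        open Exponents L q
        open import Relation.Binary.Reasoning.Setoid setoid

        P-unit : ∀ k → n ∤ k → Σ[ y ∈ Carrier ] (1# - P ^ k) * y ≈ 1#
        P-unit k n∤k = proj₁ u , trans (*-congʳ (+-congˡ (-‿cong (P^≈q^ k)))) (proj₂ u)
          where u = unit (k ℕ.* 2 ℕ.* 2) (λ n∣4k → n∤k (odd∣2*⇒∣ m k (odd∣2*⇒∣ m (k ℕ.* 2) n∣4k)))

        aP-unit : ∀ k → n ∤ suc (k ℕ.* 2) → Σ[ y ∈ Carrier ] (1# - a * P ^ k) * y ≈ 1#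
        aP-unit k n∤ = proj₁ u , trans (*-congʳ (+-congˡ (-‿cong (aP^≈q^ k)))) (proj₂ u)
          where u = unit (suc (k ℕ.* 2) ℕ.* 2) (n∤ ∘ odd∣2*⇒∣ m _)

        opaque
          v : ℕ → Carrier
          v i with n ∣? suc i
          -- A placeholder at the multiples of n, where 1 - P^(i+1) is divisible by 1 - q^n; `v-inv`
          -- is stated away from them.
          ... | yes _ = 0#
          ... | no n∤ = proj₁ (P-unit (suc i) n∤)

          v-inv : ∀ i → n ∤ suc i → (1# - P ^ suc i) * v i ≈ 1#
          v-inv i n∤ with n ∣? suc i
          ... | yes n∣ = contradiction n∣ n∤
          ... | no n∤′ = proj₂ (P-unit (suc i) n∤′)

        v-inv-< : ∀ i → suc i < n → (1# - P ^ suc i) * v i ≈ 1#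
        v-inv-< i i<n = v-inv i (>⇒∤ i<n)

        w₀ : ℕ → Carrier
        w₀ i = v i * v i

        w₀-inv : ∀ i → suc i < n → denX 0# i * w₀ i ≈ 1#
        w₀-inv i i<n = begin
          ((1# - p) * (1# - p) - 0# * p) * (v i * v i)   ≈⟨ solve 2 (λ p v → ((𝟙 ⊖ p) ⊗ (𝟙 ⊖ p) ⊖ Κ (ℤ.+ 0) ⊗ p) ⊗ (v ⊗ v) ⊜ ((𝟙 ⊖ p) ⊗ v) ⊗ ((𝟙 ⊖ p) ⊗ v)) refl p (v i) ⟩
          ((1# - p) * v i) * ((1# - p) * v i)            ≈⟨ *-cong (v-inv-< i i<n) (v-inv-< i i<n) ⟩
          1# * 1#                                        ≈⟨ *-identityˡ 1# ⟩
          1#                                             ∎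
          where p = P ^ suc i

        open Series r v w₀ 0# public using () renaming (c to c₀)

        -- In exponents of q these are x = q^(2n), W = 1 - q^(2n) and W₁ = 1 + q^n. At X = z the
        -- factor `numX` vanishes at index m, and this terminates the series.
        x x⁻¹ W W₁ z : Carrier
        x   = a * P ^ m
        x⁻¹ = (q⁻¹ * q⁻¹) * ((q⁻¹ * q⁻¹) * (q⁻¹ * q⁻¹)) ^ m
        W   = 1# - x
        W₁  = 1# + q * a ^ m
        z   = x⁻¹ * (W * W)

        private
          q²-inv : (q * q) * (q⁻¹ * q⁻¹) ≈ 1#
          q²-inv = trans (solve 2 (λ q p → (q ⊗ q) ⊗ (p ⊗ p) ⊜ (q ⊗ p) ⊗ (q ⊗ p)) refl q q⁻¹) (trans (*-cong q-inv q-inv) (*-identityˡ _))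

          P-inv : P * ((q⁻¹ * q⁻¹) * (q⁻¹ * q⁻¹)) ≈ 1#
          P-inv = trans (solve 2 (λ q p → (q ⊗ q) ⊗ (p ⊗ p) ⊜ (q ⊗ p) ⊗ (q ⊗ p)) refl a _) (trans (*-cong q²-inv q²-inv) (*-identityˡ _))

          P^-inv : ∀ k → P ^ k * ((q⁻¹ * q⁻¹) * (q⁻¹ * q⁻¹)) ^ k ≈ 1#
          P^-inv k = trans (sym (*-^ P _ k)) (trans (^-cong k P-inv) (1^ k))

        x-inv : x * x⁻¹ ≈ 1#
        x-inv = trans (solve 4 (λ a p s t → (a ⊗ p) ⊗ (s ⊗ t) ⊜ (a ⊗ s) ⊗ (p ⊗ t)) refl _ _ _ _) (trans (*-cong q²-inv (P^-inv m)) (*-identityˡ _))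

        z-eq : x * z ≈ W * W
        z-eq = trans (sym (*-assoc _ _ _)) (trans (*-congʳ x-inv) (*-identityˡ _))

        open Factorisation L q m z z-eq

        private
          ∤-below : ∀ i → i < m → n ∤ suc ((m ∸ suc i) ℕ.* 2)
          ∤-below i i<m = >⇒∤ (s≤s (≡.subst (suc ((m ∸ suc i) ℕ.* 2) ≤_) (eq m)
            (ℕₚ.*-monoˡ-< 2 (ℕₚ.∸-monoʳ-< {o = 0} (s≤s z≤n) i<m))))
            where
            eq : ∀ m → m ℕ.* 2 ≡ m ℕ.+ m
            eq = solve-∀

          ∤-above : ∀ i → i < m → n ∤ suc (suc (m ℕ.+ i) ℕ.* 2)
          ∤-above i i<m n∣ = >⇒∤ (s≤s (ℕₚ.≤-trans i<m (ℕₚ.m≤m+n m m)))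
            (odd∣2*⇒∣ m (suc i) (∣m+n∣m⇒∣n (≡.subst (n ∣_) (eq m i) n∣) ∣-refl))
            where
            eq : ∀ m i → suc (suc (m ℕ.+ i) ℕ.* 2) ≡ suc (m ℕ.+ m) ℕ.+ suc i ℕ.* 2
            eq = solve-∀

          -- By `x-denX` the element is a unit times two factors 1 - q^(2e), with e = 2(m - i) - 1
          -- and e = n + 2(i + 1). Neither e is a multiple of n.
          denX-unit : ∀ i → i < m → Σ[ y ∈ Carrier ] denX z i * y ≈ 1#
          denX-unit i i<m = x * (- p⁻¹ * (proj₁ u * proj₁ u′)) , (begin
            denX z i * (x * (- p⁻¹ * (proj₁ u * proj₁ u′)))   ≈⟨ solve 3 (λ d x y → d ⊗ (x ⊗ y) ⊜ (x ⊗ d) ⊗ y) refl _ _ _ ⟩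
            (x * denX z i) * (- p⁻¹ * (proj₁ u * proj₁ u′))   ≈⟨ *-congʳ (x-denX i i<m) ⟩
            (- P ^ suc i * (s * s′)) * (- p⁻¹ * (proj₁ u * proj₁ u′))
              ≈⟨ solve 6 (λ p p′ s s′ u u′ → (⊝ p ⊗ (s ⊗ s′)) ⊗ (⊝ p′ ⊗ (u ⊗ u′)) ⊜ (p ⊗ p′) ⊗ ((s ⊗ u) ⊗ (s′ ⊗ u′))) refl _ _ _ _ _ _ ⟩
            (P ^ suc i * p⁻¹) * ((s * proj₁ u) * (s′ * proj₁ u′))   ≈⟨ *-cong (P^-inv (suc i)) (*-cong (proj₂ u) (proj₂ u′)) ⟩
            1# * (1# * 1#)                                    ≈⟨ solve 0 (𝟙 ⊗ (𝟙 ⊗ 𝟙) ⊜ 𝟙) refl ⟩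
            1#                                                ∎)
            where
            p⁻¹ = ((q⁻¹ * q⁻¹) * (q⁻¹ * q⁻¹)) ^ suc i
            s   = 1# - a * P ^ (m ∸ suc i)
            s′  = 1# - a * P ^ suc (m ℕ.+ i)
            u   = aP-unit (m ∸ suc i) (∤-below i i<m)
            u′  = aP-unit (suc (m ℕ.+ i)) (∤-above i i<m)

          opaque
            w̃ : ℕ → Carrier
            w̃ i with i ℕₚ.<? m
            ... | yes i<m = proj₁ (denX-unit i i<m)
            ... | no _    = 0#

            w̃-inv : ∀ i → i < m → denX z i * w̃ i ≈ 1#
            w̃-inv i i<m with i ℕₚ.<? m
            ... | yes i<m′ = proj₂ (denX-unit i i<m′)
            ... | no i≮m   = contradiction i<m i≮m

        open Extension L z using (Ext; constant; constant-hom; at-0; at-z; indeterminate)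

        private
          module T  = CommutativeRing Ext
          module TS = Sequences (ops Ext) (constant q)
          module C  = SeriesHom constant-hom
          open Ops (ops Ext) using () renaming (_^_ to _^T_)

          -- The inverse of s - pX modulo X² - zX, where s = (1 - p)². Its value at 0 is 1/s, and
          -- its slope is (1/(s - zp) - 1/s)/z = p/(s(s - zp)), in which no division by z remains.
          wT : ℕ → T.Carrier
          wT i = w₀ i , (P ^ suc i * w₀ i) * w̃ i

          wT-inv : ∀ i → i < m → TS.denX indeterminate i T.* wT i T.≈ T.1#
          wT-inv i i<m = T.trans (T.*-congʳ (T.trans den≈ den≋)) (first , second)
            where
            i<n = s≤s (ℕₚ.≤-trans i<m (ℕₚ.m≤m+n m m))
            p = P ^ suc i
            cp = constant p
            den≈ : TS.denX indeterminate i T.≈ (T.1# T.- cp) T.* (T.1# T.- cp) T.- indeterminate T.* cp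
            den≈ = T.sym (T.+-cong (T.*-cong 1-p 1-p) (T.-‿cong {indeterminate T.* cp} (T.*-congˡ {indeterminate} cp≈)))
              where
              cp≈ = C.P^-homo q (constant q) T.refl (suc i)
              1-p = T.+-congˡ {T.1#} (T.-‿cong {cp} cp≈)
            den≋ : (T.1# T.- cp) T.* (T.1# T.- cp) T.- indeterminate T.* cp T.≈ ((1# - p) * (1# - p) , - p)
            den≋ = solve 1 (λ p → (𝟙 ⊖ p) ⊗ (𝟙 ⊖ p) ⊖ Κ (ℤ.+ 0) ⊗ p ⊜ (𝟙 ⊖ p) ⊗ (𝟙 ⊖ p)) refl p ,
              solve 2 (λ p z → let o = Κ (ℤ.+ 0) ; s = 𝟙 ⊖ p ; t = o ⊖ o in
                ((s ⊗ t ⊕ t ⊗ s) ⊕ (t ⊗ t) ⊗ z) ⊖ ((o ⊗ o ⊕ 𝟙 ⊗ p) ⊕ (𝟙 ⊗ o) ⊗ z) ⊜ ⊝ p) refl p z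
            first : ((1# - p) * (1# - p)) * w₀ i ≈ 1#
            first = trans (solve 2 (λ s w → s ⊗ w ⊜ (s ⊖ Κ (ℤ.+ 0)) ⊗ w) refl _ _)
                      (trans (*-congʳ (+-congˡ (-‿cong (sym (zeroˡ p))))) (w₀-inv i i<n))
            second : ((1# - p) * (1# - p)) * ((p * w₀ i) * w̃ i) + - p * w₀ i + (- p * ((p * w₀ i) * w̃ i)) * z ≈ 0#
            second = begin
              ((1# - p) * (1# - p)) * ((p * w₀ i) * w̃ i) + - p * w₀ i + (- p * ((p * w₀ i) * w̃ i)) * z
                ≈⟨ solve 4 (λ p w w̃ z → ((𝟙 ⊖ p) ⊗ (𝟙 ⊖ p)) ⊗ ((p ⊗ w) ⊗ w̃) ⊕ ⊝ p ⊗ w ⊕ (⊝ p ⊗ ((p ⊗ w) ⊗ w̃)) ⊗ z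
                     ⊜ (p ⊗ w) ⊗ ((((𝟙 ⊖ p) ⊗ (𝟙 ⊖ p)) ⊖ z ⊗ p) ⊗ w̃) ⊖ p ⊗ w) refl p (w₀ i) (w̃ i) z ⟩
              (p * w₀ i) * (denX z i * w̃ i) - p * w₀ i   ≈⟨ +-congʳ (*-congˡ (w̃-inv i i<m)) ⟩
              (p * w₀ i) * 1# - p * w₀ i                 ≈⟨ solve 1 (λ x → x ⊗ 𝟙 ⊖ x ⊜ Κ (ℤ.+ 0)) refl _ ⟩
              0#                                         ∎

        w-z : ℕ → Carrier
        w-z i = Hom.⟦_⟧ at-z (wT i)

        w-z-inv : ∀ i → i < m → denX z i * w-z i ≈ 1#
        w-z-inv i i<m = begin
          denX z i * w-z i
            ≈⟨ *-congʳ (SeriesHom.denX-homo at-z (constant q) q q-homo X-homo i) ⟨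
          ⟦ TS.denX indeterminate i ⟧ * w-z i                  ≈⟨ *-homo (TS.denX indeterminate i) (wT i) ⟨
          ⟦ TS.denX indeterminate i T.* wT i ⟧                 ≈⟨ ⟦⟧-cong {TS.denX indeterminate i T.* wT i} {T.1#} (wT-inv i i<m) ⟩
          ⟦ T.1# ⟧                                             ≈⟨ 1-homo ⟩
          1#                                                   ∎
          where
          open Hom at-z
          q-homo = solve 2 (λ q z → q ⊕ Κ (ℤ.+ 0) ⊗ z ⊜ q) refl q z
          X-homo = solve 1 (λ z → Κ (ℤ.+ 0) ⊕ 𝟙 ⊗ z ⊜ z) refl z

        open Series r v w-z z public using () renaming (c to c-z)

        private
          <m⇒<n : ∀ {i} → i < m → suc i < n
          <m⇒<n i<m = s≤s (ℕₚ.≤-trans i<m (ℕₚ.m≤m+n m m))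

          module VT = VanishingModulo Ext (constant q) (constant r) (constant half) indeterminate (constant ∘ v) wT m
            (Hom.2-unit-homo constant-hom half-inv)
            (λ i i<m → C.1-P^-unit-homo q (constant q) T.refl (suc i) (v-inv-< i (<m⇒<n i<m)))
            wT-inv

          module V₀ = VanishingModulo L q r half 0# v w₀ m half-inv
            (λ i i<m → v-inv-< i (<m⇒<n i<m)) (λ i i<m → w₀-inv i (<m⇒<n i<m))

        opaque
          -- Both sums are values of the single element W₁(u₀ + u₁X), so they differ by W₁u₁z and
          -- not merely by a multiple of z.
          c₀-sum : Σ[ u ∈ Carrier × Carrier ] sum c₀ (suc m) ≈ W₁ * proj₁ u × sum c-z (suc m) ≈ W₁ * (proj₁ u + proj₂ u * z)
          c₀-sum = proj₁ VT.sum-vanishes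
            , VT.image-vanishes at-0 q r 0# v w₀ refl refl refl (λ _ → refl) (λ _ → refl)
            , VT.image-vanishes at-z q r z v w-z (at-z-constant q) (at-z-constant r) X-homo (at-z-constant ∘ v) (λ _ → refl)
            where
            at-z-constant : ∀ y → y + 0# * z ≈ y
            at-z-constant y = solve 2 (λ y z → y ⊕ Κ (ℤ.+ 0) ⊗ z ⊜ y) refl y z
            X-homo : 0# + 1# * z ≈ z
            X-homo = solve 1 (λ z → Κ (ℤ.+ 0) ⊕ 𝟙 ⊗ z ⊜ z) refl z

        private
          <-tail : ∀ i → i < m′ → suc (suc m ℕ.+ i) < n
          <-tail i i<m′ = s≤s (≡.subst (ℕ._≤ m ℕ.+ m) (≡.trans (ℕₚ.+-suc m (suc i)) (≡.cong suc (ℕₚ.+-suc m i)))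
            (ℕₚ.+-monoʳ-≤ m (≡.subst (suc (suc i) ≤_) (≡.sym m≡) (s≤s i<m′))))

          module Tail = Reflection V₀.Quot q r 0# v w₀ (suc m) m′
            (V₀.N.tail-aP≈1 m′ m≡) (V₀.N.tail-qP≈ m′ m≡)
            (λ i i<m → V₀.≈⇒∼ (v-inv-< (suc m ℕ.+ i) (<-tail i i<m)))
            (λ i i<m → V₀.≈⇒∼ (w₀-inv (suc m ℕ.+ i) (<-tail i i<m)))

          module S₀ = Series r v w₀ 0#

          κ : Carrier
          κ = r * (S₀.d m * - (P ^ suc m * (v m * w₀ m)))

          b : ℕ → Carrier
          b i = κ * ((1# + q * P ^ (suc m ℕ.+ i)) * prod (λ l → S₀.ratio (suc m ℕ.+ l)) i)

          -- Beyond index m the product passes through the ratio at m, whose numerator at X = 0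
          -- contains (1 - aP^m)³ = W³. The constant κ collects what else precedes the tail.
          c₀-tail : ∀ i → c₀ (suc m ℕ.+ i) ≈ ((W * W) * W) * b i
          c₀-tail i = begin
            (s * r) * S₀.d (suc m ℕ.+ i)                 ≈⟨ *-congˡ (prod-++ S₀.ratio (suc m) i) ⟩
            (s * r) * ((S₀.d m * - (P ^ suc m * ((W * (W * W - 0# * (a * P ^ m))) * (v m * w₀ m)))) * t)
              ≈⟨ solve 9 (λ s r d p W y v w t → (s ⊗ r) ⊗ ((d ⊗ ⊝ (p ⊗ ((W ⊗ (W ⊗ W ⊖ Κ (ℤ.+ 0) ⊗ y)) ⊗ (v ⊗ w)))) ⊗ t)
                    ⊜ ((W ⊗ W) ⊗ W) ⊗ ((r ⊗ (d ⊗ ⊝ (p ⊗ (v ⊗ w)))) ⊗ (s ⊗ t))) refl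
                  s r (S₀.d m) (P ^ suc m) W (a * P ^ m) (v m) (w₀ m) t ⟩
            ((W * W) * W) * b i ∎
            where
            s = 1# + q * P ^ (suc m ℕ.+ i)
            t = prod (λ l → S₀.ratio (suc m ℕ.+ l)) i

          b-antisymmetric : ∀ i j → suc (i ℕ.+ j) ≡ m → b i V₀.Q.≈ - b j
          b-antisymmetric i j eq = V₀.Q.trans (V₀.Q.*-congˡ {κ} (Tail.reflect i j (ℕₚ.suc-injective (≡.trans eq m≡))))
            (V₀.≈⇒∼ (solve 2 (λ x y → x ⊗ ⊝ y ⊜ ⊝ (x ⊗ y)) refl _ _))

          opaque
            tail-sum : Σ[ u ∈ Carrier ] sum (λ i → b i * sum c₀ (m ∸ i)) m ≈ W₁ * u
            tail-sum = V₀.∼0⇒ (Antisymmetric.tail-vanishes V₀.Quot half (V₀.≈⇒∼ half-inv) c₀ m V₀.c-antisymmetric b b-antisymmetric)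

        opaque
          square-defect : Σ[ u ∈ Carrier ] △ (λ j k → c₀ j * c₀ k) n ≈ sum c₀ (suc m) * sum c₀ (suc m) + (((W * W) * W) * W₁) * u
          square-defect = (1# + 1#) * proj₁ tail-sum , (begin
            △ (λ j k → c₀ j * c₀ k) n    ≈⟨ ConvolutionSquare.△-square L c₀ m ⟩
            S * S + (1# + 1#) * sum (λ i → c₀ (suc m ℕ.+ i) * sum c₀ (m ∸ i)) m
              ≈⟨ +-congˡ (*-congˡ (trans (sum-cong m (λ i _ → trans (*-congʳ (c₀-tail i)) (*-assoc _ _ _))) (sym (*-distribˡ-sum _ _ m)))) ⟩
            S * S + (1# + 1#) * (((W * W) * W) * sum (λ i → b i * sum c₀ (m ∸ i)) m)
              ≈⟨ +-congˡ (*-congˡ (*-congˡ (proj₂ tail-sum))) ⟩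
            S * S + (1# + 1#) * (((W * W) * W) * (W₁ * proj₁ tail-sum))
              ≈⟨ solve 5 (λ s t w w₁ u → s ⊕ t ⊗ (w ⊗ (w₁ ⊗ u)) ⊜ s ⊕ (w ⊗ w₁) ⊗ (t ⊗ u)) refl (S * S) (1# + 1#) ((W * W) * W) W₁ (proj₁ tail-sum) ⟩
            S * S + (((W * W) * W) * W₁) * ((1# + 1#) * proj₁ tail-sum) ∎)
            where
            S : Carrier
            S = sum c₀ (suc m)

-- Comparison with the right-hand side in the larger ring of fractions

module ImageIdeal {L K : CRing} (ι : Hom L K) where
  open CommutativeRing K
  open RingKit K
  open Hom ι renaming (⟦_⟧ to ⟨_⟩)
  private module L = CommutativeRing L

  -- Membership in the image of the ideal gL. With g = 1 it says that an element of K comes from L,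
  -- that is, that its denominator is harmless modulo the modulus.
  _∈_ : Carrier → L.Carrier → Set
  y ∈ g = Σ[ l ∈ L.Carrier ] y ≈ ⟨ g L.* l ⟩

  ∈-resp : ∀ {g x y} → x ≈ y → x ∈ g → y ∈ g
  ∈-resp p (l , e) = l , trans (sym p) e

  ∈-image : ∀ l → ⟨ l ⟩ ∈ L.1#
  ∈-image l = l , ⟦⟧-cong (L.sym (L.*-identityˡ l))

  ∈-0 : ∀ g → 0# ∈ g
  ∈-0 g = L.0# , sym (trans (⟦⟧-cong (L.zeroʳ g)) 0-homo)

  ∈-+ : ∀ {g x y} → x ∈ g → y ∈ g → (x + y) ∈ g
  ∈-+ (l , p) (l′ , p′) = l L.+ l′ , trans (+-cong p p′) (trans (sym (+-homo _ _)) (⟦⟧-cong (L.sym (L.distribˡ _ _ _))))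

  ∈-* : ∀ {g g′ x y} → x ∈ g → y ∈ g′ → (x * y) ∈ (g L.* g′)
  ∈-* {g} {g′} (l , p) (l′ , p′) = l L.* l′ , trans (*-cong p p′) (trans (sym (*-homo _ _))
    (⟦⟧-cong (solveL 4 (λ g l g′ l′ → (g L⊗ l) L⊗ (g′ L⊗ l′) L⊜ (g L⊗ g′) L⊗ (l L⊗ l′)) L.refl g l g′ l′)))
    where open RingKit L using () renaming (solve to solveL; _⊗_ to _L⊗_; _⊜_ to _L⊜_)

  ∈-*ˡ : ∀ {g x y} → x ∈ L.1# → y ∈ g → (x * y) ∈ g
  ∈-*ˡ {g} p p′ = proj₁ q , trans (proj₂ q) (⟦⟧-cong (L.*-congʳ (L.*-identityˡ g)))
    where q = ∈-* p p′

  ∈-sum : ∀ {g f} n → (∀ i → i < n → f i ∈ g) → sum f n ∈ g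
  ∈-sum zero    h = ∈-0 _
  ∈-sum (suc n) h = ∈-+ (∈-sum n λ i i<n → h i (ℕₚ.m<n⇒m<1+n i<n)) (h n ℕₚ.≤-refl)

  ∈-prod : ∀ {f} n → (∀ i → i < n → f i ∈ L.1#) → prod f n ∈ L.1#
  ∈-prod zero    h = ∈-resp 1-homo (∈-image L.1#)
  ∈-prod (suc n) h = ∈-*ˡ (∈-prod n λ i i<n → h i (ℕₚ.m<n⇒m<1+n i<n)) (h n ℕₚ.≤-refl)

module CompleteSquare (R : CRing) where
  open CommutativeRing R
  open RingKit R

  -- Here S - ρ = W₁z(y - u₁), while S + ρ has its own factor W₁, and z is a multiple of W²; so S² -
  -- ρ² is a multiple of W₁²W². The tail term joins it because W³W₁ = W₁²W²t.
  complete-square : ∀ {D S W W₁} x t u₀ u₁ u y →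
    S ≈ W₁ * u₀ → D ≈ S * S + (((W * W) * W) * W₁) * u → W₁ * t ≈ W →
    let z = x * (W * W)
        ρ = W₁ * (u₀ + u₁ * z) - (W₁ * z) * y in
    D ≈ ρ * ρ + ((W₁ * W₁) * (W * W)) * ((x * (y - u₁)) * ((u₀ + u₀) + (u₁ * z - z * y)) + t * u)
  complete-square {W = W} {W₁} x t u₀ u₁ u y S≈ D≈ W₁t≈W = trans D≈ (trans
    (+-cong (*-cong S≈ S≈) (*-congʳ (*-congʳ (*-congˡ (sym W₁t≈W)))))
    (solve 8 (λ w₁ x W u₀ u₁ y t u → let z = x ⊗ (W ⊗ W) ; ρ = w₁ ⊗ (u₀ ⊕ u₁ ⊗ z) ⊖ (w₁ ⊗ z) ⊗ y in
       (w₁ ⊗ u₀) ⊗ (w₁ ⊗ u₀) ⊕ (((W ⊗ W) ⊗ (w₁ ⊗ t)) ⊗ w₁) ⊗ u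
       ⊜ ρ ⊗ ρ ⊕ ((w₁ ⊗ w₁) ⊗ (W ⊗ W)) ⊗ ((x ⊗ (y ⊖ u₁)) ⊗ ((u₀ ⊕ u₀) ⊕ (u₁ ⊗ z ⊖ z ⊗ y)) ⊕ t ⊗ u))
       refl W₁ x W u₀ u₁ y t u))

module _ (L K : CRing) (ι : Hom L K) where
  private module L = CommutativeRing L
  open CommutativeRing K
  open Ops (ops L) using () renaming (_^_ to _^L_)
  open Ops (ops K) using (_^_)
  module _ (m m′ : ℕ) (m≡ : m ≡ suc m′) where
    private
      n : ℕ
      n = suc (m ℕ.+ m)
    module _ (q q⁻¹ half r : L.Carrier) (q-inv : q L.* q⁻¹ L.≈ L.1#)
      (half-inv : (L.1# L.+ L.1#) L.* half L.≈ L.1#) (r-inv : (L.1# L.+ q) L.* r L.≈ L.1#)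
      (unit : ∀ e → n ∤ e → Σ[ y ∈ L.Carrier ] (L.1# L.- q ^L e) L.* y L.≈ L.1#) where
      private
        Q : Carrier
        Q = Hom.⟦_⟧ ι q

      module Comparison (V : ℕ → Carrier) (V-inv : ∀ e → (1# - Q ^ suc e) * V e ≈ 1#) where
        open RingKit K hiding (_^_)
        open Hom ι renaming (⟦_⟧ to ⟨_⟩)
        open ImageIdeal ι
        open Sequences (ops K) Q
        open Exponents K Q
        open import Relation.Binary.Reasoning.Setoid setoid

        module LC = LocalCongruence L m m′ m≡ q q⁻¹ half r q-inv half-inv r-inv unit
        module SL = Sequences (ops L) q
        module H  = SeriesHom ι

        -- Since `V e` inverts 1 - q^(e+1), the exponents inverted here are 4i + 4, 4i + 2, 4i + 3
        -- and 4i + 5.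
        vK voK v₃ v₅ : ℕ → Carrier
        vK i  = V (suc (suc (suc (i ℕ.* 2 ℕ.* 2))))
        voK i = V (suc (i ℕ.* 2 ℕ.* 2))
        v₃ i  = V (suc (suc (i ℕ.* 2 ℕ.* 2)))
        v₅ i  = V (suc (suc (suc (suc (i ℕ.* 2 ℕ.* 2)))))

        private
          via : ∀ {y} e → y ≈ Q ^ suc e → (1# - y) * V e ≈ 1#
          via e p = trans (*-congʳ (+-congˡ (-‿cong p))) (V-inv e)

          qa≈ : ∀ i → (Q * a) * P ^ i ≈ Q ^ suc (suc (i ℕ.* 2) ℕ.* 2)
          qa≈ i = trans (*-assoc _ _ _) (trans (*-congˡ (aP^≈q^ i)) (*-comm _ _))

          qP≈ : ∀ i → (Q * P) * P ^ i ≈ Q ^ suc (suc i ℕ.* 2 ℕ.* 2)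
          qP≈ i = trans (solve 3 (λ q P x → (q ⊗ P) ⊗ x ⊜ (x ⊗ P) ⊗ q) refl Q P (P ^ i)) (*-congʳ (P^≈q^ (suc i)))

        vK-inv : ∀ i → (1# - P ^ suc i) * vK i ≈ 1#
        vK-inv i = via _ (P^≈q^ (suc i))

        voK-inv : ∀ i → (1# - a * P ^ i) * voK i ≈ 1#
        voK-inv i = via _ (aP^≈q^ i)

        v₃-inv : ∀ i → (1# - (Q * a) * P ^ i) * v₃ i ≈ 1#
        v₃-inv i = via _ (qa≈ i)

        v₅-inv : ∀ i → (1# - (Q * P) * P ^ i) * v₅ i ≈ 1#
        v₅-inv i = via _ (qP≈ i)

        module B = BaileyPair K Q ⟨ q⁻¹ ⟩ vK voK v₃ v₅ (unit-homo q-inv) vK-inv voK-inv v₃-inv v₅-inv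

        qn : Carrier
        qn = ⟨ q L.* SL.a ^L m ⟩

        private
          qn≈ : qn ≈ Q ^ n
          qn≈ = begin
            ⟨ q L.* SL.a ^L m ⟩           ≈⟨ trans (*-homo _ _) (*-congˡ (trans (^-homo _ m) (^-cong m (H.a-homo q Q refl)))) ⟩
            Q * a ^ m                     ≈⟨ *-comm _ _ ⟩
            a ^ m * Q                     ≈⟨ *-congʳ (*-^ Q Q m) ⟩
            (Q ^ m * Q ^ m) * Q           ≈⟨ *-congʳ (^-+ Q m m) ⟨
            Q ^ n                         ∎

          -- Inverses are unique, so for n not dividing e + 1 the inverse in K is the image of the
          -- one in L.
          V∈ : ∀ e → n ∤ suc e → V e ∈ L.1#
          V∈ e n∤ = ∈-resp (cancel-unit _ _ (V-inv e) (begin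
              (1# - Q ^ suc e) * ⟨ proj₁ u ⟩              ≈⟨ *-congʳ (trans (1-‿homo _) (+-congˡ (-‿cong (^-homo q (suc e))))) ⟨
              ⟨ L.1# L.- q ^L suc e ⟩ * ⟨ proj₁ u ⟩        ≈⟨ unit-homo (proj₂ u) ⟩
              1#                                          ≈⟨ V-inv e ⟨
              (1# - Q ^ suc e) * V e                      ∎)) (∈-image (proj₁ u))
            where u = unit (suc e) n∤

          -- Among the odd exponents 3, 5, …, 2j + 1 ≤ 2n − 1 only n itself is divisible by n.
          OddStatus : ℕ → Carrier → Set
          OddStatus j y = (j < m → y ∈ L.1#) × (m ≤ j → ((1# - qn) * y) ∈ L.1#)

          1-qn∈ : (1# - qn) ∈ L.1#
          1-qn∈ = ∈-resp (1-‿homo _) (∈-image (L.1# L.- (q L.* SL.a ^L m)))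

          odd-step : ∀ j {y} → suc j ≤ m ℕ.+ m → OddStatus j y → OddStatus (suc j) (y * V (suc j ℕ.* 2))
          odd-step j {y} j<2m (below , above) = below′ , above′
            where
            double : ∀ k → k ℕ.* 2 ≡ k ℕ.+ k
            double = solve-∀
            below′ : suc j < m → (y * V (suc j ℕ.* 2)) ∈ L.1#
            below′ 1+j<m = ∈-*ˡ (below (ℕₚ.<-trans ℕₚ.≤-refl 1+j<m))
              (V∈ _ (>⇒∤ (s≤s (≡.subst (_≤ m ℕ.+ m) (≡.cong suc (≡.sym (double (suc j)))) (ℕₚ.+-mono-≤-< (ℕₚ.<⇒≤ 1+j<m) 1+j<m)))))
            above′ : m ≤ suc j → ((1# - qn) * (y * V (suc j ℕ.* 2))) ∈ L.1#
            above′ m≤1+j with ℕₚ.≤-<-connex m j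
            -- The new exponent 2j + 3 lies strictly between n and 2n.
            ... | inj₁ m≤j = ∈-resp (*-assoc _ _ _) (∈-*ˡ (above m≤j) (V∈ _ (between-∤
                    (s≤s (≡.subst (m ℕ.+ m <_) (≡.sym (double (suc j))) (ℕₚ.+-mono-<-≤ (s≤s m≤j) m≤1+j)))
                    (≡.subst (_< n ℕ.+ n) (≡.cong suc (≡.sym (double (suc j))))
                      (s≤s (≡.subst (suc j ℕ.+ suc j <_) (≡.sym (ℕₚ.+-suc (m ℕ.+ m) (m ℕ.+ m)))
                        (s≤s (ℕₚ.+-mono-≤ j<2m j<2m))))))))
            -- Now j + 1 = m, so the new exponent is n itself and 1 - q^n cancels its inverse.
            ... | inj₂ j<m = ∈-resp (sym (begin
                    (1# - qn) * (y * V (suc j ℕ.* 2))      ≈⟨ solve 3 (λ s y v → s ⊗ (y ⊗ v) ⊜ y ⊗ (s ⊗ v)) refl _ _ _ ⟩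
                    y * ((1# - qn) * V (suc j ℕ.* 2))      ≈⟨ *-congˡ (via (suc j ℕ.* 2) (trans qn≈ (reflexive (≡.cong (Q ^_) n≡)))) ⟩
                    y * 1#                                 ≈⟨ *-identityʳ y ⟩
                    y                                      ∎)) (below j<m)
              where
              n≡ : n ≡ suc (suc j ℕ.* 2)
              n≡ = ≡.cong suc (≡.trans (≡.cong (λ l → l ℕ.+ l) (ℕₚ.≤-antisym m≤1+j j<m)) (≡.sym (double (suc j))))

          odd-status : ∀ k → k ≤ m → OddStatus (k ℕ.* 2) (B.poch₃₅⁻¹ k)
          odd-status zero    _   = (λ _ → 1∈) , (λ _ → ∈-*ˡ 1-qn∈ 1∈)
            where 1∈ = ∈-resp 1-homo (∈-image L.1#)
          odd-status (suc k) k<m = resp (*-assoc _ _ _)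
            (odd-step (suc (k ℕ.* 2)) (bound (suc k) k<m) (odd-step (k ℕ.* 2) (ℕₚ.<⇒≤ (bound (suc k) k<m)) (odd-status k (ℕₚ.<⇒≤ k<m))))
            where
            bound : ∀ k → k ≤ m → k ℕ.* 2 ≤ m ℕ.+ m
            bound k k≤m = ≡.subst (ℕ._≤ m ℕ.+ m) (≡.sym (double k)) (ℕₚ.+-mono-≤ k≤m k≤m)
              where
              double : ∀ k → k ℕ.* 2 ≡ k ℕ.+ k
              double = solve-∀
            resp : ∀ {j x y} → x ≈ y → OddStatus j x → OddStatus j y
            resp p (b , a) = ∈-resp p ∘ b , ∈-resp (*-congˡ p) ∘ a

          τ∈ : ∀ k → k ≤ m → ((1# - qn) * τ vK v₃ v₅ k) ∈ L.1#
          τ∈ k k≤m = ∈-resp (sym (begin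
              (1# - qn) * τ vK v₃ v₅ k             ≈⟨ *-congˡ (prod-* _ _ k) ⟩
              (1# - qn) * (y * B.poch₃₅⁻¹ k)       ≈⟨ solve 3 (λ s y v → s ⊗ (y ⊗ v) ⊜ y ⊗ (s ⊗ v)) refl _ _ _ ⟩
              y * ((1# - qn) * B.poch₃₅⁻¹ k)       ∎)) (∈-*ˡ y∈ π∈)
            where
            y = prod (λ i → (a * (1# - a * P ^ i)) * vK i) k
            y∈ : y ∈ L.1#
            y∈ = ∈-prod k λ i i<k → ∈-*ˡ
              (∈-resp (trans (*-homo _ _) (*-cong (H.a-homo q Q refl) (H.1-aP^-homo q Q refl i))) (∈-image (SL.a L.* (L.1# L.- SL.a L.* SL.P ^L i))))
              (V∈ _ λ n∣ → >⇒∤ (s≤s (ℕₚ.≤-trans (ℕₚ.≤-trans i<k k≤m) (ℕₚ.m≤m+n m m)))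
                             (odd∣2*⇒∣ m (suc i) (odd∣2*⇒∣ m (suc i ℕ.* 2) n∣)))
            π∈ : ((1# - qn) * B.poch₃₅⁻¹ k) ∈ L.1#
            π∈ with ℕₚ.≤-<-connex m (k ℕ.* 2)
            ... | inj₁ m≤2k = proj₂ (odd-status k k≤m) m≤2k
            ... | inj₂ 2k<m = ∈-*ˡ 1-qn∈ (proj₁ (odd-status k k≤m) 2k<m)

        module _ (br : Carrier) (br-eq : (1# - a) * br ≈ 1# - a * P ^ m) where

          rightSide : Carrier → Carrier
          rightSide X = ε m * (br * sum (λ k → τ vK v₃ v₅ k * prod (numX X) k) (suc m))

          private
            1-a≈ : (1# - a) * voK 0 ≈ 1#
            1-a≈ = trans (*-congʳ (+-congˡ (-‿cong (sym (*-identityʳ a))))) (via _ (aP^≈q^ 0))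

            W₁W : LC.W₁ L.* (L.1# L.- q L.* SL.a ^L m) L.≈ LC.W
            W₁W = L.trans (KL.solve 2 (λ q x → (KL.𝟙 KL.⊕ q KL.⊗ x) KL.⊗ (KL.𝟙 KL.⊖ q KL.⊗ x) KL.⊜ KL.𝟙 KL.⊖ (q KL.⊗ q) KL.⊗ (x KL.⊗ x)) L.refl q (SL.a ^L m))
                    (L.+-congˡ (L.-‿cong (L.*-congˡ (L.sym (KL.*-^ SL.a SL.a m)))))
              where module KL = RingKit L

            -- The bracket [n] in q² equals (1 + q^n)(1 - q^n)/(1 - q²). The factor 1 - q^n removes
            -- the possible simple pole of τ, and W₁ is left over.
            br∈ : ∀ k → k ≤ m → (br * τ vK v₃ v₅ k) ∈ LC.W₁
            br∈ k k≤m = ∈-resp (sym (begin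
                br * τ vK v₃ v₅ k                                   ≈⟨ *-congʳ br≈ ⟩
                (⟨ LC.W₁ ⟩ * ((1# - qn) * voK 0)) * τ vK v₃ v₅ k    ≈⟨ solve 4 (λ w s v t → (w ⊗ (s ⊗ v)) ⊗ t ⊜ (v ⊗ (s ⊗ t)) ⊗ w) refl _ _ _ _ ⟩
                (voK 0 * ((1# - qn) * τ vK v₃ v₅ k)) * ⟨ LC.W₁ ⟩    ∎))
              (∈-*ˡ (∈-*ˡ voK∈ (τ∈ k k≤m)) (L.1# , ⟦⟧-cong (L.sym (L.*-identityʳ LC.W₁))))
              where
              voK∈ : voK 0 ∈ L.1#
              voK∈ = V∈ 1 (λ n∣2 → >⇒∤ (s≤s (≡.subst (λ l → 1 ≤ l ℕ.+ l) (≡.sym m≡) (s≤s z≤n))) (odd∣2*⇒∣ m 1 n∣2))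
              br≈ : br ≈ ⟨ LC.W₁ ⟩ * ((1# - qn) * voK 0)
              br≈ = cancel-unit _ _ 1-a≈ (begin
                (1# - a) * br                                       ≈⟨ br-eq ⟩
                1# - a * P ^ m                                      ≈⟨ H.1-aP^-homo q Q refl m ⟨
                ⟨ LC.W ⟩                                            ≈⟨ ⟦⟧-cong W₁W ⟨
                ⟨ LC.W₁ L.* (L.1# L.- q L.* SL.a ^L m) ⟩            ≈⟨ trans (*-homo _ _) (*-congˡ (1-‿homo _)) ⟩
                ⟨ LC.W₁ ⟩ * (1# - qn)                               ≈⟨ *-identityˡ _ ⟨
                1# * (⟨ LC.W₁ ⟩ * (1# - qn))                        ≈⟨ *-congʳ 1-a≈ ⟨
                ((1# - a) * voK 0) * (⟨ LC.W₁ ⟩ * (1# - qn))        ≈⟨ solve 4 (λ s v w t → (s ⊗ v) ⊗ (w ⊗ t) ⊜ s ⊗ (w ⊗ (t ⊗ v))) refl _ _ _ _ ⟩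
                (1# - a) * (⟨ LC.W₁ ⟩ * ((1# - qn) * voK 0))        ∎)

            numX-diff : ∀ k → (prod (numX ⟨ LC.z ⟩) k - prod (numX 0#) k) ∈ LC.z
            numX-diff zero    = ∈-resp (sym (-‿inverseʳ 1#)) (∈-0 _)
            numX-diff (suc k) = ∈-resp (sym (solve 5 (λ p p₀ s z y → let Z = Κ (ℤ.+ 0) in
                   p ⊗ (s ⊖ z ⊗ y) ⊖ p₀ ⊗ (s ⊖ Z ⊗ y) ⊜ (s ⊖ z ⊗ y) ⊗ (p ⊖ p₀) ⊕ (p₀ ⊗ (⊝ y)) ⊗ z) refl
                   (prod (numX ⟨ LC.z ⟩) k) (prod (numX 0#) k) ((1# - a * P ^ k) * (1# - a * P ^ k)) ⟨ LC.z ⟩ (a * P ^ k)))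
              (∈-+ (∈-*ˡ (∈-resp (H.numX-homo q Q refl refl k) (∈-image (SL.numX LC.z k))) (numX-diff k))
                   (∈-*ˡ (∈-*ˡ (∈-prod k λ i _ → ∈-resp (H.numX-homo q Q refl 0-homo i) (∈-image (SL.numX L.0# i)))
                               (∈-resp (trans (-‿homo _) (-‿cong (H.aP^-homo q Q refl k))) (∈-image (L.- (SL.a L.* SL.P ^L k)))))
                         (L.1# , ⟦⟧-cong (L.sym (L.*-identityʳ LC.z)))))

            opaque
              rightSide-diff : (rightSide ⟨ LC.z ⟩ - rightSide 0#) ∈ (LC.W₁ L.* LC.z)
              rightSide-diff = ∈-resp (sym (begin
                  rightSide ⟨ LC.z ⟩ - rightSide 0#
                    ≈⟨ solve 4 (λ e b s t → e ⊗ (b ⊗ s) ⊖ e ⊗ (b ⊗ t) ⊜ e ⊗ (b ⊗ (s ⊖ t))) refl _ _ _ _ ⟩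
                  ε m * (br * (sum (λ k → τ vK v₃ v₅ k * prod (numX ⟨ LC.z ⟩) k) (suc m) - sum (λ k → τ vK v₃ v₅ k * prod (numX 0#) k) (suc m)))
                    ≈⟨ *-congˡ (*-congˡ (trans (+-congˡ (-‿sum _ (suc m))) (sym (sum-+ _ _ (suc m))))) ⟩
                  ε m * (br * sum (λ k → τ vK v₃ v₅ k * prod (numX ⟨ LC.z ⟩) k - τ vK v₃ v₅ k * prod (numX 0#) k) (suc m))
                    ≈⟨ *-congˡ (trans (*-distribˡ-sum br _ (suc m)) (sum-cong (suc m) λ k _ →
                         solve 4 (λ b t x y → b ⊗ (t ⊗ x ⊖ t ⊗ y) ⊜ (b ⊗ t) ⊗ (x ⊖ y)) refl _ _ _ _)) ⟩
                  ε m * sum (λ k → (br * τ vK v₃ v₅ k) * (prod (numX ⟨ LC.z ⟩) k - prod (numX 0#) k)) (suc m) ∎))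
                (∈-*ˡ (∈-resp (H.ε-homo q Q refl m) (∈-image (SL.ε m)))
                      (∈-sum (suc m) λ k k<1+m → ∈-* (br∈ k (ℕₚ.≤-pred k<1+m)) (numX-diff k)))

            exact-z : ⟨ Ops.sum (ops L) LC.c-z (suc m) ⟩ ≈ rightSide ⟨ LC.z ⟩
            exact-z = cancel-unit _ _ 1-a≈ (begin
              (1# - a) * ⟨ Ops.sum (ops L) LC.c-z (suc m) ⟩
                ≈⟨ *-congˡ (H.sum-c-homo q Q refl refl r LC.v LC.w-z ⟨ r ⟩ (⟨_⟩ ∘ LC.v) (⟨_⟩ ∘ LC.w-z) refl (λ _ → refl) (λ _ → refl) (suc m)) ⟩
              (1# - a) * sum (Series.c ⟨ r ⟩ (⟨_⟩ ∘ LC.v) (⟨_⟩ ∘ LC.w-z) ⟨ LC.z ⟩) (suc m)   ≈⟨ exact ⟩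
              (1# - a * P ^ m) * (ε m * Σt)                ≈⟨ *-congʳ br-eq ⟨
              ((1# - a) * br) * (ε m * Σt)                 ≈⟨ solve 4 (λ s b e t → (s ⊗ b) ⊗ (e ⊗ t) ⊜ s ⊗ (e ⊗ (b ⊗ t))) refl (1# - a) br (ε m) Σt ⟩
              (1# - a) * rightSide ⟨ LC.z ⟩                ∎)
              where
              Σt = sum (λ k → τ vK v₃ v₅ k * prod (numX ⟨ LC.z ⟩) k) (suc m)
              open B.Terminating m ⟨ r ⟩ ⟨ LC.z ⟩ (⟨_⟩ ∘ LC.v) (⟨_⟩ ∘ LC.w-z)
                (trans (*-congʳ (sym (trans (+-homo _ _) (+-congʳ 1-homo)))) (unit-homo r-inv))
                (trans (*-congʳ (sym (H.aP^-homo q Q refl m))) (trans (sym (*-homo _ _)) (trans (⟦⟧-cong LC.z-eq)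
                  (trans (*-homo _ _) (*-cong (H.1-aP^-homo q Q refl m) (H.1-aP^-homo q Q refl m))))))
                (λ i i<m → H.1-P^-unit-homo q Q refl (suc i) (LC.v-inv-< i (s≤s (ℕₚ.≤-trans i<m (ℕₚ.m≤m+n m m)))))
                (λ i i<m → trans (*-congʳ (sym (H.denX-homo q Q refl refl i))) (unit-homo (LC.w-z-inv i i<m)))
                using (exact)

          private
            module KL = RingKit L
            u₀ = proj₁ (proj₁ LC.c₀-sum)
            u₁ = proj₂ (proj₁ LC.c₀-sum)
            y  = proj₁ rightSide-diff
            u  = proj₁ LC.square-defect
            t  = L.1# L.- q L.* SL.a ^L m

          -- The right-hand square root located in L, although its terms live only in K. Watson's
          -- identity places its deformation at z in L, and `rightSide-diff` places the correction
          -- there as well.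
          root : L.Carrier
          root = LC.W₁ L.* (u₀ L.+ u₁ L.* LC.z) L.- (LC.W₁ L.* LC.z) L.* y

          root≈ : ⟨ root ⟩ ≈ rightSide 0#
          root≈ = begin
            ⟨ root ⟩                             ≈⟨ trans (+-homo _ _) (+-cong (⟦⟧-cong (L.sym (proj₂ (proj₂ LC.c₀-sum)))) (-‿homo _)) ⟩
            ⟨ KL.sum LC.c-z (suc m) ⟩ - ⟨ (LC.W₁ L.* LC.z) L.* y ⟩   ≈⟨ +-cong exact-z (-‿cong (sym (proj₂ rightSide-diff))) ⟩
            rightSide ⟨ LC.z ⟩ - (rightSide ⟨ LC.z ⟩ - rightSide 0#)  ≈⟨ solve 2 (λ x y → x ⊖ (x ⊖ y) ⊜ y) refl (rightSide ⟨ LC.z ⟩) (rightSide 0#) ⟩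
            rightSide 0#                      ∎

          defect : L.Carrier
          defect = (LC.x⁻¹ L.* (y L.- u₁)) L.* ((u₀ L.+ u₀) L.+ (u₁ L.* LC.z L.- LC.z L.* y)) L.+ t L.* u

          congruence : KL.△ (λ j k → LC.c₀ j L.* LC.c₀ k) n
            L.≈ root L.* root L.+ ((LC.W₁ L.* LC.W₁) L.* (LC.W L.* LC.W)) L.* defect
          congruence = CompleteSquare.complete-square L {W = LC.W} {LC.W₁} LC.x⁻¹ t u₀ u₁ u y
            (proj₁ (proj₂ LC.c₀-sum)) (proj₂ LC.square-defect) W₁W

-- The ring ℤ[q]

module IntegerPolynomials where
  open import Data.Integer.Base using (+_)
  open ≡ using (refl; sym; trans; cong; cong₂)

  coeff : Poly → ℕ → ℤ
  coeff []      _       = + 0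
  coeff (a ∷ p) zero    = a
  coeff (a ∷ p) (suc i) = coeff p i

  infix 4 _≋_
  -- Equality up to trailing zeros. As a record it determines p and r, unlike a bare function type
  -- on coefficients, so implicit arguments stay solvable.
  record _≋_ (p r : Poly) : Set where
    constructor by-coeff
    field at : ∀ i → coeff p i ≡ coeff r i
  open _≋_

  coeff-+ : ∀ p r i → coeff (p +P r) i ≡ coeff p i ℤ.+ coeff r i
  coeff-+ []      r       i       = sym (ℤₚ.+-identityˡ _)
  coeff-+ (a ∷ p) []      i       = sym (ℤₚ.+-identityʳ _)
  coeff-+ (a ∷ p) (b ∷ r) zero    = refl
  coeff-+ (a ∷ p) (b ∷ r) (suc i) = coeff-+ p r i

  coeff-neg : ∀ p i → coeff (negP p) i ≡ ℤ.- coeff p i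
  coeff-neg []      i       = refl
  coeff-neg (a ∷ p) zero    = refl
  coeff-neg (a ∷ p) (suc i) = coeff-neg p i

  coeff-scale : ∀ c p i → coeff (scaleP c p) i ≡ c ℤ.* coeff p i
  coeff-scale c []      i       = sym (ℤₚ.*-zeroʳ c)
  coeff-scale c (a ∷ p) zero    = refl
  coeff-scale c (a ∷ p) (suc i) = coeff-scale c p i

  coeff-alt : ∀ p i → coeff (altP p) i ≡ sign i ℤ.* coeff p i
  coeff-alt []      i       = sym (ℤₚ.*-zeroʳ (sign i))
  coeff-alt (a ∷ p) zero    = sym (ℤₚ.*-identityˡ a)
  coeff-alt (a ∷ p) (suc i) = trans (coeff-neg (altP p) i)
    (trans (cong ℤ.-_ (coeff-alt p i)) (ℤₚ.neg-distribˡ-* (sign i) (coeff p i)))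

  ≋⇒≈P : ∀ p r → p ≋ r → p ≈P r
  ≋⇒≈P p r eq = zeros (p -P r) λ i → trans (coeff-+ p (negP r) i)
    (trans (cong₂ ℤ._+_ (at eq i) (coeff-neg r i)) (ℤₚ.+-inverseʳ (coeff r i)))
    where
    zeros : ∀ p → (∀ i → coeff p i ≡ + 0) → IsZeroP p
    zeros []      h = []
    zeros (a ∷ p) h = h 0 ∷ zeros p (h ∘ suc)

  private
    ≋-refl : ∀ {p} → p ≋ p
    ≋-refl = by-coeff λ _ → refl

    ≋-sym : ∀ {p r} → p ≋ r → r ≋ p
    ≋-sym e = by-coeff λ i → sym (at e i)

    ≋-trans : ∀ {p r s} → p ≋ r → r ≋ s → p ≋ s
    ≋-trans e f = by-coeff λ i → trans (at e i) (at f i)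

    +-cong : ∀ {p r s t} → p ≋ r → s ≋ t → p +P s ≋ r +P t
    +-cong {p} {r} {s} {t} e f = by-coeff λ i → trans (coeff-+ p s i) (trans (cong₂ ℤ._+_ (at e i) (at f i)) (sym (coeff-+ r t i)))

    ∷-cong : ∀ {a b p r} → a ≡ b → p ≋ r → a ∷ p ≋ b ∷ r
    ∷-cong e f = by-coeff λ { zero → e ; (suc i) → at f i }

    scale-cong : ∀ c {p r} → p ≋ r → scaleP c p ≋ scaleP c r
    scale-cong c {p} {r} e = by-coeff λ i → trans (coeff-scale c p i) (trans (cong (c ℤ.*_) (at e i)) (sym (coeff-scale c r i)))

    +-assoc : ∀ p r s → (p +P r) +P s ≋ p +P (r +P s)
    +-assoc p r s = by-coeff λ i → trans (coeff-+ (p +P r) s i) (trans (cong (ℤ._+ coeff s i) (coeff-+ p r i))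
      (trans (ℤₚ.+-assoc (coeff p i) (coeff r i) (coeff s i)) (sym (trans (coeff-+ p (r +P s) i) (cong (ℤ._+_ (coeff p i)) (coeff-+ r s i))))))

    +-comm : ∀ p r → p +P r ≋ r +P p
    +-comm p r = by-coeff λ i → trans (coeff-+ p r i) (trans (ℤₚ.+-comm (coeff p i) (coeff r i)) (sym (coeff-+ r p i)))

    +-inverseˡ : ∀ p → negP p +P p ≋ []
    +-inverseˡ p = by-coeff λ i → trans (coeff-+ (negP p) p i) (trans (cong (ℤ._+ coeff p i) (coeff-neg p i)) (ℤₚ.+-inverseˡ (coeff p i)))

    +-interchange : ∀ p r s t → (p +P r) +P (s +P t) ≋ (p +P s) +P (r +P t)
    +-interchange p r s t = by-coeff λ i →
      trans (coeff-+ (p +P r) (s +P t) i) (trans (cong₂ ℤ._+_ (coeff-+ p r i) (coeff-+ s t i))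
      (trans (swap (coeff p i) (coeff r i) (coeff s i) (coeff t i))
      (sym (trans (coeff-+ (p +P s) (r +P t) i) (cong₂ ℤ._+_ (coeff-+ p s i) (coeff-+ r t i))))))
      where
      open ℤSolver.+-*-Solver
      swap : ∀ a b c d → (a ℤ.+ b) ℤ.+ (c ℤ.+ d) ≡ (a ℤ.+ c) ℤ.+ (b ℤ.+ d)
      swap = solve 4 (λ a b c d → (a :+ b) :+ (c :+ d) := (a :+ c) :+ (b :+ d)) refl

    scale-+ : ∀ c p r → scaleP c (p +P r) ≋ scaleP c p +P scaleP c r
    scale-+ c p r = by-coeff λ i → trans (coeff-scale c (p +P r) i) (trans (cong (c ℤ.*_) (coeff-+ p r i))
      (trans (ℤₚ.*-distribˡ-+ c (coeff p i) (coeff r i)) (sym (trans (coeff-+ (scaleP c p) (scaleP c r) i) (cong₂ ℤ._+_ (coeff-scale c p i) (coeff-scale c r i))))))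

    scale-scale : ∀ c d p → scaleP c (scaleP d p) ≋ scaleP (c ℤ.* d) p
    scale-scale c d p = by-coeff λ i → trans (coeff-scale c (scaleP d p) i) (trans (cong (c ℤ.*_) (coeff-scale d p i))
      (trans (sym (ℤₚ.*-assoc c d (coeff p i))) (sym (coeff-scale (c ℤ.* d) p i))))

    scale-0 : ∀ p → scaleP (+ 0) p ≋ []
    scale-0 p = by-coeff λ i → trans (coeff-scale (+ 0) p i) (ℤₚ.*-zeroˡ (coeff p i))

    scale-1 : ∀ p → scaleP (+ 1) p ≋ p
    scale-1 p = by-coeff λ i → trans (coeff-scale (+ 1) p i) (ℤₚ.*-identityˡ (coeff p i))

    0∷[] : + 0 ∷ [] ≋ []
    0∷[] = by-coeff λ { zero → refl ; (suc i) → refl }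

    +-identityʳ : ∀ p → p +P [] ≋ p
    +-identityʳ p = +-comm p []

    *-congˡ : ∀ p {r s} → r ≋ s → p *P r ≋ p *P s
    *-congˡ []      e = ≋-refl
    *-congˡ (a ∷ p) e = +-cong (scale-cong a e) (∷-cong refl (*-congˡ p e))

    *-zeroʳ : ∀ p → p *P [] ≋ []
    *-zeroʳ []      = ≋-refl
    *-zeroʳ (a ∷ p) = ≋-trans (∷-cong refl (*-zeroʳ p)) 0∷[]

    *-∷ : ∀ p b r → p *P (b ∷ r) ≋ scaleP b p +P (+ 0 ∷ (p *P r))
    *-∷ []      b r = ≋-sym 0∷[]
    *-∷ (a ∷ p) b r = ∷-cong (cong (ℤ._+ + 0) (ℤₚ.*-comm a b))
      (≋-trans (+-cong (≋-refl {scaleP a r}) (*-∷ p b r))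
      (≋-trans (≋-sym (+-assoc (scaleP a r) (scaleP b p) _))
      (≋-trans (+-cong (+-comm (scaleP a r) (scaleP b p)) ≋-refl) (+-assoc (scaleP b p) (scaleP a r) _))))

    *-comm : ∀ p r → p *P r ≋ r *P p
    *-comm []      r = ≋-sym (*-zeroʳ r)
    *-comm (a ∷ p) r = ≋-trans (+-cong (≋-refl {scaleP a r}) (∷-cong refl (*-comm p r))) (≋-sym (*-∷ r a p))

    *-cong : ∀ {p r s t} → p ≋ r → s ≋ t → p *P s ≋ r *P t
    *-cong {p} {r} {s} {t} e f = ≋-trans (*-congˡ p f) (≋-trans (*-comm p t) (≋-trans (*-congˡ t e) (*-comm t r)))

    distribˡ : ∀ p r s → p *P (r +P s) ≋ p *P r +P p *P s
    distribˡ []      r s = ≋-refl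
    distribˡ (a ∷ p) r s = ≋-trans (+-cong (scale-+ a r s) (∷-cong refl (distribˡ p r s)))
      (+-interchange (scaleP a r) (scaleP a s) (+ 0 ∷ (p *P r)) (+ 0 ∷ (p *P s)))

    scale-* : ∀ c p r → scaleP c (p *P r) ≋ scaleP c p *P r
    scale-* c []      r = ≋-refl
    scale-* c (a ∷ p) r = ≋-trans (scale-+ c (scaleP a r) _)
      (+-cong (scale-scale c a r) (∷-cong (ℤₚ.*-zeroʳ c) (scale-* c p r)))

    *-assoc : ∀ p r s → (p *P r) *P s ≋ p *P (r *P s)
    *-assoc []      r s = ≋-refl
    *-assoc (a ∷ p) r s = ≋-trans (*-comm (scaleP a r +P (+ 0 ∷ (p *P r))) s) (≋-trans (distribˡ s (scaleP a r) _)
      (+-cong (≋-trans (*-comm s (scaleP a r)) (≋-sym (scale-* a r s)))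
              (≋-trans (*-comm s (+ 0 ∷ (p *P r))) (≋-trans (+-cong (scale-0 s) ≋-refl) (∷-cong refl (*-assoc p r s))))))

    *-identityˡ : ∀ p → oneP *P p ≋ p
    *-identityˡ p = ≋-trans (+-cong (scale-1 p) 0∷[]) (+-identityʳ p)

    polyOps : Ops Poly
    polyOps = record { _+_ = _+P_ ; _*_ = _*P_ ; -_ = negP ; 0# = [] ; 1# = oneP }

    neg-cong : ∀ {p r} → p ≋ r → negP p ≋ negP r
    neg-cong {p} {r} e = by-coeff λ i → trans (coeff-neg p i) (trans (cong ℤ.-_ (at e i)) (sym (coeff-neg r i)))

  ℤ[q] : CRing
  ℤ[q] = commutativeRing polyOps _≋_ record
    { isEquivalence = record { refl = ≋-refl ; sym = ≋-sym ; trans = ≋-trans }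
    ; +-cong = +-cong ; *-cong = *-cong ; -‿cong = neg-cong
    ; +-assoc = +-assoc ; +-comm = +-comm ; +-identityˡ = λ p → ≋-refl ; +-inverseˡ = +-inverseˡ
    ; *-assoc = *-assoc ; *-comm = *-comm ; *-identityˡ = *-identityˡ ; distribˡ = distribˡ
    }

  scale≋ : ∀ c p → scaleP c p ≋ constP c *P p
  scale≋ c p = ≋-sym (≋-trans (+-cong (≋-refl {scaleP c p}) 0∷[]) (+-identityʳ _))

  const-* : ∀ c d → constP (c ℤ.* d) ≋ constP c *P constP d
  const-* c d = ∷-cong (sym (ℤₚ.+-identityʳ _)) ≋-refl

  q : Poly
  q = qpow 1

  q-* : ∀ p → q *P p ≋ + 0 ∷ p
  q-* p = ≋-trans (+-cong (scale-0 p) ≋-refl) (∷-cong refl (*-identityˡ p))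

  open Ops (ops ℤ[q]) using (_^_)

  qpow≋ : ∀ k → qpow k ≋ q ^ k
  qpow≋ zero    = ≋-refl
  qpow≋ (suc k) = ≋-trans (≋-sym (q-* (qpow k))) (≋-trans (*-comm q (qpow k)) (*-cong (qpow≋ k) ≋-refl))

  Regular : Poly → Set
  Regular p = ∀ x y → p *P x ≋ p *P y → x ≋ y

  regular-* : ∀ {p r} → Regular p → Regular r → Regular (p *P r)
  regular-* {p} {r} hp hr x y e = hr x y (hp _ _ (≋-trans (≋-sym (*-assoc p r x)) (≋-trans e (*-assoc p r y))))

  annihilator⇒regular : ∀ p → (∀ d → p *P d ≋ [] → d ≋ []) → Regular p
  annihilator⇒regular p h x y e =
    ≋-trans (≋-sym (+-identityʳ x)) (≋-trans (+-cong (≋-refl {x}) (≋-sym (+-inverseˡ y)))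
      (≋-trans (≋-sym (+-assoc x (negP y) y)) (+-cong (h (x -P y) diff) ≋-refl)))
    where
    open RingKit ℤ[q] using (solve; _⊜_; _⊕_; _⊗_; _⊖_; ⊝_; Κ)
    diff : p *P (x -P y) ≋ []
    diff = ≋-trans (solve 3 (λ p x y → p ⊗ (x ⊖ y) ⊜ p ⊗ x ⊖ p ⊗ y) ≋-refl p x y)
           (≋-trans (+-cong e ≋-refl) (≋-trans (+-comm (p *P y) _) (+-inverseˡ (p *P y))))

  coeff₀≢0⇒regular : ∀ p → ¬ (coeff p 0 ≡ + 0) → Regular p
  coeff₀≢0⇒regular p p₀≢0 = annihilator⇒regular p go
    where
    go : ∀ d → p *P d ≋ [] → d ≋ []
    go []      e = ≋-refl
    go (b ∷ d) e = ≋-trans (∷-cong b≡0 (go d tail≋)) 0∷[]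
      where
      e′ : scaleP b p +P (+ 0 ∷ (p *P d)) ≋ []
      e′ = ≋-trans (≋-sym (*-∷ p b d)) e
      b*p₀ : b ℤ.* coeff p 0 ≡ + 0
      b*p₀ = trans (sym (coeff-scale b p 0)) (trans (sym (ℤₚ.+-identityʳ _)) (trans (sym (coeff-+ (scaleP b p) (+ 0 ∷ (p *P d)) 0)) (at e′ 0)))
      b≡0 : b ≡ + 0
      b≡0 with ℤₚ.i*j≡0⇒i≡0∨j≡0 b b*p₀
      ... | inj₁ b≡0  = b≡0
      ... | inj₂ p₀≡0 = contradiction p₀≡0 p₀≢0
      tail≋ : p *P d ≋ []
      tail≋ = by-coeff λ i → trans (sym (at (+-cong (≋-trans (subst-scale b≡0) (scale-0 p)) ≋-refl) (suc i))) (at e′ (suc i))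
        where
        subst-scale : ∀ {c} → b ≡ c → scaleP b p ≋ scaleP c p
        subst-scale refl = ≋-refl

  q-regular : Regular q
  q-regular x y e = by-coeff λ i → at (≋-trans (≋-sym (q-* x)) (≋-trans e (q-* y))) (suc i)

  alt : Hom ℤ[q] ℤ[q]
  alt = record
    { ⟦_⟧ = altP
    ; ⟦⟧-cong = λ {p} {r} e → by-coeff λ i → trans (coeff-alt p i) (trans (cong (sign i ℤ.*_) (at e i)) (sym (coeff-alt r i)))
    ; +-homo = alt-+
    ; *-homo = alt-*
    ; -‿homo = λ p → by-coeff λ i → trans (coeff-alt (negP p) i) (trans (cong (sign i ℤ.*_) (coeff-neg p i))
        (trans (sym (ℤₚ.neg-distribʳ-* (sign i) (coeff p i))) (sym (trans (coeff-neg (altP p) i) (cong ℤ.-_ (coeff-alt p i))))))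
    ; 0-homo = ≋-refl
    ; 1-homo = ≋-refl
    }
    where
    alt-+ : ∀ p r → altP (p +P r) ≋ altP p +P altP r
    alt-+ p r = by-coeff λ i → trans (coeff-alt (p +P r) i) (trans (cong (sign i ℤ.*_) (coeff-+ p r i))
      (trans (ℤₚ.*-distribˡ-+ (sign i) (coeff p i) (coeff r i))
      (sym (trans (coeff-+ (altP p) (altP r) i) (cong₂ ℤ._+_ (coeff-alt p i) (coeff-alt r i))))))
    alt-scale : ∀ c p → altP (scaleP c p) ≋ scaleP c (altP p)
    alt-scale c p = by-coeff λ i → trans (coeff-alt (scaleP c p) i) (trans (cong (sign i ℤ.*_) (coeff-scale c p i))
      (trans (swap (sign i) c (coeff p i)) (sym (trans (coeff-scale c (altP p) i) (cong (c ℤ.*_) (coeff-alt p i))))))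
      where
      open ℤSolver.+-*-Solver
      swap : ∀ a b c → a ℤ.* (b ℤ.* c) ≡ b ℤ.* (a ℤ.* c)
      swap = solve 3 (λ a b c → a :* (b :* c) := b :* (a :* c)) refl
    alt-* : ∀ p r → altP (p *P r) ≋ altP p *P altP r
    alt-* []      r = ≋-refl
    alt-* (a ∷ p) r = ≋-trans (alt-+ (scaleP a r) (+ 0 ∷ (p *P r)))
      (+-cong (alt-scale a r) (∷-cong refl (≋-trans (neg-cong (alt-* p r))
        (solve 2 (λ x y → ⊝ (x ⊗ y) ⊜ ⊝ x ⊗ y) ≋-refl (altP p) (altP r)))))
      where open RingKit ℤ[q] using (solve; _⊜_; _⊗_; ⊝_)

open IntegerPolynomials

-- Cyclotomic polynomials up to rational constants

module _ (R : CRing) where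
  open CommutativeRing R
  open Ops (ops R) using (_^_)

  module RationalDivisibility (q : Carrier) (const : ℤ → Carrier) (const-0 : const (ℤ.+ 0) ≈ 0#)
    (const-1 : const (ℤ.+ 1) ≈ 1#) (const-suc : ∀ k → const (ℤ.+ k) + 1# ≈ const (ℤ.+ suc k))
    (const-* : ∀ c d → const (c ℤ.* d) ≈ const c * const d)
    (X-regular : ∀ e x y → (q ^ suc e - 1#) * x ≈ (q ^ suc e - 1#) * y → x ≈ y) where
    open RingKit R hiding (_^_)
    X : ℕ → Carrier
    X k = q ^ k - 1#

    NonZeroConst : Set
    NonZeroConst = Σ[ c ∈ ℤ ] c ≢ ℤ.+ 0

    ⟪_⟫ : NonZeroConst → Carrier
    ⟪ c , _ ⟫ = const c

    _·_ : NonZeroConst → NonZeroConst → NonZeroConst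
    (c , c≢0) · (d , d≢0) = c ℤ.* d , [ c≢0 , d≢0 ]′ ∘ ℤₚ.i*j≡0⇒i≡0∨j≡0 c

    ·-hom : ∀ c d → ⟪ c · d ⟫ ≈ ⟪ c ⟫ * ⟪ d ⟫
    ·-hom (c , _) (d , _) = const-* c d

    one : NonZeroConst
    one = ℤ.+ 1 , λ ()

    -- Divisibility and coprimality over ℚ, with integer constants as denominators.
    infix 4 _∣ℚ_
    _∣ℚ_ : Carrier → Carrier → Set
    f ∣ℚ g = Σ[ u ∈ Carrier ] Σ[ c ∈ NonZeroConst ] f * u ≈ ⟪ c ⟫ * g

    Cop : Carrier → Carrier → Set
    Cop f g = Σ[ s ∈ Carrier ] Σ[ t ∈ Carrier ] Σ[ c ∈ NonZeroConst ] s * f + t * g ≈ ⟪ c ⟫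

    open import Relation.Binary.Reasoning.Setoid setoid

    cop-sym : ∀ {f g} → Cop f g → Cop g f
    cop-sym (s , t , c , e) = t , s , c , trans (solve 2 (λ x y → x ⊕ y ⊜ y ⊕ x) refl _ _) e

    cop-* : ∀ {f f′ g} → Cop f g → Cop f′ g → Cop (f * f′) g
    cop-* {f} {f′} {g} (s , t , c , e) (s′ , t′ , c′ , e′) =
      s * s′ , (s * f) * t′ + t * (s′ * f′ + t′ * g) , c · c′ , (begin
        (s * s′) * (f * f′) + ((s * f) * t′ + t * (s′ * f′ + t′ * g)) * g
          ≈⟨ solve 7 (λ s s′ f f′ t t′ g → (s ⊗ s′) ⊗ (f ⊗ f′) ⊕ ((s ⊗ f) ⊗ t′ ⊕ t ⊗ (s′ ⊗ f′ ⊕ t′ ⊗ g)) ⊗ g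
               ⊜ (s ⊗ f ⊕ t ⊗ g) ⊗ (s′ ⊗ f′ ⊕ t′ ⊗ g)) refl s s′ f f′ t t′ g ⟩
        (s * f + t * g) * (s′ * f′ + t′ * g)   ≈⟨ *-cong e e′ ⟩
        ⟪ c ⟫ * ⟪ c′ ⟫                         ≈⟨ ·-hom c c′ ⟨
        ⟪ c · c′ ⟫                             ∎)

    cop-1 : ∀ g → Cop 1# g
    cop-1 g = 1# , 0# , one , trans (solve 1 (λ g → 𝟙 ⊗ 𝟙 ⊕ Κ (ℤ.+ 0) ⊗ g ⊜ 𝟙) refl g) (sym const-1)

    cop-resp : ∀ {f f′ g} → f ≈ f′ → Cop f g → Cop f′ g
    cop-resp p (s , t , c , e) = s , t , c , trans (+-congʳ (*-congˡ (sym p))) e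

    cop-divisor : ∀ {f f′ g} → f ∣ℚ f′ → Cop f′ g → Cop f g
    cop-divisor {f} {f′} {g} (u , c , e) (s , t , d , e′) = s * u , ⟪ c ⟫ * t , c · d , (begin
      (s * u) * f + (⟪ c ⟫ * t) * g     ≈⟨ solve 6 (λ s u f c t g → (s ⊗ u) ⊗ f ⊕ (c ⊗ t) ⊗ g ⊜ s ⊗ (f ⊗ u) ⊕ c ⊗ (t ⊗ g)) refl s u f ⟪ c ⟫ t g ⟩
      s * (f * u) + ⟪ c ⟫ * (t * g)     ≈⟨ +-congʳ (*-congˡ e) ⟩
      s * (⟪ c ⟫ * f′) + ⟪ c ⟫ * (t * g) ≈⟨ solve 4 (λ s c f tg → s ⊗ (c ⊗ f) ⊕ c ⊗ tg ⊜ c ⊗ (s ⊗ f ⊕ tg)) refl s ⟪ c ⟫ f′ (t * g) ⟩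
      ⟪ c ⟫ * (s * f′ + t * g)          ≈⟨ *-congˡ e′ ⟩
      ⟪ c ⟫ * ⟪ d ⟫                     ≈⟨ ·-hom c d ⟨
      ⟪ c · d ⟫                         ∎)

    ∣ℚ-trans : ∀ {f g h} → f ∣ℚ g → g ∣ℚ h → f ∣ℚ h
    ∣ℚ-trans {f} {g} {h} (u , c , e) (v , d , e′) = u * v , c · d , (begin
      f * (u * v)            ≈⟨ *-assoc f u v ⟨
      (f * u) * v            ≈⟨ *-congʳ e ⟩
      (⟪ c ⟫ * g) * v        ≈⟨ *-assoc _ _ _ ⟩
      ⟪ c ⟫ * (g * v)        ≈⟨ *-congˡ e′ ⟩
      ⟪ c ⟫ * (⟪ d ⟫ * h)    ≈⟨ *-assoc _ _ _ ⟨
      (⟪ c ⟫ * ⟪ d ⟫) * h    ≈⟨ *-congʳ (·-hom c d) ⟨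
      ⟪ c · d ⟫ * h          ∎)

    ∣⇒∣ℚ : ∀ {f g} u → f * u ≈ g → f ∣ℚ g
    ∣⇒∣ℚ u e = u , one , trans e (sym (trans (*-congʳ const-1) (*-identityˡ _)))

    cop-product : ∀ {f g x} → Cop f g → f ∣ℚ x → g ∣ℚ x → (f * g) ∣ℚ x
    cop-product {f} {g} {x} (s , t , k , e) (u , c , eu) (v , d , ev) =
      (s * (⟪ c ⟫ * v) + t * (⟪ d ⟫ * u)) , (k · (c · d)) , (begin
        (f * g) * (s * (⟪ c ⟫ * v) + t * (⟪ d ⟫ * u))
          ≈⟨ solve 8 (λ f g s t c d u v → (f ⊗ g) ⊗ (s ⊗ (c ⊗ v) ⊕ t ⊗ (d ⊗ u)) ⊜ (s ⊗ f) ⊗ (c ⊗ (g ⊗ v)) ⊕ (t ⊗ g) ⊗ (d ⊗ (f ⊗ u)))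
               refl f g s t ⟪ c ⟫ ⟪ d ⟫ u v ⟩
        (s * f) * (⟪ c ⟫ * (g * v)) + (t * g) * (⟪ d ⟫ * (f * u))   ≈⟨ +-cong (*-congˡ (*-congˡ ev)) (*-congˡ (*-congˡ eu)) ⟩
        (s * f) * (⟪ c ⟫ * (⟪ d ⟫ * x)) + (t * g) * (⟪ d ⟫ * (⟪ c ⟫ * x))
          ≈⟨ solve 5 (λ y z c d x → y ⊗ (c ⊗ (d ⊗ x)) ⊕ z ⊗ (d ⊗ (c ⊗ x)) ⊜ ((y ⊕ z) ⊗ (c ⊗ d)) ⊗ x) refl (s * f) (t * g) ⟪ c ⟫ ⟪ d ⟫ x ⟩
        ((s * f + t * g) * (⟪ c ⟫ * ⟪ d ⟫)) * x       ≈⟨ *-congʳ (*-cong e (sym (·-hom c d))) ⟩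
        (⟪ k ⟫ * ⟪ c · d ⟫) * x                       ≈⟨ *-congʳ (·-hom k (c · d)) ⟨
        ⟪ k · (c · d) ⟫ * x                           ∎)

    geometric : Carrier → ℕ → Carrier
    geometric G = sum (λ i → G ^ i)

    geometric-sum : ∀ G k → (G - 1#) * geometric G k ≈ G ^ k - 1#
    geometric-sum G zero    = solve 1 (λ g → (g ⊖ 𝟙) ⊗ Κ (ℤ.+ 0) ⊜ 𝟙 ⊖ 𝟙) refl G
    geometric-sum G (suc k) = begin
      (G - 1#) * (geometric G k + G ^ k)              ≈⟨ solve 3 (λ G s p → (G ⊖ 𝟙) ⊗ (s ⊕ p) ⊜ (G ⊖ 𝟙) ⊗ s ⊕ (G ⊖ 𝟙) ⊗ p) refl G (geometric G k) (G ^ k) ⟩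
      (G - 1#) * geometric G k + (G - 1#) * G ^ k     ≈⟨ +-congʳ (geometric-sum G k) ⟩
      (G ^ k - 1#) + (G - 1#) * G ^ k                 ≈⟨ solve 2 (λ G p → (p ⊖ 𝟙) ⊕ (G ⊖ 𝟙) ⊗ p ⊜ p ⊗ G ⊖ 𝟙) refl G (G ^ k) ⟩
      G ^ k * G - 1#                                  ∎

    geometric-mod : ∀ G k → Σ[ z ∈ Carrier ] geometric G k ≈ const (ℤ.+ k) + (G - 1#) * z
    geometric-mod G zero    = 0# , trans (solve 1 (λ g → Κ (ℤ.+ 0) ⊜ Κ (ℤ.+ 0) ⊕ (g ⊖ 𝟙) ⊗ Κ (ℤ.+ 0)) refl G) (+-congʳ (sym const-0))
    geometric-mod G (suc k) = z + geometric G k , (begin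
      geometric G k + G ^ k                                    ≈⟨ +-cong e (solve 1 (λ p → p ⊜ (p ⊖ 𝟙) ⊕ 𝟙) refl (G ^ k)) ⟩
      (const (ℤ.+ k) + (G - 1#) * z) + ((G ^ k - 1#) + 1#)    ≈⟨ +-congˡ (+-congʳ (geometric-sum G k)) ⟨
      (const (ℤ.+ k) + (G - 1#) * z) + ((G - 1#) * geometric G k + 1#)
        ≈⟨ solve 4 (λ c g z s → (c ⊕ g ⊗ z) ⊕ (g ⊗ s ⊕ 𝟙) ⊜ (c ⊕ 𝟙) ⊕ g ⊗ (z ⊕ s)) refl (const (ℤ.+ k)) (G - 1#) z (geometric G k) ⟩
      (const (ℤ.+ k) + 1#) + (G - 1#) * (z + geometric G k)   ≈⟨ +-congʳ (const-suc k) ⟩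
      const (ℤ.+ suc k) + (G - 1#) * (z + geometric G k)      ∎)
      where
      z = proj₁ (geometric-mod G k)
      e = proj₂ (geometric-mod G k)

    X-multiple : ∀ e k → X e * geometric (q ^ e) k ≈ X (k ℕ.* e)
    X-multiple e k = trans (geometric-sum (q ^ e) k) (+-congʳ (sym (^-* q k e)))

    X-∣ : ∀ {d n} → d ∣ n → X d ∣ℚ X n
    X-∣ {d} (divides k ≡.refl) = ∣⇒∣ℚ (geometric (q ^ d) k) (X-multiple d k)

    X-+ : ∀ g k → X (g ℕ.+ k) - q ^ g * X k ≈ X g
    X-+ g k = trans (+-congʳ (+-congʳ (^-+ q g k))) (solve 2 (λ g k → (g ⊗ k ⊖ 𝟙) ⊖ g ⊗ (k ⊖ 𝟙) ⊜ g ⊖ 𝟙) refl (q ^ g) (q ^ k))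

    X-bézout : ∀ e n → Σ[ α ∈ Carrier ] Σ[ β ∈ Carrier ] α * X e + β * X n ≈ X (gcd e n)
    X-bézout e n with Bézout.identity (gcd-GCD e n)
    ... | Bézout.+- x y eq = geometric (q ^ e) x , - (q ^ g * geometric (q ^ n) y) , (begin
      geometric (q ^ e) x * X e + - (q ^ g * geometric (q ^ n) y) * X n
        ≈⟨ solve 5 (λ s e g t n → s ⊗ e ⊕ ⊝ (g ⊗ t) ⊗ n ⊜ e ⊗ s ⊖ g ⊗ (n ⊗ t)) refl (geometric (q ^ e) x) (X e) (q ^ g) (geometric (q ^ n) y) (X n) ⟩
      X e * geometric (q ^ e) x - q ^ g * (X n * geometric (q ^ n) y)   ≈⟨ +-cong (X-multiple e x) (-‿cong (*-congˡ (X-multiple n y))) ⟩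
      X (x ℕ.* e) - q ^ g * X (y ℕ.* n)            ≡⟨ ≡.cong (λ l → X l - q ^ g * X (y ℕ.* n)) eq ⟨
      X (g ℕ.+ y ℕ.* n) - q ^ g * X (y ℕ.* n)      ≈⟨ X-+ g (y ℕ.* n) ⟩
      X g ∎)
      where g = gcd e n
    ... | Bézout.-+ x y eq = - (q ^ g * geometric (q ^ e) x) , geometric (q ^ n) y , (begin
      - (q ^ g * geometric (q ^ e) x) * X e + geometric (q ^ n) y * X n
        ≈⟨ solve 5 (λ s e g t n → ⊝ (g ⊗ s) ⊗ e ⊕ t ⊗ n ⊜ n ⊗ t ⊖ g ⊗ (e ⊗ s)) refl (geometric (q ^ e) x) (X e) (q ^ g) (geometric (q ^ n) y) (X n) ⟩
      X n * geometric (q ^ n) y - q ^ g * (X e * geometric (q ^ e) x)   ≈⟨ +-cong (X-multiple n y) (-‿cong (*-congˡ (X-multiple e x))) ⟩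
      X (y ℕ.* n) - q ^ g * X (x ℕ.* e)            ≡⟨ ≡.cong (λ l → X l - q ^ g * X (x ℕ.* e)) eq ⟨
      X (g ℕ.+ x ℕ.* e) - q ^ g * X (x ℕ.* e)      ≈⟨ X-+ g (x ℕ.* e) ⟩
      X g ∎)
      where g = gcd e n

    -- Mirrors the filtering inside `newΦ`, with 1 in place of an omitted entry, so that a product
    -- over divisors becomes an ordinary product over an initial segment.
    select : ℕ → ℕ → Carrier → Carrier
    select k i p = if does (suc i ∣? k) then p else 1#

    divisorProduct : (ℕ → Carrier) → ℕ → ℕ → Carrier
    divisorProduct φ k = prod (λ i → select k i (φ i))

    select-yes : ∀ k i p → suc i ∣ k → select k i p ≡ p
    select-yes k i p d = ≡.cong (λ b → if b then p else 1#) (dec-true (suc i ∣? k) d)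

    select-no : ∀ k i p → suc i ∤ k → select k i p ≡ 1#
    select-no k i p ¬d = ≡.cong (λ b → if b then p else 1#) (dec-false (suc i ∣? k) ¬d)

    divisorProduct-self : ∀ φ n → divisorProduct φ (suc n) (suc n) ≈ divisorProduct φ (suc n) n * φ n
    divisorProduct-self φ n = *-congˡ {divisorProduct φ (suc n) n} (reflexive (select-yes (suc n) n (φ n) ∣-refl))

    divisorProduct-extend : ∀ φ g k → divisorProduct φ (suc g) (suc g ℕ.+ k) ≈ divisorProduct φ (suc g) (suc g)
    divisorProduct-extend φ g k = trans (prod-++ (λ i → select (suc g) i (φ i)) (suc g) k) (trans (*-congˡ {divisorProduct φ (suc g) (suc g)}
      (trans (prod-cong k λ i _ → reflexive (select-no (suc g) (suc g ℕ.+ i) (φ (suc g ℕ.+ i)) (>⇒∤ (s≤s (ℕₚ.m≤m+n (suc g) i))))) (1^ k))) (*-identityʳ _))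

    divisorProduct-∣ : ∀ φ {g n} → g ∣ n → ∀ m → Σ[ u ∈ Carrier ] divisorProduct φ g m * u ≈ divisorProduct φ n m
    divisorProduct-∣ φ {g} {n} g∣n m = prod rest m , trans (sym (prod-* _ rest m)) (prod-cong m λ i _ → rest≈ i)
      where
      rest : ℕ → Carrier
      rest i with suc i ∣? g
      ... | yes _ = 1#
      ... | no _  = select n i (φ i)
      rest≈ : ∀ i → select g i (φ i) * rest i ≈ select n i (φ i)
      rest≈ i with suc i ∣? g
      ... | yes d = trans (*-identityʳ _) (reflexive (≡.trans (select-yes g i (φ i) d) (≡.sym (select-yes n i (φ i) (∣-trans d g∣n)))))
      ... | no ¬d = trans (*-congʳ {select n i (φ i)} (reflexive (select-no g i (φ i) ¬d))) (*-identityˡ _)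

    -- φ i is the factor of index i + 1.
    Factorises : (ℕ → Carrier) → ℕ → Set
    Factorises φ m = ∀ i → i < m → Σ[ c ∈ NonZeroConst ] divisorProduct φ (suc i) (suc i) ≈ ⟪ c ⟫ * X (suc i)

    module _ {φ : ℕ → Carrier} {m : ℕ} (factorises : Factorises φ m) where

      φ∣X : ∀ i → i < m → φ i ∣ℚ X (suc i)
      φ∣X i i<m = divisorProduct φ (suc i) i , proj₁ (factorises i i<m) ,
        trans (*-comm (φ i) _) (trans (sym (divisorProduct-self φ i)) (proj₂ (factorises i i<m)))

      -- Let n = i + 1, g = gcd(e, n) < n and Y = (q^n - 1)/(q^g - 1). Up to constants φ i divides
      -- Y, since the factors indexed by divisors of g already account for q^g - 1. As Y is
      -- congruent to the constant n/g modulo q^g - 1, and q^g - 1 is a combination of q^e - 1 and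
      -- q^n - 1, with φ i dividing the latter up to constants, a nonzero constant is reached.
      X-cop-φ : ∀ e i → i < m → suc i ∤ e → Cop (X e) (φ i)
      X-cop-φ e i i<m n∤e with gcd e (suc i) in g≡ | gcd[m,n]∣m e (suc i) | gcd[m,n]∣n e (suc i) | X-bézout e (suc i)
      ... | zero  | _ | divides k eq | _ = contradiction (≡.trans eq (ℕₚ.*-zeroʳ k)) λ ()
      ... | suc g | g∣e | g∣n | α , β , bez = - ((⟪ c ⟫ * Z) * α) , (⟪ c′ ⟫ * rest - (Z * β) * D) , (c · k′) , (begin
          - ((⟪ c ⟫ * Z) * α) * X e + (⟪ c′ ⟫ * rest - (Z * β) * D) * φ i
            ≈⟨ solve 9 (λ c Z α x c′ r β D f → ⊝ ((c ⊗ Z) ⊗ α) ⊗ x ⊕ (c′ ⊗ r ⊖ (Z ⊗ β) ⊗ D) ⊗ f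
                 ⊜ f ⊗ (c′ ⊗ r) ⊖ (Z ⊗ (c ⊗ (α ⊗ x) ⊕ β ⊗ (D ⊗ f)))) refl ⟪ c ⟫ Z α (X e) ⟪ c′ ⟫ rest β D (φ i) ⟩
          φ i * (⟪ c′ ⟫ * rest) - Z * (⟪ c ⟫ * (α * X e) + β * (D * φ i))
            ≈⟨ +-cong (sym cY) (-‿cong (*-congˡ {Z} (+-congˡ {⟪ c ⟫ * (α * X e)} (*-congˡ {β} φD)))) ⟩
          ⟪ c ⟫ * Y - Z * (⟪ c ⟫ * (α * X e) + β * (⟪ c ⟫ * X n))
            ≈⟨ solve 7 (λ c Y Z α x β y → c ⊗ Y ⊖ Z ⊗ (c ⊗ (α ⊗ x) ⊕ β ⊗ (c ⊗ y)) ⊜ c ⊗ (Y ⊖ (α ⊗ x ⊕ β ⊗ y) ⊗ Z)) refl ⟪ c ⟫ Y Z α (X e) β (X n) ⟩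
          ⟪ c ⟫ * (Y - (α * X e + β * X n) * Z)     ≈⟨ *-congˡ {⟪ c ⟫} (+-cong Y≈ (-‿cong (*-congʳ {Z} bez))) ⟩
          ⟪ c ⟫ * ((const (ℤ.+ k) + X (suc g) * Z) - X (suc g) * Z)
            ≈⟨ *-congˡ {⟪ c ⟫} (solve 2 (λ k x → (k ⊕ x) ⊖ x ⊜ k) refl (const (ℤ.+ k)) (X (suc g) * Z)) ⟩
          ⟪ c ⟫ * const (ℤ.+ k)                    ≈⟨ ·-hom c k′ ⟨
          ⟪ c · k′ ⟫ ∎)
        where
        n = suc i
        k = _∣_.quotient g∣n
        n≡ : n ≡ k ℕ.* suc g
        n≡ = _∣_.equality g∣n
        k≢0 : ℤ.+ k ≢ ℤ.+ 0
        k≢0 p = contradiction (≡.trans n≡ (≡.cong (ℕ._* suc g) (ℤₚ.+-injective p))) λ ()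
        k′ = ℤ.+ k , k≢0
        G = q ^ suc g
        Y = geometric G k
        Z = proj₁ (geometric-mod G k)
        Y≈ = proj₂ (geometric-mod G k)
        c = proj₁ (factorises i i<m)
        D = divisorProduct φ n i
        φD : D * φ i ≈ ⟪ c ⟫ * X n
        φD = trans (sym (divisorProduct-self φ i)) (proj₂ (factorises i i<m))
        g<n : suc g ≤ i
        g<n with ℕₚ.m≤n⇒m<n∨m≡n (∣⇒≤ g∣n)
        ... | inj₁ g<n  = ℕₚ.≤-pred g<n
        ... | inj₂ g≡n  = contradiction (≡.subst (_∣ e) g≡n g∣e) n∤e
        c′ = proj₁ (factorises g (ℕₚ.≤-trans g<n (ℕₚ.<⇒≤ i<m)))
        rest = proj₁ (divisorProduct-∣ φ g∣n i)
        D≈ : D ≈ (⟪ c′ ⟫ * X (suc g)) * rest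
        D≈ = trans (sym (proj₂ (divisorProduct-∣ φ g∣n i))) (*-congʳ {rest} (begin
          divisorProduct φ (suc g) i                     ≡⟨ ≡.cong (divisorProduct φ (suc g)) (ℕₚ.m+[n∸m]≡n g<n) ⟨
          divisorProduct φ (suc g) (suc g ℕ.+ (i ℕ.∸ suc g)) ≈⟨ divisorProduct-extend φ g (i ℕ.∸ suc g) ⟩
          divisorProduct φ (suc g) (suc g)               ≈⟨ proj₂ (factorises g (ℕₚ.≤-trans g<n (ℕₚ.<⇒≤ i<m))) ⟩
          ⟪ c′ ⟫ * X (suc g)                             ∎))
        -- By `D≈` the proper divisors of n contribute the factor q^g - 1, which is then cancelled
        -- as a regular element.
        cY : ⟪ c ⟫ * Y ≈ φ i * (⟪ c′ ⟫ * rest)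
        cY = X-regular g _ _ (begin
          X (suc g) * (⟪ c ⟫ * Y)                        ≈⟨ solve 3 (λ x c y → x ⊗ (c ⊗ y) ⊜ c ⊗ (x ⊗ y)) refl (X (suc g)) ⟪ c ⟫ Y ⟩
          ⟪ c ⟫ * (X (suc g) * Y)                        ≈⟨ *-congˡ {⟪ c ⟫} (trans (X-multiple (suc g) k) (reflexive (≡.cong X (≡.sym n≡)))) ⟩
          ⟪ c ⟫ * X n                                    ≈⟨ φD ⟨
          D * φ i                                        ≈⟨ *-congʳ {φ i} D≈ ⟩
          ((⟪ c′ ⟫ * X (suc g)) * rest) * φ i            ≈⟨ solve 4 (λ c x r f → ((c ⊗ x) ⊗ r) ⊗ f ⊜ x ⊗ (f ⊗ (c ⊗ r))) refl ⟪ c′ ⟫ (X (suc g)) rest (φ i) ⟩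
          X (suc g) * (φ i * (⟪ c′ ⟫ * rest))            ∎)

      -- Of two distinct indices at least one does not divide the other, and `X-cop-φ` applies to a
      -- multiple of the corresponding factor.
      φ-cop : ∀ i j → i < m → j < m → i ≢ j → Cop (φ i) (φ j)
      φ-cop i j i<m j<m i≢j with suc j ∣? suc i
      ... | no j∤i  = cop-divisor (φ∣X i i<m) (X-cop-φ (suc i) j j<m j∤i)
      ... | yes j∣i = cop-sym (cop-divisor (φ∣X j j<m) (X-cop-φ (suc j) i i<m λ i∣j → i≢j (ℕₚ.suc-injective (∣-antisym i∣j j∣i))))

      -- The factors divide `X n` one by one and are pairwise coprime over ℚ, so their product
      -- divides it. The cofactor for proper divisors becomes the next φ.
      divisorProduct∣X : ∀ n j → j ≤ m → divisorProduct φ n j ∣ℚ X n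
      divisorProduct∣X n zero    _   = ∣⇒∣ℚ (X n) (*-identityˡ _)
      divisorProduct∣X n (suc j) j<m with suc j ∣? n
      ... | no ¬d = ∣ℚ-trans (∣⇒∣ℚ 1# (trans (*-identityʳ _) (trans (*-congˡ {divisorProduct φ n j} (reflexive (select-no n j (φ j) ¬d))) (*-identityʳ _)))) (divisorProduct∣X n j (ℕₚ.<⇒≤ j<m))
      ... | yes d = ≡.subst (λ p → (divisorProduct φ n j * p) ∣ℚ X n) (≡.sym (select-yes n j (φ j) d)) $ cop-product (coprime j ℕₚ.≤-refl) (divisorProduct∣X n j (ℕₚ.<⇒≤ j<m)) (∣ℚ-trans (φ∣X j j<m) (X-∣ d))
        where
        coprime : ∀ l → l ≤ j → Cop (divisorProduct φ n l) (φ j)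
        coprime zero    _   = cop-1 (φ j)
        coprime (suc l) l<j = cop-* (coprime l (ℕₚ.<⇒≤ l<j)) selected
          where
          selected : Cop (select n l (φ l)) (φ j)
          selected with suc l ∣? n
          ... | yes d = ≡.subst (λ p → Cop p (φ j)) (≡.sym (select-yes n l (φ l) d)) $ φ-cop l j (ℕₚ.<-trans l<j j<m) j<m (ℕₚ.<⇒≢ l<j)
          ... | no ¬d = ≡.subst (λ p → Cop p (φ j)) (≡.sym (select-no n l (φ l) ¬d)) (cop-1 (φ j))

    module _ (A B : ℕ → Carrier)
      (A≈ : ∀ m → A m ≈ X (suc m) * divisorProduct B (suc m) m)
      (B≈ : ∀ m → B m ≈ divisorProduct A (suc m) m)
      where

      Represents : (ℕ → Carrier) → ℕ → Set
      Represents φ m = ∀ i → i < m → Σ[ c ∈ NonZeroConst ] ⟪ c ⟫ * A i ≈ φ i * B i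

      private
        represents-product : ∀ φ m → Represents φ m → ∀ k j → j ≤ m →
          Σ[ c ∈ NonZeroConst ] ⟪ c ⟫ * divisorProduct A k j ≈ divisorProduct φ k j * divisorProduct B k j
        represents-product φ m rep k zero    _   = one , *-congʳ const-1
        represents-product φ m rep k (suc j) j<m = c · proj₁ d , (begin
          ⟪ c · proj₁ d ⟫ * (a * select k j (A j))             ≈⟨ *-congʳ (·-hom c (proj₁ d)) ⟩
          (⟪ c ⟫ * ⟪ proj₁ d ⟫) * (a * select k j (A j))       ≈⟨ solve 4 (λ c d a s → (c ⊗ d) ⊗ (a ⊗ s) ⊜ (c ⊗ a) ⊗ (d ⊗ s)) refl _ _ _ _ ⟩
          (⟪ c ⟫ * a) * (⟪ proj₁ d ⟫ * select k j (A j))       ≈⟨ *-cong e (proj₂ d) ⟩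
          (f * b) * (select k j (φ j) * select k j (B j))      ≈⟨ solve 4 (λ f b s t → (f ⊗ b) ⊗ (s ⊗ t) ⊜ (f ⊗ s) ⊗ (b ⊗ t)) refl _ _ _ _ ⟩
          (f * select k j (φ j)) * (b * select k j (B j))      ∎)
          where
          a = divisorProduct A k j
          b = divisorProduct B k j
          f = divisorProduct φ k j
          c = proj₁ (represents-product φ m rep k j (ℕₚ.<⇒≤ j<m))
          e = proj₂ (represents-product φ m rep k j (ℕₚ.<⇒≤ j<m))
          d : Σ[ c ∈ NonZeroConst ] ⟪ c ⟫ * select k j (A j) ≈ select k j (φ j) * select k j (B j)
          d with does (suc j ∣? k)
          ... | true  = rep j j<m
          ... | false = one , *-congʳ const-1

        update : (ℕ → Carrier) → ℕ → Carrier → ℕ → Carrier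
        update φ m x i = if does (i ℕₚ.≟ m) then x else φ i

        update-at : ∀ φ m x → update φ m x m ≡ x
        update-at φ m x = ≡.cong (λ b → if b then x else φ m) (dec-true (m ℕₚ.≟ m) ≡.refl)

        update-below : ∀ φ m x i → i < m → update φ m x i ≡ φ i
        update-below φ m x i i<m = ≡.cong (λ b → if b then x else φ i) (dec-false (i ℕₚ.≟ m) (ℕₚ.<⇒≢ i<m))

        update-product : ∀ φ m x k j → j ≤ m → divisorProduct (update φ m x) k j ≈ divisorProduct φ k j
        update-product φ m x k j j≤m = prod-cong j λ i i<j →
          reflexive (≡.cong (select k i) (update-below φ m x i (ℕₚ.≤-trans i<j j≤m)))

      -- Cyclotomic polynomials are given only as formal fractions A/B. This produces honest
      -- polynomials φ with cA = φB, together with the factorisation of q^n - 1 up to constants, by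
      -- a single induction in which each statement for smaller indices feeds the other.
      polynomial-factors : ∀ m → Σ[ φ ∈ (ℕ → Carrier) ] Factorises φ m × Represents φ m
      polynomial-factors zero    = (λ _ → 1#) , (λ _ ()) , (λ _ ())
      polynomial-factors (suc m) = φ′ , factorises′ , represents′
        where
        φ = proj₁ (polynomial-factors m)
        factorises = proj₁ (proj₂ (polynomial-factors m))
        represents = proj₂ (proj₂ (polynomial-factors m))
        n = suc m
        quotient = divisorProduct∣X factorises n m ℕₚ.≤-refl
        u = proj₁ quotient
        c = proj₁ (proj₂ quotient)
        d = proj₁ (represents-product φ m represents n m ℕₚ.≤-refl)
        φ′ = update φ m (⟪ d ⟫ * u)
        f = divisorProduct φ n m
        factorises′ : Factorises φ′ n
        factorises′ i i<n with ℕₚ.m≤n⇒m<n∨m≡n (ℕₚ.≤-pred i<n)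
        ... | inj₁ i<m    = proj₁ (factorises i i<m) , trans (update-product φ m _ (suc i) (suc i) i<m) (proj₂ (factorises i i<m))
        ... | inj₂ ≡.refl = d · c , (begin
          divisorProduct φ′ n n                ≈⟨ divisorProduct-self φ′ m ⟩
          divisorProduct φ′ n m * φ′ m         ≈⟨ *-cong (update-product φ m _ n m ℕₚ.≤-refl) (reflexive (update-at φ m _)) ⟩
          f * (⟪ d ⟫ * u)                      ≈⟨ solve 3 (λ f d u → f ⊗ (d ⊗ u) ⊜ d ⊗ (f ⊗ u)) refl f ⟪ d ⟫ u ⟩
          ⟪ d ⟫ * (f * u)                      ≈⟨ *-congˡ (proj₂ (proj₂ quotient)) ⟩
          ⟪ d ⟫ * (⟪ c ⟫ * X n)                ≈⟨ *-assoc _ _ _ ⟨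
          (⟪ d ⟫ * ⟪ c ⟫) * X n                ≈⟨ *-congʳ (·-hom d c) ⟨
          ⟪ d · c ⟫ * X n                      ∎)
        represents′ : Represents φ′ n
        represents′ i i<n with ℕₚ.m≤n⇒m<n∨m≡n (ℕₚ.≤-pred i<n)
        ... | inj₁ i<m    = proj₁ (represents i i<m) ,
          trans (proj₂ (represents i i<m)) (*-congʳ (reflexive (≡.sym (update-below φ m _ i i<m))))
        ... | inj₂ ≡.refl = c , (begin
          ⟪ c ⟫ * A m                          ≈⟨ *-congˡ (A≈ m) ⟩
          ⟪ c ⟫ * (X n * b)                    ≈⟨ *-assoc _ _ _ ⟨
          (⟪ c ⟫ * X n) * b                    ≈⟨ *-congʳ (proj₂ (proj₂ quotient)) ⟨
          (f * u) * b                          ≈⟨ solve 3 (λ f u b → (f ⊗ u) ⊗ b ⊜ u ⊗ (f ⊗ b)) refl f u b ⟩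
          u * (f * b)                          ≈⟨ *-congˡ (proj₂ (represents-product φ m represents n m ℕₚ.≤-refl)) ⟨
          u * (⟪ d ⟫ * divisorProduct A n m)   ≈⟨ solve 3 (λ u d a → u ⊗ (d ⊗ a) ⊜ (d ⊗ u) ⊗ a) refl u ⟪ d ⟫ _ ⟩
          (⟪ d ⟫ * u) * divisorProduct A n m   ≈⟨ *-cong (reflexive (update-at φ m _)) (B≈ m) ⟨
          φ′ m * B m                           ∎)
          where b = divisorProduct B n m

    ∣ℚ-* : ∀ {f f′ g g′} → f ∣ℚ f′ → g ∣ℚ g′ → (f * g) ∣ℚ (f′ * g′)
    ∣ℚ-* {f} {f′} {g} {g′} (u , c , e) (v , d , e′) = u * v , c · d , (begin
      (f * g) * (u * v)                    ≈⟨ solve 4 (λ f g u v → (f ⊗ g) ⊗ (u ⊗ v) ⊜ (f ⊗ u) ⊗ (g ⊗ v)) refl f g u v ⟩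
      (f * u) * (g * v)                    ≈⟨ *-cong e e′ ⟩
      (⟪ c ⟫ * f′) * (⟪ d ⟫ * g′)          ≈⟨ solve 4 (λ c f d g → (c ⊗ f) ⊗ (d ⊗ g) ⊜ (c ⊗ d) ⊗ (f ⊗ g)) refl ⟪ c ⟫ f′ ⟪ d ⟫ g′ ⟩
      (⟪ c ⟫ * ⟪ d ⟫) * (f′ * g′)          ≈⟨ *-congʳ (·-hom c d) ⟨
      ⟪ c · d ⟫ * (f′ * g′)                ∎)

    module _ (σ : Hom R R) (σ-q : Hom.⟦_⟧ σ q ≈ - q) (σ-const : ∀ c → Hom.⟦_⟧ σ (const c) ≈ const c)
      (m : ℕ) where
      private
        n : ℕ
        n = suc (m ℕ.+ m)

      module Alternation (ψ : Carrier) (ψ∣X : ψ ∣ℚ X n) (X-cop : ∀ e → n ∤ e → Cop (X e) ψ)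
        (odd∤ : ∀ e → n ∤ e → n ∤ e ℕ.* 2) where
        open Hom σ renaming (⟦_⟧ to σ⟦_⟧)

        ψ̄ M : Carrier
        ψ̄ = σ⟦ ψ ⟧
        M = ((ψ̄ * ψ̄) * (ψ̄ * ψ̄)) * (ψ * ψ)

        cop-σ : ∀ {f g} → Cop f g → Cop σ⟦ f ⟧ σ⟦ g ⟧
        cop-σ (s , t , (c , c≢0) , e) = σ⟦ s ⟧ , σ⟦ t ⟧ , (c , c≢0) ,
          trans (sym (trans (+-homo _ _) (+-cong (*-homo _ _) (*-homo _ _)))) (trans (⟦⟧-cong e) (σ-const c))

        ∣ℚ-σ : ∀ {f g} → f ∣ℚ g → σ⟦ f ⟧ ∣ℚ σ⟦ g ⟧
        ∣ℚ-σ (u , (c , c≢0) , e) = σ⟦ u ⟧ , (c , c≢0) , trans (sym (*-homo _ _)) (trans (⟦⟧-cong e) (trans (*-homo _ _) (*-congʳ (σ-const c))))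

        cop-M : ∀ {p} → Cop p ψ → Cop p ψ̄ → Cop p M
        cop-M h h̄ = cop-sym (cop-* (cop-* (cop-* h̄′ h̄′) (cop-* h̄′ h̄′)) (cop-* h′ h′))
          where
          h′ = cop-sym h
          h̄′ = cop-sym h̄

        σ-q^even : ∀ e → σ⟦ q ^ (e ℕ.* 2) ⟧ ≈ q ^ (e ℕ.* 2)
        σ-q^even e = trans (^-homo q (e ℕ.* 2)) (trans (^-cong (e ℕ.* 2) σ-q) (trans (^-* (- q) e 2)
          (trans (^-cong e (solve 1 (λ q → (𝟙 ⊗ ⊝ q) ⊗ ⊝ q ⊜ (𝟙 ⊗ q) ⊗ q) refl q)) (sym (^-* q e 2)))))

        X-even-cop : ∀ e → n ∤ e → Cop (X (e ℕ.* 2)) M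
        X-even-cop e n∤e = cop-M h (cop-resp (trans (+-homo _ _) (+-cong (σ-q^even e) (trans (-‿homo 1#) (-‿cong 1-homo)))) (cop-σ h))
          where h = X-cop (e ℕ.* 2) (odd∤ e n∤e)

        X-even : ∀ e → X (e ℕ.* 2) ≈ (q ^ e - 1#) * (q ^ e + 1#)
        X-even e = trans (+-congʳ (trans (reflexive (≡.cong (q ^_) (≡.trans (ℕₚ.*-comm e 2) (≡.cong (e ℕ.+_) (ℕₚ.+-identityʳ e))))) (^-+ q e e)))
          (solve 1 (λ x → x ⊗ x ⊖ 𝟙 ⊜ (x ⊖ 𝟙) ⊗ (x ⊕ 𝟙)) refl (q ^ e))

        1-q^-cop : ∀ e → n ∤ e → Cop (1# - q ^ e) M
        1-q^-cop e n∤e = cop-divisor (∣⇒∣ℚ (- (q ^ e + 1#))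
          (trans (solve 1 (λ x → (𝟙 ⊖ x) ⊗ (⊝ (x ⊕ 𝟙)) ⊜ (x ⊖ 𝟙) ⊗ (x ⊕ 𝟙)) refl (q ^ e)) (sym (X-even e)))) (X-even-cop e n∤e)

        1+q-cop : n ∤ 1 → Cop (1# + q) M
        1+q-cop n∤1 = cop-divisor (∣⇒∣ℚ (q ^ 1 - 1#)
          (trans (solve 1 (λ q → (𝟙 ⊕ q) ⊗ (𝟙 ⊗ q ⊖ 𝟙) ⊜ (𝟙 ⊗ q ⊖ 𝟙) ⊗ (𝟙 ⊗ q ⊕ 𝟙)) refl q) (sym (X-even 1)))) (X-even-cop 1 n∤1)

        q-cop : Cop q M
        q-cop = cop-M h (cop-divisor (∣⇒∣ℚ (- 1#) (solve 1 (λ q → q ⊗ ⊝ 𝟙 ⊜ ⊝ q) refl q)) (cop-resp σ-q (cop-σ h)))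
          where
          bézout : q ^ (m ℕ.+ m) * q + - 1# * X n ≈ const (ℤ.+ 1)
          bézout = trans (solve 1 (λ x → x ⊕ ⊝ 𝟙 ⊗ (x ⊖ 𝟙) ⊜ 𝟙) refl (q ^ n)) (sym const-1)
          h : Cop q ψ
          h = cop-sym (cop-divisor ψ∣X (cop-sym (q ^ (m ℕ.+ m) , - 1# , one , bézout)))

        2-cop : Cop (1# + 1#) M
        2-cop = 1# , 0# , (ℤ.+ 2 , λ ()) , trans (solve 1 (λ x → 𝟙 ⊗ (𝟙 ⊕ 𝟙) ⊕ Κ (ℤ.+ 0) ⊗ x ⊜ 𝟙 ⊕ 𝟙) refl M)
          (trans (+-congʳ (sym const-1)) (const-suc 1))

        W₁ : Carrier
        W₁ = 1# + q ^ n

        ψ̄∣W₁ : ψ̄ ∣ℚ W₁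
        ψ̄∣W₁ = ∣ℚ-trans (∣ℚ-σ ψ∣X) (∣⇒∣ℚ (- 1#) (trans (*-congʳ (trans (+-homo _ _) (+-cong σ-q^n (trans (-‿homo 1#) (-‿cong 1-homo)))))
          (solve 1 (λ x → (⊝ x ⊖ 𝟙) ⊗ ⊝ 𝟙 ⊜ 𝟙 ⊕ x) refl (q ^ n))))
          where
          σ-q^n : σ⟦ q ^ n ⟧ ≈ - (q ^ n)
          σ-q^n = trans (*-homo _ _) (trans (*-cong (trans (reflexive (≡.cong (λ l → σ⟦ q ^ l ⟧) m+m)) (trans (σ-q^even m) (reflexive (≡.cong (q ^_) (≡.sym m+m))))) σ-q)
                    (sym (-‿distribʳ-* _ _)))
            where
            m+m : m ℕ.+ m ≡ m ℕ.* 2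
            m+m = ≡.trans (≡.cong (m ℕ.+_) (≡.sym (ℕₚ.+-identityʳ m))) (ℕₚ.*-comm 2 m)

        M∣ : M ∣ℚ ((W₁ * W₁) * ((1# - q ^ (n ℕ.+ n)) * (1# - q ^ (n ℕ.+ n))))
        M∣ = ∣ℚ-trans (∣ℚ-* (∣ℚ-* (∣ℚ-* ψ̄∣W₁ ψ̄∣W₁) (∣ℚ-* ψ̄∣W₁ ψ̄∣W₁)) (∣ℚ-* ψ∣X ψ∣X))
          (∣⇒∣ℚ 1# (trans (solve 1 (λ x → (((𝟙 ⊕ x) ⊗ (𝟙 ⊕ x)) ⊗ ((𝟙 ⊕ x) ⊗ (𝟙 ⊕ x))) ⊗ ((x ⊖ 𝟙) ⊗ (x ⊖ 𝟙)) ⊗ 𝟙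
              ⊜ ((𝟙 ⊕ x) ⊗ (𝟙 ⊕ x)) ⊗ ((𝟙 ⊖ x ⊗ x) ⊗ (𝟙 ⊖ x ⊗ x))) refl (q ^ n))
            (*-congˡ (*-cong 1-q^2n 1-q^2n))))
          where 1-q^2n = +-congˡ (-‿cong (sym (^-+ q n n)))

        module _ (A B : Carrier) (d : NonZeroConst) (dA : ⟪ d ⟫ * A ≈ ψ * B) where

          modulus-num modulus-den : Carrier
          modulus-num = ((((1# * σ⟦ A ⟧) * σ⟦ A ⟧) * σ⟦ A ⟧) * σ⟦ A ⟧) * ((1# * A) * A)
          modulus-den = ((((1# * σ⟦ B ⟧) * σ⟦ B ⟧) * σ⟦ B ⟧) * σ⟦ B ⟧) * ((1# * B) * B)

          private
            d⁶ : NonZeroConst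
            d⁶ = ((d · d) · (d · d)) · (d · d)

            d̄A : ⟪ d ⟫ * σ⟦ A ⟧ ≈ ψ̄ * σ⟦ B ⟧
            d̄A = trans (*-congʳ (sym (σ-const (proj₁ d)))) (trans (sym (*-homo _ _)) (trans (⟦⟧-cong dA) (*-homo _ _)))

            ⟪d⁶⟫ : ⟪ d⁶ ⟫ ≈ ((⟪ d ⟫ * ⟪ d ⟫) * (⟪ d ⟫ * ⟪ d ⟫)) * (⟪ d ⟫ * ⟪ d ⟫)
            ⟪d⁶⟫ = trans (·-hom ((d · d) · (d · d)) (d · d)) (*-cong (trans (·-hom (d · d) (d · d)) (*-cong (·-hom d d) (·-hom d d))) (·-hom d d))

            modulus≈ : ⟪ d⁶ ⟫ * modulus-num ≈ M * modulus-den
            modulus≈ = begin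
              ⟪ d⁶ ⟫ * modulus-num   ≈⟨ *-congʳ ⟪d⁶⟫ ⟩
              (((⟪ d ⟫ * ⟪ d ⟫) * (⟪ d ⟫ * ⟪ d ⟫)) * (⟪ d ⟫ * ⟪ d ⟫)) * modulus-num
                ≈⟨ solve 3 (λ d ā a → (((d ⊗ d) ⊗ (d ⊗ d)) ⊗ (d ⊗ d)) ⊗ (((((𝟙 ⊗ ā) ⊗ ā) ⊗ ā) ⊗ ā) ⊗ ((𝟙 ⊗ a) ⊗ a))
                     ⊜ (((d ⊗ ā) ⊗ (d ⊗ ā)) ⊗ ((d ⊗ ā) ⊗ (d ⊗ ā))) ⊗ ((d ⊗ a) ⊗ (d ⊗ a))) refl ⟪ d ⟫ σ⟦ A ⟧ A ⟩
              (((⟪ d ⟫ * σ⟦ A ⟧) * (⟪ d ⟫ * σ⟦ A ⟧)) * ((⟪ d ⟫ * σ⟦ A ⟧) * (⟪ d ⟫ * σ⟦ A ⟧))) * ((⟪ d ⟫ * A) * (⟪ d ⟫ * A))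
                ≈⟨ *-cong (*-cong (*-cong d̄A d̄A) (*-cong d̄A d̄A)) (*-cong dA dA) ⟩
              (((ψ̄ * σ⟦ B ⟧) * (ψ̄ * σ⟦ B ⟧)) * ((ψ̄ * σ⟦ B ⟧) * (ψ̄ * σ⟦ B ⟧))) * ((ψ * B) * (ψ * B))
                ≈⟨ solve 4 (λ ψ̄ b̄ ψ b → (((ψ̄ ⊗ b̄) ⊗ (ψ̄ ⊗ b̄)) ⊗ ((ψ̄ ⊗ b̄) ⊗ (ψ̄ ⊗ b̄))) ⊗ ((ψ ⊗ b) ⊗ (ψ ⊗ b))
                     ⊜ (((ψ̄ ⊗ ψ̄) ⊗ (ψ̄ ⊗ ψ̄)) ⊗ (ψ ⊗ ψ)) ⊗ (((((𝟙 ⊗ b̄) ⊗ b̄) ⊗ b̄) ⊗ b̄) ⊗ ((𝟙 ⊗ b) ⊗ b))) refl ψ̄ σ⟦ B ⟧ ψ B ⟩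
              M * modulus-den ∎

          conclude : ∀ N D u v W → v * N ≈ W * (u * D) → M ∣ℚ W → Cop v M →
            Σ[ U ∈ Carrier ] Σ[ V ∈ Carrier ]
              (Σ[ s ∈ Carrier ] Σ[ t ∈ Carrier ] Σ[ c ∈ ℤ ] c ≢ ℤ.+ 0 × (s * V) * modulus-den + t * modulus-num ≈ const c * modulus-den)
              × (V * N) * modulus-den ≈ (modulus-num * U) * D
          conclude N D u v W e (y , c , e′) (s , t , k , e″) =
            ⟪ d⁶ ⟫ * (y * u) , ⟪ c ⟫ * v , (s , (⟪ c ⟫ * t) * ⟪ d⁶ ⟫ , proj₁ (c · k) , proj₂ (c · k) , coprime) , divides′
            where
            coprime : (s * (⟪ c ⟫ * v)) * modulus-den + ((⟪ c ⟫ * t) * ⟪ d⁶ ⟫) * modulus-num ≈ ⟪ c · k ⟫ * modulus-den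
            coprime = begin
              (s * (⟪ c ⟫ * v)) * modulus-den + ((⟪ c ⟫ * t) * ⟪ d⁶ ⟫) * modulus-num
                ≈⟨ +-congˡ (trans (*-assoc _ _ _) (*-congˡ modulus≈)) ⟩
              (s * (⟪ c ⟫ * v)) * modulus-den + (⟪ c ⟫ * t) * (M * modulus-den)
                ≈⟨ solve 6 (λ s c v b t M → (s ⊗ (c ⊗ v)) ⊗ b ⊕ (c ⊗ t) ⊗ (M ⊗ b) ⊜ (c ⊗ (s ⊗ v ⊕ t ⊗ M)) ⊗ b) refl s ⟪ c ⟫ v modulus-den t M ⟩
              (⟪ c ⟫ * (s * v + t * M)) * modulus-den   ≈⟨ *-congʳ (trans (*-congˡ e″) (sym (·-hom c k))) ⟩
              ⟪ c · k ⟫ * modulus-den                   ∎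
            divides′ : ((⟪ c ⟫ * v) * N) * modulus-den ≈ (modulus-num * (⟪ d⁶ ⟫ * (y * u))) * D
            divides′ = begin
              ((⟪ c ⟫ * v) * N) * modulus-den             ≈⟨ *-congʳ (trans (*-assoc _ _ _) (*-congˡ e)) ⟩
              (⟪ c ⟫ * (W * (u * D))) * modulus-den       ≈⟨ solve 5 (λ c W u D b → (c ⊗ (W ⊗ (u ⊗ D))) ⊗ b ⊜ (c ⊗ W) ⊗ ((u ⊗ D) ⊗ b)) refl ⟪ c ⟫ W u D modulus-den ⟩
              (⟪ c ⟫ * W) * ((u * D) * modulus-den)       ≈⟨ *-congʳ e′ ⟨
              (M * y) * ((u * D) * modulus-den)           ≈⟨ solve 5 (λ M y u D b → (M ⊗ y) ⊗ ((u ⊗ D) ⊗ b) ⊜ (M ⊗ b) ⊗ ((y ⊗ u) ⊗ D)) refl M y u D modulus-den ⟩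
              (M * modulus-den) * ((y * u) * D)           ≈⟨ *-congʳ modulus≈ ⟨
              (⟪ d⁶ ⟫ * modulus-num) * ((y * u) * D)      ≈⟨ solve 4 (λ d a z D → (d ⊗ a) ⊗ (z ⊗ D) ⊜ (a ⊗ (d ⊗ z)) ⊗ D) refl ⟪ d⁶ ⟫ modulus-num (y * u) D ⟩
              (modulus-num * (⟪ d⁶ ⟫ * (y * u))) * D      ∎

-- The two sides of the congruence in a ring over ℤ[q]

module Image (R : CRing) (h : Hom ℤ[q] R) where
  open CommutativeRing R
  open RingKit R
  open Hom h public
  open import Relation.Binary.Reasoning.Setoid setoid

  q′ : Carrier
  q′ = ⟦ q ⟧
  open Sequences (ops R) q′
  open Exponents R q′

  qpow-image : ∀ k → ⟦ qpow k ⟧ ≈ q′ ^ k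
  qpow-image k = trans (⟦⟧-cong (qpow≋ k)) (^-homo q k)

  1-qpow-image : ∀ k → ⟦ oneP -P qpow k ⟧ ≈ 1# - q′ ^ k
  1-qpow-image k = trans (1-‿homo (qpow k)) (+-congˡ (-‿cong (qpow-image k)))

  cube-image : ∀ p {x} → ⟦ p ⟧ ≈ x → ⟦ cube p ⟧ ≈ (x * x) * x
  cube-image p e = trans (*-homo (p *P p) p) (*-cong (trans (*-homo p p) (*-cong e e)) e)

  poch4-image : ∀ s (f : ℕ → Carrier) → (∀ i → q′ ^ (s ℕ.+ 4 ℕ.* i) ≈ f i) → ∀ k → ⟦ poch4 s k ⟧ ≈ prod (λ i → 1# - f i) k
  poch4-image s f e zero    = 1-homo
  poch4-image s f e (suc k) = trans (*-homo (poch4 s k) _)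
    (*-cong (poch4-image s f e k) (trans (1-qpow-image (s ℕ.+ 4 ℕ.* k)) (+-congˡ (-‿cong (e k)))))

  pochP-image : ∀ k → ⟦ poch4 4 k ⟧ ≈ pochP k
  pochP-image = poch4-image 4 _ λ i → trans (reflexive (≡.cong (q′ ^_) (eq i))) (sym (P^≈q^ (suc i)))
    where
    eq : ∀ i → 4 ℕ.+ 4 ℕ.* i ≡ suc i ℕ.* 2 ℕ.* 2
    eq = solve-∀

  pocha-image : ∀ k → ⟦ poch4 2 k ⟧ ≈ pocha k
  pocha-image = poch4-image 2 _ λ i → trans (reflexive (≡.cong (q′ ^_) (eq i))) (sym (aP^≈q^ i))
    where
    eq : ∀ i → 2 ℕ.+ 4 ℕ.* i ≡ suc (i ℕ.* 2) ℕ.* 2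
    eq = solve-∀

  sign-image : ∀ k → ⟦ constP (sign (suc k)) ⟧ ≈ - ⟦ constP (sign k) ⟧
  sign-image k = -‿homo (constP (sign k))

  signed-power-image : ∀ k → ⟦ constP (sign k) ⟧ * q′ ^ (2 ℕ.* k ℕ.* k ℕ.+ 2 ℕ.* k) ≈ prod (λ i → - P ^ suc i) k
  signed-power-image zero    = trans (*-congʳ 1-homo) (*-identityˡ 1#)
  signed-power-image (suc k) = begin
    ⟦ constP (sign (suc k)) ⟧ * q′ ^ (2 ℕ.* suc k ℕ.* suc k ℕ.+ 2 ℕ.* suc k)
      ≈⟨ *-cong (sign-image k) (trans (reflexive (≡.cong (q′ ^_) (eq k))) (^-+ q′ (2 ℕ.* k ℕ.* k ℕ.+ 2 ℕ.* k) (suc k ℕ.* 2 ℕ.* 2))) ⟩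
    - ⟦ constP (sign k) ⟧ * (q′ ^ (2 ℕ.* k ℕ.* k ℕ.+ 2 ℕ.* k) * q′ ^ (suc k ℕ.* 2 ℕ.* 2))
      ≈⟨ solve 3 (λ s x y → ⊝ s ⊗ (x ⊗ y) ⊜ (s ⊗ x) ⊗ ⊝ y) refl _ _ _ ⟩
    (⟦ constP (sign k) ⟧ * q′ ^ (2 ℕ.* k ℕ.* k ℕ.+ 2 ℕ.* k)) * - (q′ ^ (suc k ℕ.* 2 ℕ.* 2))
      ≈⟨ *-cong (signed-power-image k) (-‿cong (sym (P^≈q^ (suc k)))) ⟩
    prod (λ i → - P ^ suc i) (suc k) ∎
    where
    eq : ∀ k → 2 ℕ.* suc k ℕ.* suc k ℕ.+ 2 ℕ.* suc k ≡ 2 ℕ.* k ℕ.* k ℕ.+ 2 ℕ.* k ℕ.+ suc k ℕ.* 2 ℕ.* 2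
    eq = solve-∀

  1+qP^-image : ∀ k → ⟦ oneP +P qpow (4 ℕ.* k ℕ.+ 1) ⟧ ≈ 1# + q′ * P ^ k
  1+qP^-image k = trans (+-homo oneP _) (+-cong 1-homo (trans (qpow-image (4 ℕ.* k ℕ.+ 1))
    (trans (reflexive (≡.cong (q′ ^_) (eq k))) (trans (*-congʳ (sym (P^≈q^ k))) (*-comm _ _)))))
    where
    eq : ∀ k → 4 ℕ.* k ℕ.+ 1 ≡ suc (k ℕ.* 2 ℕ.* 2)
    eq = solve-∀

  cq-num-image : ∀ k → ⟦ proj₁ (cq k) ⟧ ≈ ((1# + q′ * P ^ k) * ((pocha k * pocha k) * pocha k)) * prod (λ i → - P ^ suc i) k
  cq-num-image k = begin
    ⟦ scaleP (sign k) ((s *P cube (poch4 2 k)) *P qpow e) ⟧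
      ≈⟨ trans (⟦⟧-cong (scale≋ (sign k) _)) (trans (*-homo (constP (sign k)) _) (*-congˡ (trans (*-homo (s *P cube (poch4 2 k)) _) (*-congʳ (*-homo s _))))) ⟩
    ⟦ constP (sign k) ⟧ * ((⟦ s ⟧ * ⟦ cube (poch4 2 k) ⟧) * ⟦ qpow e ⟧)
      ≈⟨ *-congˡ (*-cong (*-cong (1+qP^-image k) (cube-image (poch4 2 k) (pocha-image k))) (qpow-image e)) ⟩
    ⟦ constP (sign k) ⟧ * (((1# + q′ * P ^ k) * ((pocha k * pocha k) * pocha k)) * q′ ^ e)
      ≈⟨ solve 3 (λ c x y → c ⊗ (x ⊗ y) ⊜ x ⊗ (c ⊗ y)) refl _ _ _ ⟩
    ((1# + q′ * P ^ k) * ((pocha k * pocha k) * pocha k)) * (⟦ constP (sign k) ⟧ * q′ ^ e)   ≈⟨ *-congˡ (signed-power-image k) ⟩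
    ((1# + q′ * P ^ k) * ((pocha k * pocha k) * pocha k)) * prod (λ i → - P ^ suc i) k       ∎
    where
    s = oneP +P qpow (4 ℕ.* k ℕ.+ 1)
    e = 2 ℕ.* k ℕ.* k ℕ.+ 2 ℕ.* k

  cq-den-image : ∀ k → ⟦ proj₂ (cq k) ⟧ ≈ (1# + q′) * ((pochP k * pochP k) * pochP k)
  cq-den-image k = trans (*-homo (oneP +P qpow 1) _)
    (*-cong (trans (+-homo oneP (qpow 1)) (+-congʳ 1-homo)) (cube-image (poch4 4 k) (pochP-image k)))

  qpow2-image : ∀ k → ⟦ qpow (2 ℕ.* k) ⟧ ≈ a ^ k
  qpow2-image k = trans (qpow-image (2 ℕ.* k)) (trans (reflexive (≡.cong (q′ ^_) (ℕₚ.*-comm 2 k))) (trans (^-* q′ k 2) (^-cong k (sym a≈))))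

  qint2-image : ∀ k → (1# - a) * ⟦ qint2 k ⟧ ≈ 1# - a ^ k
  qint2-image zero    = trans (*-congˡ 0-homo) (solve 1 (λ a → (𝟙 ⊖ a) ⊗ Κ (ℤ.+ 0) ⊜ 𝟙 ⊖ 𝟙) refl a)
  qint2-image (suc k) = begin
    (1# - a) * ⟦ qint2 k +P qpow (2 ℕ.* k) ⟧            ≈⟨ *-congˡ (trans (+-homo (qint2 k) _) (+-congˡ (qpow2-image k))) ⟩
    (1# - a) * (⟦ qint2 k ⟧ + a ^ k)                    ≈⟨ solve 3 (λ a x y → (𝟙 ⊖ a) ⊗ (x ⊕ y) ⊜ (𝟙 ⊖ a) ⊗ x ⊕ (𝟙 ⊖ a) ⊗ y) refl _ _ _ ⟩
    (1# - a) * ⟦ qint2 k ⟧ + (1# - a) * a ^ k           ≈⟨ +-congʳ (qint2-image k) ⟩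
    (1# - a ^ k) + (1# - a) * a ^ k                     ≈⟨ solve 2 (λ a x → (𝟙 ⊖ x) ⊕ (𝟙 ⊖ a) ⊗ x ⊜ 𝟙 ⊖ x ⊗ a) refl _ _ ⟩
    1# - a ^ suc k                                      ∎

  Represents : Frac → Carrier → Set
  Represents (N , D) y = ⟦ D ⟧ * y ≈ ⟦ N ⟧

  represents-+ : ∀ x x′ {y y′} → Represents x y → Represents x′ y′ → Represents (x +F x′) (y + y′)
  represents-+ (N , D) (N′ , D′) {y} {y′} e e′ = begin
    ⟦ D *P D′ ⟧ * (y + y′)                        ≈⟨ *-congʳ (*-homo D D′) ⟩
    (⟦ D ⟧ * ⟦ D′ ⟧) * (y + y′)                   ≈⟨ solve 4 (λ d d′ y y′ → (d ⊗ d′) ⊗ (y ⊕ y′) ⊜ (d ⊗ y) ⊗ d′ ⊕ (d′ ⊗ y′) ⊗ d) refl _ _ _ _ ⟩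
    (⟦ D ⟧ * y) * ⟦ D′ ⟧ + (⟦ D′ ⟧ * y′) * ⟦ D ⟧  ≈⟨ +-cong (*-congʳ e) (*-congʳ e′) ⟩
    ⟦ N ⟧ * ⟦ D′ ⟧ + ⟦ N′ ⟧ * ⟦ D ⟧               ≈⟨ trans (+-homo (N *P D′) (N′ *P D)) (+-cong (*-homo N D′) (*-homo N′ D)) ⟨
    ⟦ N *P D′ +P N′ *P D ⟧                        ∎

  represents-* : ∀ x x′ {y y′} → Represents x y → Represents x′ y′ → Represents (x *F x′) (y * y′)
  represents-* (N , D) (N′ , D′) {y} {y′} e e′ = begin
    ⟦ D *P D′ ⟧ * (y * y′)          ≈⟨ *-congʳ (*-homo D D′) ⟩
    (⟦ D ⟧ * ⟦ D′ ⟧) * (y * y′)     ≈⟨ solve 4 (λ d d′ y y′ → (d ⊗ d′) ⊗ (y ⊗ y′) ⊜ (d ⊗ y) ⊗ (d′ ⊗ y′)) refl _ _ _ _ ⟩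
    (⟦ D ⟧ * y) * (⟦ D′ ⟧ * y′)     ≈⟨ *-cong e e′ ⟩
    ⟦ N ⟧ * ⟦ N′ ⟧                  ≈⟨ *-homo N N′ ⟨
    ⟦ N *P N′ ⟧                     ∎

  represents-sum : ∀ (f : ℕ → Frac) y n → (∀ k → k < n → Represents (f k) (y k)) → Represents (sumF f n) (sum y n)
  represents-sum f y zero    h = trans (zeroʳ _) (sym 0-homo)
  represents-sum f y (suc n) h = represents-+ (sumF f n) (f n)
    (represents-sum f y n λ k k<n → h k (ℕₚ.m<n⇒m<1+n k<n)) (h n ℕₚ.≤-refl)

  represents-poly : ∀ p → Represents (poly→F p) ⟦ p ⟧
  represents-poly p = trans (*-congʳ 1-homo) (*-identityˡ _)

  module _ (r : Carrier) (v w : ℕ → Carrier) (r-inv : (1# + q′) * r ≈ 1#) where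
    open Series r v w 0#

    private
      d-cleared : ∀ k → (∀ i → i < k → (1# - P ^ suc i) * v i ≈ 1#) → (∀ i → i < k → denX 0# i * w i ≈ 1#) →
        ((pochP k * pochP k) * pochP k) * d k ≈ ((pocha k * pocha k) * pocha k) * prod (λ i → - P ^ suc i) k
      d-cleared zero    _ _ = refl
      d-cleared (suc k) v-inv w-inv = begin
        (((f * s) * (f * s)) * (f * s)) * (d k * - (p * ((t * (t * t - 0# * y)) * (v k * w k))))
          ≈⟨ solve 8 (λ f s d p t y v w → (((f ⊗ s) ⊗ (f ⊗ s)) ⊗ (f ⊗ s)) ⊗ (d ⊗ ⊝ (p ⊗ ((t ⊗ (t ⊗ t ⊖ Κ (ℤ.+ 0) ⊗ y)) ⊗ (v ⊗ w))))
               ⊜ (((f ⊗ f) ⊗ f) ⊗ d) ⊗ (((t ⊗ t) ⊗ t) ⊗ (⊝ p ⊗ ((s ⊗ v) ⊗ ((s ⊗ s ⊖ Κ (ℤ.+ 0) ⊗ p) ⊗ w))))) refl f s (d k) p t y (v k) (w k) ⟩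
        (((f * f) * f) * d k) * (((t * t) * t) * (- p * ((s * v k) * ((s * s - 0# * p) * w k))))
          ≈⟨ *-cong (d-cleared k (λ i i<k → v-inv i (ℕₚ.m<n⇒m<1+n i<k)) (λ i i<k → w-inv i (ℕₚ.m<n⇒m<1+n i<k)))
                    (*-congˡ (*-congˡ (*-cong (v-inv k ℕₚ.≤-refl) (w-inv k ℕₚ.≤-refl)))) ⟩
        (((o * o) * o) * e) * (((t * t) * t) * (- p * (1# * 1#)))
          ≈⟨ solve 4 (λ o e t p → (((o ⊗ o) ⊗ o) ⊗ e) ⊗ (((t ⊗ t) ⊗ t) ⊗ (⊝ p ⊗ (𝟙 ⊗ 𝟙))) ⊜ (((o ⊗ t) ⊗ (o ⊗ t)) ⊗ (o ⊗ t)) ⊗ (e ⊗ ⊝ p)) refl o e t p ⟩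
        (((o * t) * (o * t)) * (o * t)) * (e * - p) ∎
        where
        f = pochP k
        s = 1# - P ^ suc k
        p = P ^ suc k
        t = 1# - a * P ^ k
        y = a * P ^ k
        o = pocha k
        e = prod (λ i → - P ^ suc i) k

    represents-cq : ∀ k → (∀ i → i < k → (1# - P ^ suc i) * v i ≈ 1#) → (∀ i → i < k → denX 0# i * w i ≈ 1#) →
      Represents (cq k) (c k)
    represents-cq k v-inv w-inv = begin
      ⟦ proj₂ (cq k) ⟧ * c k                                  ≈⟨ *-congʳ (cq-den-image k) ⟩
      ((1# + q′) * ((f * f) * f)) * (((1# + q′ * P ^ k) * r) * d k)
        ≈⟨ solve 5 (λ s f t r d → (s ⊗ ((f ⊗ f) ⊗ f)) ⊗ ((t ⊗ r) ⊗ d) ⊜ (s ⊗ r) ⊗ (t ⊗ (((f ⊗ f) ⊗ f) ⊗ d))) refl (1# + q′) f (1# + q′ * P ^ k) r (d k) ⟩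
      ((1# + q′) * r) * ((1# + q′ * P ^ k) * (((f * f) * f) * d k))   ≈⟨ *-cong r-inv (*-congˡ (d-cleared k v-inv w-inv)) ⟩
      1# * ((1# + q′ * P ^ k) * (((o * o) * o) * prod (λ i → - P ^ suc i) k))
        ≈⟨ solve 3 (λ s o e → 𝟙 ⊗ (s ⊗ (o ⊗ e)) ⊜ (s ⊗ o) ⊗ e) refl _ _ _ ⟩
      ((1# + q′ * P ^ k) * ((o * o) * o)) * prod (λ i → - P ^ suc i) k   ≈⟨ cq-num-image k ⟨
      ⟦ proj₁ (cq k) ⟧ ∎
      where
      f = pochP k
      o = pocha k

  module _ (v v₃ v₅ : ℕ → Carrier)
    (v-inv  : ∀ i → (1# - P ^ suc i) * v i ≈ 1#)
    (v₃-inv : ∀ i → (1# - (q′ * a) * P ^ i) * v₃ i ≈ 1#)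
    (v₅-inv : ∀ i → (1# - (q′ * P) * P ^ i) * v₅ i ≈ 1#) where

    represents-inner : ∀ k → Represents ((cube (poch4 2 k) *P qpow (2 ℕ.* k)) , ((poch4 4 k *P poch4 3 k) *P poch4 5 k))
      (τ v v₃ v₅ k * prod (numX 0#) k)
    represents-inner k = begin
      ⟦ (poch4 4 k *P poch4 3 k) *P poch4 5 k ⟧ * (τ v v₃ v₅ k * prod (numX 0#) k)
        ≈⟨ *-congʳ (trans (*-homo (poch4 4 k *P poch4 3 k) _) (*-cong (trans (*-homo (poch4 4 k) _) (*-cong (pochP-image k) (image₃ k))) (image₅ k))) ⟩
      ((pochP k * poch₃ k) * poch₅ k) * (τ v v₃ v₅ k * prod (numX 0#) k)   ≈⟨ products k ⟩
      ((pocha k * pocha k) * pocha k) * a ^ k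
        ≈⟨ trans (*-homo (cube (poch4 2 k)) _) (*-cong (cube-image (poch4 2 k) (pocha-image k)) (qpow2-image k)) ⟨
      ⟦ cube (poch4 2 k) *P qpow (2 ℕ.* k) ⟧ ∎
      where
      poch₃ poch₅ : ℕ → Carrier
      poch₃ = prod (λ i → 1# - (q′ * a) * P ^ i)
      poch₅ = prod (λ i → 1# - (q′ * P) * P ^ i)
      image₃ : ∀ k → ⟦ poch4 3 k ⟧ ≈ poch₃ k
      image₃ = poch4-image 3 _ λ i → sym (trans (*-assoc q′ a _) (trans (*-congˡ (aP^≈q^ i)) (trans (*-comm q′ _) (reflexive (≡.cong (q′ ^_) (eq i))))))
        where
        eq : ∀ i → suc (suc (i ℕ.* 2) ℕ.* 2) ≡ 3 ℕ.+ 4 ℕ.* i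
        eq = solve-∀
      image₅ : ∀ k → ⟦ poch4 5 k ⟧ ≈ poch₅ k
      image₅ = poch4-image 5 _ λ i → sym (trans (solve 3 (λ q P x → (q ⊗ P) ⊗ x ⊜ (x ⊗ P) ⊗ q) refl q′ P (P ^ i)) (trans (*-congʳ (P^≈q^ (suc i))) (reflexive (≡.cong (q′ ^_) (eq i)))))
        where
        eq : ∀ i → suc (suc i ℕ.* 2 ℕ.* 2) ≡ 5 ℕ.+ 4 ℕ.* i
        eq = solve-∀
      products : ∀ k → ((pochP k * poch₃ k) * poch₅ k) * (τ v v₃ v₅ k * prod (numX 0#) k) ≈ ((pocha k * pocha k) * pocha k) * a ^ k
      products zero    = solve 0 (((𝟙 ⊗ 𝟙) ⊗ 𝟙) ⊗ (𝟙 ⊗ 𝟙) ⊜ ((𝟙 ⊗ 𝟙) ⊗ 𝟙) ⊗ 𝟙) refl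
      products (suc k) = begin
        (((f * s) * (g * s₃)) * (g₅ * s₅)) * ((T * (((a * t) * v k) * (v₃ k * v₅ k))) * (M * (t * t - 0# * y)))
          ≈⟨ solve 14 (λ f s g s₃ h s₅ T a t v v₃ v₅ M y →
               (((f ⊗ s) ⊗ (g ⊗ s₃)) ⊗ (h ⊗ s₅)) ⊗ ((T ⊗ (((a ⊗ t) ⊗ v) ⊗ (v₃ ⊗ v₅))) ⊗ (M ⊗ (t ⊗ t ⊖ Κ (ℤ.+ 0) ⊗ y)))
               ⊜ (((f ⊗ g) ⊗ h) ⊗ (T ⊗ M)) ⊗ ((((t ⊗ t) ⊗ t) ⊗ a) ⊗ ((s ⊗ v) ⊗ ((s₃ ⊗ v₃) ⊗ (s₅ ⊗ v₅))))) refl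
               f s g s₃ g₅ s₅ T a t (v k) (v₃ k) (v₅ k) M y ⟩
        (((f * g) * g₅) * (T * M)) * ((((t * t) * t) * a) * ((s * v k) * ((s₃ * v₃ k) * (s₅ * v₅ k))))
          ≈⟨ *-cong (products k) (*-congˡ (*-cong (v-inv k) (*-cong (v₃-inv k) (v₅-inv k)))) ⟩
        (((o * o) * o) * a ^ k) * ((((t * t) * t) * a) * (1# * (1# * 1#)))
          ≈⟨ solve 4 (λ o A t a → (((o ⊗ o) ⊗ o) ⊗ A) ⊗ ((((t ⊗ t) ⊗ t) ⊗ a) ⊗ (𝟙 ⊗ (𝟙 ⊗ 𝟙))) ⊜ (((o ⊗ t) ⊗ (o ⊗ t)) ⊗ (o ⊗ t)) ⊗ (A ⊗ a)) refl o (a ^ k) t a ⟩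
        (((o * t) * (o * t)) * (o * t)) * (a ^ k * a) ∎
        where
        f  = pochP k
        s  = 1# - P ^ suc k
        g  = poch₃ k
        s₃ = 1# - (q′ * a) * P ^ k
        g₅ = poch₅ k
        s₅ = 1# - (q′ * P) * P ^ k
        T  = τ v v₃ v₅ k
        t  = 1# - a * P ^ k
        M  = prod (numX 0#) k
        y  = a * P ^ k
        o  = pocha k

  ε²-image : ∀ m → ε m * ε m ≈ q′ ^ ((m ℕ.+ m) ℕ.* (m ℕ.+ m))
  ε²-image zero    = *-identityˡ 1#
  ε²-image (suc m) = begin
    (ε m * - (a * P ^ m)) * (ε m * - (a * P ^ m))       ≈⟨ solve 2 (λ e x → (e ⊗ ⊝ x) ⊗ (e ⊗ ⊝ x) ⊜ (e ⊗ e) ⊗ (x ⊗ x)) refl _ _ ⟩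
    (ε m * ε m) * ((a * P ^ m) * (a * P ^ m))           ≈⟨ *-cong (ε²-image m) (*-cong (aP^≈q^ m) (aP^≈q^ m)) ⟩
    q′ ^ ((m ℕ.+ m) ℕ.* (m ℕ.+ m)) * (q′ ^ l * q′ ^ l)  ≈⟨ *-congˡ (^-+ q′ l l) ⟨
    q′ ^ ((m ℕ.+ m) ℕ.* (m ℕ.+ m)) * q′ ^ (l ℕ.+ l)     ≈⟨ ^-+ q′ ((m ℕ.+ m) ℕ.* (m ℕ.+ m)) (l ℕ.+ l) ⟨
    q′ ^ ((m ℕ.+ m) ℕ.* (m ℕ.+ m) ℕ.+ (l ℕ.+ l))        ≡⟨ ≡.cong (q′ ^_) (eq m) ⟨
    q′ ^ ((suc m ℕ.+ suc m) ℕ.* (suc m ℕ.+ suc m))      ∎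
    where
    l = suc (m ℕ.* 2) ℕ.* 2
    eq : ∀ m → (suc m ℕ.+ suc m) ℕ.* (suc m ℕ.+ suc m) ≡ (m ℕ.+ m) ℕ.* (m ℕ.+ m) ℕ.+ (suc (m ℕ.* 2) ℕ.* 2 ℕ.+ suc (m ℕ.* 2) ℕ.* 2)
    eq = solve-∀

compose : ∀ {R S T} → Hom S T → Hom R S → Hom R T
compose {T = T} g f = record
  { ⟦_⟧     = g.⟦_⟧ ∘ f.⟦_⟧
  ; ⟦⟧-cong = g.⟦⟧-cong ∘ f.⟦⟧-cong
  ; +-homo  = λ x y → trans (g.⟦⟧-cong (f.+-homo x y)) (g.+-homo _ _)
  ; *-homo  = λ x y → trans (g.⟦⟧-cong (f.*-homo x y)) (g.*-homo _ _)
  ; -‿homo  = λ x → trans (g.⟦⟧-cong (f.-‿homo x)) (g.-‿homo _)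
  ; 0-homo  = trans (g.⟦⟧-cong f.0-homo) g.0-homo
  ; 1-homo  = trans (g.⟦⟧-cong f.1-homo) g.1-homo }
  where
  open CommutativeRing T using (trans)
  module g = Hom g
  module f = Hom f

modulusMultiple : ℕ → Poly
modulusMultiple n = ((oneP +P qpow n) *P (oneP +P qpow n)) *P ((oneP -P qpow (n ℕ.+ n)) *P (oneP -P qpow (n ℕ.+ n)))

module _ (L K : CRing) (eL : Hom ℤ[q] L) (ι : Hom L K) where
  private module L = CommutativeRing L
  open CommutativeRing K
  open Ops (ops L) using () renaming (_^_ to _^L_)
  open Ops (ops K) using (_^_)
  private
    ⟨_⟩ : Poly → CommutativeRing.Carrier L
    ⟨_⟩ = Hom.⟦_⟧ eL
  module _ (ι-injective : ∀ p r → Hom.⟦_⟧ ι ⟨ p ⟩ ≈ Hom.⟦_⟧ ι ⟨ r ⟩ → p ≋ r) (Good : Poly → Set)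
    (clear : ∀ y → Σ[ u ∈ Poly ] Σ[ v ∈ Poly ] Good v × ⟨ v ⟩ L.* y L.≈ ⟨ u ⟩) (m m′ : ℕ)
    (m≡ : m ≡ suc m′) where
    private
      n : ℕ
      n = suc (m ℕ.+ m)

    module ClearedCongruence (q⁻¹ half r : L.Carrier) (q-inv : ⟨ q ⟩ L.* q⁻¹ L.≈ L.1#)
      (half-inv : (L.1# L.+ L.1#) L.* half L.≈ L.1#) (r-inv : (L.1# L.+ ⟨ q ⟩) L.* r L.≈ L.1#)
      (unit : ∀ e → n ∤ e → Σ[ y ∈ L.Carrier ] (L.1# L.- ⟨ q ⟩ ^L e) L.* y L.≈ L.1#)
      (V : ℕ → Carrier) (V-inv : ∀ e → (1# - Hom.⟦_⟧ ι ⟨ q ⟩ ^ suc e) * V e ≈ 1#) where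
      open RingKit K hiding (_^_)
      open import Relation.Binary.Reasoning.Setoid setoid

      module IL = Image L eL
      module IK = Image K (compose ι eL)
      module Cmp = Comparison L K ι m m′ m≡ ⟨ q ⟩ q⁻¹ half r q-inv half-inv r-inv unit V V-inv
      open Cmp using (module LC)
      module ι = Hom ι
      open Sequences (ops K) IK.q′

      private
        br : Carrier
        br = IK.⟦ qint2 n ⟧

        br-eq : (1# - a) * br ≈ 1# - a * P ^ m
        br-eq = trans (IK.qint2-image n) (+-congˡ (-‿cong (trans (*-comm _ _) (*-congˡ (trans (^-+ a m m) (sym (*-^ a a m)))))))

        lhs-value : L.Carrier
        lhs-value = RingKit.△ L (λ j k → LC.c₀ j L.* LC.c₀ k) n

        cq-represented : ∀ k → k < n → IL.Represents (cq k) (LC.c₀ k)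
        cq-represented k k<n = IL.represents-cq r LC.v LC.w₀ r-inv k
          (λ i i<k → LC.v-inv-< i (ℕₚ.≤-<-trans i<k k<n))
          (λ i i<k → LC.w₀-inv i (ℕₚ.≤-<-trans i<k k<n))

        lhs-represented : IL.Represents (lhs n) lhs-value
        lhs-represented = IL.represents-sum _ _ n λ k k<n → IL.represents-sum _ _ (suc k) λ j j<1+k →
          IL.represents-* (cq j) (cq (k ∸ j)) (cq-represented j (ℕₚ.≤-<-trans (ℕₚ.≤-pred j<1+k) k<n))
                                              (cq-represented (k ∸ j) (ℕₚ.≤-<-trans (ℕₚ.m∸n≤m k j) k<n))

        inner-value : Carrier
        inner-value = sum (λ k → τ Cmp.vK Cmp.v₃ Cmp.v₅ k * prod (numX 0#) k) (suc m)

        inner-represented : IK.Represents (innerSum n) inner-value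
        inner-represented = ≡.subst (λ l → IK.Represents (sumF _ (suc l)) inner-value) (≡.sym half≡)
          (IK.represents-sum _ _ (suc m) λ k _ → IK.represents-inner Cmp.vK Cmp.v₃ Cmp.v₅ Cmp.vK-inv Cmp.v₃-inv Cmp.v₅-inv k)
          where
          half≡ : (m ℕ.+ m) / 2 ≡ m
          half≡ = ≡.trans (≡.cong (_/ 2) (double m)) (m*n/n≡m m 2)
            where
            double : ∀ m → m ℕ.+ m ≡ m ℕ.* 2
            double = solve-∀

        rhs-value : Carrier
        rhs-value = IK.⟦ (qint2 n *P qint2 n) *P qpow ((m ℕ.+ m) ℕ.* (m ℕ.+ m)) ⟧ * (inner-value * inner-value)

        rhs-represented : IK.Represents (rhs n) rhs-value
        rhs-represented = IK.represents-* (poly→F _) (innerSum n *F innerSum n) (IK.represents-poly _)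
          (IK.represents-* (innerSum n) (innerSum n) inner-represented inner-represented)

        root = Cmp.root br br-eq

        rhs-value≈ : rhs-value ≈ ι.⟦ root L.* root ⟧
        rhs-value≈ = begin
          IK.⟦ (qint2 n *P qint2 n) *P qpow ((m ℕ.+ m) ℕ.* (m ℕ.+ m)) ⟧ * (inner-value * inner-value)
            ≈⟨ *-congʳ (trans (IK.*-homo (qint2 n *P qint2 n) _) (*-cong (IK.*-homo (qint2 n) (qint2 n)) (trans (IK.qpow-image ((m ℕ.+ m) ℕ.* (m ℕ.+ m))) (sym (IK.ε²-image m))))) ⟩
          ((br * br) * (ε m * ε m)) * (inner-value * inner-value)
            ≈⟨ solve 3 (λ b e s → ((b ⊗ b) ⊗ (e ⊗ e)) ⊗ (s ⊗ s) ⊜ (e ⊗ (b ⊗ s)) ⊗ (e ⊗ (b ⊗ s))) refl br (ε m) inner-value ⟩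
          (ε m * (br * inner-value)) * (ε m * (br * inner-value))    ≈⟨ *-cong (Cmp.root≈ br br-eq) (Cmp.root≈ br br-eq) ⟨
          ι.⟦ root ⟧ * ι.⟦ root ⟧                                     ≈⟨ ι.*-homo root root ⟨
          ι.⟦ root L.* root ⟧                                         ∎

        multiple≈ : IL.⟦ modulusMultiple n ⟧ L.≈ (LC.W₁ L.* LC.W₁) L.* (LC.W L.* LC.W)
        multiple≈ = L.trans (IL.*-homo _ _) (L.*-cong (L.trans (IL.*-homo _ _) (L.*-cong W₁≈ W₁≈)) (L.trans (IL.*-homo _ _) (L.*-cong W≈ W≈)))
          where
          module KL = RingKit L
          open Exponents L ⟨ q ⟩
          module SL = Sequences (ops L) ⟨ q ⟩
          W₁≈ : IL.⟦ oneP +P qpow n ⟧ L.≈ LC.W₁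
          W₁≈ = L.trans (IL.+-homo oneP (qpow n)) (L.+-cong IL.1-homo (L.trans (IL.qpow-image n)
            (L.trans (L.*-comm _ _) (L.*-congˡ (L.trans (KL.^-+ ⟨ q ⟩ m m) (L.sym (KL.*-^ ⟨ q ⟩ ⟨ q ⟩ m)))))))
          W≈ : IL.⟦ oneP -P qpow (n ℕ.+ n) ⟧ L.≈ LC.W
          W≈ = L.trans (IL.1-qpow-image (n ℕ.+ n)) (L.+-congˡ (L.-‿cong (L.trans (L.reflexive (≡.cong (⟨ q ⟩ ^L_) (eq m))) (L.sym (aP^≈q^ m)))))
            where
            eq : ∀ m → suc (m ℕ.+ m) ℕ.+ suc (m ℕ.+ m) ≡ suc (m ℕ.* 2) ℕ.* 2
            eq = solve-∀

        module _ (N₁ D₁ N₂ D₂ u v : Poly) (y₁ U : L.Carrier) (y₂ : Carrier)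
          (e₁ : IL.Represents (N₁ , D₁) y₁) (e₂ : IK.Represents (N₂ , D₂) y₂)
          (cU : ⟨ v ⟩ L.* U L.≈ ⟨ u ⟩) (M : Poly)
          (diff : ι.⟦ y₁ ⟧ ≈ y₂ + ι.⟦ ⟨ M ⟩ L.* U ⟧) where

          cleared : v *P (N₁ *P D₂ -P N₂ *P D₁) ≋ M *P (u *P (D₁ *P D₂))
          cleared = ι-injective _ _ (begin
            IK.⟦ v *P (N₁ *P D₂ -P N₂ *P D₁) ⟧
              ≈⟨ trans (IK.*-homo v _) (*-congˡ (trans (IK.+-homo (N₁ *P D₂) _) (+-cong (IK.*-homo N₁ D₂) (trans (IK.-‿homo (N₂ *P D₁)) (-‿cong (IK.*-homo N₂ D₁)))))) ⟩
            V′ * (IK.⟦ N₁ ⟧ * d₂ - IK.⟦ N₂ ⟧ * d₁)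
              ≈⟨ *-congˡ (+-cong (*-congʳ (sym e₁′)) (-‿cong (*-congʳ (sym e₂)))) ⟩
            V′ * ((d₁ * ι.⟦ y₁ ⟧) * d₂ - (d₂ * y₂) * d₁)
              ≈⟨ *-congˡ (+-congʳ (*-congʳ (*-congˡ (trans diff (+-congˡ (ι.*-homo ⟨ M ⟩ U)))))) ⟩
            V′ * ((d₁ * (y₂ + IK.⟦ M ⟧ * ι.⟦ U ⟧)) * d₂ - (d₂ * y₂) * d₁)
              ≈⟨ solve 6 (λ v d₁ d₂ y M U → v ⊗ ((d₁ ⊗ (y ⊕ M ⊗ U)) ⊗ d₂ ⊖ (d₂ ⊗ y) ⊗ d₁) ⊜ M ⊗ ((v ⊗ U) ⊗ (d₁ ⊗ d₂))) refl V′ d₁ d₂ y₂ IK.⟦ M ⟧ ι.⟦ U ⟧ ⟩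
            IK.⟦ M ⟧ * ((V′ * ι.⟦ U ⟧) * (d₁ * d₂))   ≈⟨ *-congˡ (*-congʳ (trans (sym (ι.*-homo ⟨ v ⟩ U)) (ι.⟦⟧-cong cU))) ⟩
            IK.⟦ M ⟧ * (IK.⟦ u ⟧ * (d₁ * d₂))         ≈⟨ trans (IK.*-homo M _) (*-congˡ (trans (IK.*-homo u _) (*-congˡ (IK.*-homo D₁ D₂)))) ⟨
            IK.⟦ M *P (u *P (D₁ *P D₂)) ⟧             ∎)
            where
            V′ = IK.⟦ v ⟧
            d₁ = IK.⟦ D₁ ⟧
            d₂ = IK.⟦ D₂ ⟧
            e₁′ : d₁ * ι.⟦ y₁ ⟧ ≈ IK.⟦ N₁ ⟧
            e₁′ = trans (sym (ι.*-homo ⟨ D₁ ⟩ y₁)) (ι.⟦⟧-cong e₁)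

        U : L.Carrier
        U = Cmp.defect br br-eq

        cl : Σ[ u ∈ Poly ] Σ[ v ∈ Poly ] Good v × ⟨ v ⟩ L.* U L.≈ ⟨ u ⟩
        cl = clear U

      cleared-congruence : Σ[ u ∈ Poly ] Σ[ v ∈ Poly ] Good v ×
        v *P (proj₁ (lhs n) *P proj₂ (rhs n) -P proj₁ (rhs n) *P proj₂ (lhs n)) ≋ modulusMultiple n *P (u *P (proj₂ (lhs n) *P proj₂ (rhs n)))
      cleared-congruence = proj₁ cl , proj₁ (proj₂ cl) , proj₁ (proj₂ (proj₂ cl)) ,
        cleared (proj₁ (lhs n)) (proj₂ (lhs n)) (proj₁ (rhs n)) (proj₂ (rhs n)) (proj₁ cl) (proj₁ (proj₂ cl))
          lhs-value U rhs-value lhs-represented rhs-represented (proj₂ (proj₂ (proj₂ cl))) (modulusMultiple n)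
          (trans (ι.⟦⟧-cong (L.trans (Cmp.congruence br br-eq) (L.+-congˡ (L.*-congʳ (L.sym multiple≈)))))
            (trans (ι.+-homo (root L.* root) _) (+-congʳ (sym rhs-value≈))))

module P = CommutativeRing ℤ[q]
open Ops (ops ℤ[q]) using (prod; _^_)

coeff₀-1-q^ : ∀ e → coeff (oneP -P q ^ suc e) 0 ≡ ℤ.+ 1
coeff₀-1-q^ e = ≡.trans (coeff-+ oneP (negP (q ^ suc e)) 0) (≡.cong (λ c → ℤ.+ 1 ℤ.+ c)
  (≡.trans (coeff-neg (q ^ suc e) 0) (≡.cong ℤ.-_ (_≋_.at (P.trans (P.*-comm (q ^ e) q) (q-* (q ^ e))) 0))))

1-q^-regular : ∀ e → Regular (oneP -P q ^ suc e)
1-q^-regular e = coeff₀≢0⇒regular (oneP -P q ^ suc e) λ p → contradiction (≡.trans (≡.sym (coeff₀-1-q^ e)) p) λ ()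

X-regular : ∀ e → Regular (q ^ suc e -P oneP)
X-regular e x y p = 1-q^-regular e x y (P.trans (negated x) (P.trans (P.-‿cong p) (P.sym (negated y))))
  where
  open RingKit ℤ[q] using (solve; _⊜_; _⊗_; _⊖_; ⊝_; 𝟙)
  negated : ∀ x → (oneP -P q ^ suc e) *P x ≋ negP ((q ^ suc e -P oneP) *P x)
  negated x = solve 2 (λ p x → (𝟙 ⊖ p) ⊗ x ⊜ ⊝ ((p ⊖ 𝟙) ⊗ x)) P.refl (q ^ suc e) x

const-0 : constP (ℤ.+ 0) ≋ []
const-0 = by-coeff λ { zero → ≡.refl ; (suc _) → ≡.refl }

const-suc : ∀ k → constP (ℤ.+ k) +P oneP ≋ constP (ℤ.+ suc k)
const-suc k = P.reflexive (≡.cong (λ l → constP (ℤ.+ l)) (ℕₚ.+-comm k 1))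

module Rational = RationalDivisibility ℤ[q] q constP const-0 P.refl const-suc const-* X-regular
open Rational using (NonZeroConst; ⟪_⟫; Cop; _∣ℚ_; select; divisorProduct; cop-*; cop-sym; cop-1)

-- newΦ is analysed through the shape of its value on a cons, because the list of factors that it
-- multiplies is private to Defs.
module _ where
  open RingKit ℤ[q] using (solve; _⊜_; _⊗_; 𝟙)

  private
    num-if : ∀ b x f (ys : List Frac) →
      x *P proj₂ (prodF (if b then f ∷ ys else ys)) ≋ (if b then proj₂ f else oneP) *P (x *P proj₂ (prodF ys))
    num-if true  x f ys = solve 3 (λ x f y → x ⊗ (f ⊗ y) ⊜ f ⊗ (x ⊗ y)) P.refl x (proj₂ f) (proj₂ (prodF ys))
    num-if false x f ys = P.sym (P.*-identityˡ (x *P proj₂ (prodF ys)))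

    den-if : ∀ b f (ys : List Frac) →
      oneP *P proj₁ (prodF (if b then f ∷ ys else ys)) ≋ (if b then proj₁ f else oneP) *P (oneP *P proj₁ (prodF ys))
    den-if true  f ys = solve 2 (λ f y → 𝟙 ⊗ (f ⊗ y) ⊜ f ⊗ (𝟙 ⊗ y)) P.refl (proj₁ f) (proj₁ (prodF ys))
    den-if false f ys = P.sym (P.*-identityˡ (oneP *P proj₁ (prodF ys)))

  newΦ-num-∷ : ∀ n d f xs → proj₁ (newΦ n ((d , f) ∷ xs)) ≋ (if does (d ∣? n) then proj₂ f else oneP) *P proj₁ (newΦ n xs)
  newΦ-num-∷ n d f xs = num-if (does (d ∣? n)) (qpow n -P oneP) f _

  newΦ-den-∷ : ∀ n d f xs → proj₂ (newΦ n ((d , f) ∷ xs)) ≋ (if does (d ∣? n) then proj₁ f else oneP) *P proj₂ (newΦ n xs)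
  newΦ-den-∷ n d f xs = den-if (does (d ∣? n)) f _

module DivisorFold (n : ℕ) (G : List (ℕ × Frac) → Poly) (π : Frac → Poly)
  (G-∷ : ∀ d f xs → G ((d , f) ∷ xs) ≋ (if does (d ∣? n) then π f else oneP) *P G xs) where

  G-snoc : ∀ d f xs → G (xs ++ (d , f) ∷ []) ≋ G xs *P (if does (d ∣? n) then π f else oneP)
  G-snoc d f []              = P.trans (G-∷ d f []) (P.*-comm (if does (d ∣? n) then π f else oneP) (G []))
  G-snoc d f ((d′ , f′) ∷ xs) = P.trans (G-∷ d′ f′ (xs ++ (d , f) ∷ []))
    (P.trans (P.*-cong (P.refl {s′}) (G-snoc d f xs))
    (P.trans (P.sym (P.*-assoc s′ (G xs) s)) (P.*-cong (P.sym (G-∷ d′ f′ xs)) (P.refl {s}))))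
    where
    s s′ : Poly
    s  = if does (d ∣? n) then π f else oneP
    s′ = if does (d′ ∣? n) then π f′ else oneP

  G-cycUpTo : ∀ j → G (cycUpTo j) ≋ G [] *P divisorProduct (λ i → π (Φ (suc i))) n j
  G-cycUpTo zero    = P.sym (P.*-identityʳ (G []))
  G-cycUpTo (suc j) = P.trans (G-snoc (suc j) (Φ (suc j)) (cycUpTo j))
    (P.trans (P.*-cong (G-cycUpTo j) (P.refl {s})) (P.*-assoc (G []) (divisorProduct (λ i → π (Φ (suc i))) n j) s))
    where
    s : Poly
    s = if does (suc j ∣? n) then π (Φ (suc j)) else oneP

Φ-num Φ-den : ℕ → Poly
Φ-num i = proj₁ (Φ (suc i))
Φ-den i = proj₂ (Φ (suc i))

Φ-num≋ : ∀ m → Φ-num m ≋ Rational.X (suc m) *P divisorProduct Φ-den (suc m) m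
Φ-num≋ m = P.trans (DivisorFold.G-cycUpTo (suc m) (λ xs → proj₁ (newΦ (suc m) xs)) proj₂ (newΦ-num-∷ (suc m)) m)
  (P.*-cong (P.trans (P.*-identityʳ (qpow (suc m) -P oneP)) (P.+-cong (qpow≋ (suc m)) (P.refl {negP oneP})))
            (P.refl {divisorProduct Φ-den (suc m) m}))

Φ-den≋ : ∀ m → Φ-den m ≋ divisorProduct Φ-num (suc m) m
Φ-den≋ m = P.trans (DivisorFold.G-cycUpTo (suc m) (λ xs → proj₂ (newΦ (suc m) xs)) proj₁ (newΦ-den-∷ (suc m)) m)
  (P.*-identityˡ (divisorProduct Φ-num (suc m) m))

≋⇒≡F : ∀ x y P →
  (Σ[ U ∈ Poly ] Σ[ V ∈ Poly ]
    (Σ[ s ∈ Poly ] Σ[ t ∈ Poly ] Σ[ c ∈ ℤ ] c ≡.≢ ℤ.+ 0 × (s *P V) *P proj₂ P +P t *P proj₁ P ≋ constP c *P proj₂ P)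
    × (V *P (proj₁ x *P proj₂ y -P proj₁ y *P proj₂ x)) *P proj₂ P ≋ (proj₁ P *P U) *P (proj₂ x *P proj₂ y)) →
  x ≡F y [mod P ]
≋⇒≡F (N₁ , D₁) (N₂ , D₂) (A , B) (U , V , (s , t , c , c≢0 , e) , e′) =
  U , V , (s , t , c , c≢0 , ≋⇒≈P ((s *P V) *P B +P t *P A) (scaleP c B) (P.trans e (P.sym (scale≋ c B)))) ,
  ≋⇒≈P ((V *P (N₁ *P D₂ -P N₂ *P D₁)) *P B) ((A *P U) *P (D₁ *P D₂)) e′

alt-q : altP q ≋ negP q
alt-q = P.refl

module Odd (m m′ : ℕ) (m≡ : m ≡ suc m′) where

  n : ℕ
  n = suc (m ℕ.+ m)

  private
    cyclotomic = Rational.polynomial-factors Φ-num Φ-den Φ-num≋ Φ-den≋ n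
    φ = proj₁ cyclotomic
    factorises = proj₁ (proj₂ cyclotomic)
    represents = proj₂ (proj₂ cyclotomic)

    ψ : Poly
    ψ = φ (m ℕ.+ m)

  open Rational.Alternation alt alt-q (λ _ → P.refl) m ψ (Rational.φ∣X factorises (m ℕ.+ m) ℕₚ.≤-refl)
    (λ e → Rational.X-cop-φ factorises e (m ℕ.+ m) ℕₚ.≤-refl) (λ e n∤e → n∤e ∘ odd∣2*⇒∣ m e)
    using (M; M∣; 1-q^-cop; 1+q-cop; q-cop; 2-cop; conclude)

  Good : Poly → Set
  Good p = Regular p × Cop p M

  1-regular : Regular oneP
  1-regular x y e = P.trans (P.sym (P.*-identityˡ x)) (P.trans e (P.*-identityˡ y))

  1-good : Good oneP
  1-good = 1-regular , cop-1 M

  good-* : ∀ {x y} → Good x → Good y → Good (x *P y)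
  good-* {x} {y} (r , c) (r′ , c′) = regular-* {x} {y} r r′ , cop-* {x} {y} {M} c c′

  open Localization ℤ[q] Good 1-good (λ {x} {y} → good-* {x} {y}) proj₁
    renaming (Loc to L; embed to embedL)
    using (Fraction; _over_by_; num; den; den∈S; embed-inv)
  module K = Localization ℤ[q] Regular 1-regular (λ {x} {y} → regular-* {x} {y}) (λ r → r)

  ι : Hom L K.Loc
  ι = record
    { ⟦_⟧ = λ x → num x K.over den x by proj₁ (den∈S x)
    ; ⟦⟧-cong = λ e → e
    ; +-homo = λ _ _ → P.refl ; *-homo = λ _ _ → P.refl ; -‿homo = λ _ → P.refl ; 0-homo = P.refl ; 1-homo = P.refl }

  private
    module L = CommutativeRing L
    open RingKit ℤ[q] using (solve; _⊜_; _⊕_; _⊗_; 𝟙)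
    open Ops (ops L) using () renaming (_^_ to _^L_)
    open Ops (ops K.Loc) using () renaming (_^_ to _^K_)
    module KK = CommutativeRing K.Loc
    ⟨_⟩ = Hom.⟦_⟧ embedL

    1/_ : ∀ {s} → Good s → Fraction
    1/_ {s} g = oneP over s by g

    q-good : Good q
    q-good = q-regular , q-cop

    n∤1 : n ∤ 1
    n∤1 = >⇒∤ (s≤s (≡.subst (λ l → 1 ≤ l ℕ.+ l) (≡.sym m≡) (s≤s z≤n)))

    2-good : Good (oneP +P oneP)
    2-good = coeff₀≢0⇒regular (oneP +P oneP) (λ ()) , 2-cop

    1+q-good : Good (oneP +P q)
    1+q-good = coeff₀≢0⇒regular (oneP +P q) (λ ()) , 1+q-cop n∤1

    1-q^-good : ∀ e → n ∤ suc e → Good (oneP -P q ^ suc e)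
    1-q^-good e n∤ = 1-q^-regular e , 1-q^-cop (suc e) n∤

    unit : ∀ e → n ∤ e → Σ[ y ∈ Fraction ] (L.1# L.- ⟨ q ⟩ ^L e) L.* y L.≈ L.1#
    unit zero    n∤ = contradiction (n ∣0) n∤
    unit (suc e) n∤ = 1/ g , Hom.1-^-unit embedL q (suc e) {1/ g} (embed-inv (oneP -P q ^ suc e) g)
      where g = 1-q^-good e n∤

    V : ℕ → K.Fraction
    V e = oneP K.over (oneP -P q ^ suc e) by 1-q^-regular e

    V-inv : ∀ e → (KK.1# KK.- Hom.⟦_⟧ K.embed q ^K suc e) KK.* V e KK.≈ KK.1#
    V-inv e = Hom.1-^-unit K.embed q (suc e) {V e} (K.embed-inv (oneP -P q ^ suc e) (1-q^-regular e))

    clear : ∀ y → Σ[ u ∈ Poly ] Σ[ v ∈ Poly ] Good v × ⟨ v ⟩ L.* y L.≈ ⟨ u ⟩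
    clear (u over v by g) = u , v , g , solve 2 (λ u v → (v ⊗ u) ⊗ 𝟙 ⊜ u ⊗ (𝟙 ⊗ v)) P.refl u v

  open ClearedCongruence L K.Loc embedL ι
    (λ p r e → P.trans (P.sym (P.*-identityʳ p)) (P.trans e (P.*-identityʳ r)))
    Good clear m m′ m≡ (1/ q-good) (1/ 2-good) (1/ 1+q-good)
    (embed-inv q q-good)
    (solve 0 (((𝟙 ⊗ 𝟙 ⊕ 𝟙 ⊗ 𝟙) ⊗ 𝟙) ⊗ 𝟙 ⊜ 𝟙 ⊗ ((𝟙 ⊗ 𝟙) ⊗ (𝟙 ⊕ 𝟙))) P.refl)
    (solve 1 (λ q → ((𝟙 ⊗ 𝟙 ⊕ q ⊗ 𝟙) ⊗ 𝟙) ⊗ 𝟙 ⊜ 𝟙 ⊗ ((𝟙 ⊗ 𝟙) ⊗ (𝟙 ⊕ q))) P.refl q)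
    unit V V-inv

  private
    u v N D : Poly
    u = proj₁ cleared-congruence
    v = proj₁ (proj₂ cleared-congruence)
    N = proj₁ (lhs n) *P proj₂ (rhs n) -P proj₁ (rhs n) *P proj₂ (lhs n)
    D = proj₂ (lhs n) *P proj₂ (rhs n)

    v-good : Good v
    v-good = proj₁ (proj₂ (proj₂ cleared-congruence))

    M∣multiple : M ∣ℚ modulusMultiple n
    M∣multiple = Rational.∣ℚ-trans {M} {W′} {modulusMultiple n} M∣ (Rational.∣⇒∣ℚ {W′} {modulusMultiple n} oneP
      (P.trans (P.*-identityʳ W′) (P.sym (P.*-cong (P.*-cong W₁≋ W₁≋) (P.*-cong W≋ W≋)))))
      where
      w₁ w W′ : Poly
      w₁ = oneP +P q ^ n
      w  = oneP -P q ^ (n ℕ.+ n)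
      W′ = (w₁ *P w₁) *P (w *P w)
      W₁≋ : oneP +P qpow n ≋ w₁
      W₁≋ = P.+-cong (P.refl {oneP}) (qpow≋ n)
      W≋ : oneP -P qpow (n ℕ.+ n) ≋ w
      W≋  = P.+-cong (P.refl {oneP}) (P.-‿cong (qpow≋ (n ℕ.+ n)))

  theorem : lhs n ≡F rhs n [mod modulus n ]
  theorem = ≋⇒≡F (lhs n) (rhs n) (modulus n)
    (conclude (Φ-num (m ℕ.+ m)) (Φ-den (m ℕ.+ m)) (proj₁ (represents (m ℕ.+ m) ℕₚ.≤-refl)) (proj₂ (represents (m ℕ.+ m) ℕₚ.≤-refl))
      N D u v (modulusMultiple n) (proj₂ (proj₂ (proj₂ cleared-congruence))) M∣multiple (proj₂ v-good))

theorem1p2 : (n : ℕ) → 1 < n → n % 2 ≡ 1 →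
    lhs n ≡F rhs n [mod modulus n ]
theorem1p2 n 1<n n%2≡1 = ≡.subst (λ n → lhs n ≡F rhs n [mod modulus n ]) (≡.sym n≡) (Odd.theorem m (ℕ.pred m) m≡)
  where
  m = n / 2
  n≡ : n ≡ suc (m ℕ.+ m)
  n≡ = ≡.trans (m≡m%n+[m/n]*n n 2) (≡.cong₂ ℕ._+_ n%2≡1 (≡.trans (ℕₚ.*-comm m 2) (≡.cong (m ℕ.+_) (ℕₚ.+-identityʳ m))))
  m≢0 : m ≡.≢ 0
  m≢0 m≡0 = ℕₚ.<-irrefl (≡.sym (≡.trans n≡ (≡.cong (λ l → suc (l ℕ.+ l)) m≡0))) 1<n
  m≡ : m ≡ suc (ℕ.pred m)
  m≡ = ≡.sym (ℕₚ.suc-pred m {{ℕ.≢-nonZero m≢0}})
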